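{- Let $p>3$ be a prime and let $k$ be an integer. Then the $\eta$-quotients of level $p$ lying in $M_k(\Gamma_1(p))$ are linearly independent over $\mathbb C$.
   Context: $\eta(z)=q^{1/24}\prod_{n\ge1}(1-q^n)$ with $q=e^{2\pi i z}$, for $z$ in the upper half plane. An $\eta$-quotient of level $p$ ($p$ prime) is a function $\eta(z)^{r_1}\eta(pz)^{r_p}$ with $r_1,r_p\in\mathbb Z$; its weight is $\frac12(r_1+r_p)$. $\Gamma_1(p)$ is the group of matrices in $\mathrm{SL}_2(\mathbb Z)$ congruent to $\begin{pmatrix}1&*\\0&1\end{pmatrix}$ modulo $p$, and $M_k(\Gamma_1(p))$ is the space of (holomorphic) modular forms of weight $k$ for $\Gamma_1(p)$. -}

module Defs where

open import Algebra.Bundles using (RawRing)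
import Algebra.Definitions.RawSemiring as RawSemiringDefs
open import Data.Fin using (Fin; toℕ)
open import Data.Integer as ℤ using (ℤ; +_; -[1+_])
import Data.Integer.Divisibility as ℤ
open import Data.Nat as ℕ using (ℕ; suc)
import Data.Nat.Combinatorics as ℕ
import Data.Nat.Properties as ℕ
open import Data.Product using (Σ; ∃-syntax; _×_; _,_)
open import Data.Rational as ℚ using (ℚ; 0ℚ; 1ℚ; ½)
import Data.Rational.Properties as ℚ
open import Data.Rational.Solver using (module +-*-Solver)
open import Function.Bundles using (Func)
open import Function.Definitions using (Injective)
open import Level using (0ℓ)
open import Relation.Binary.Bundles using (Setoid)
open import Relation.Binary.PropositionalEquality
  using (_≡_; refl; sym; trans; cong; cong₂; subst)
open import Relation.Nullary using (¬_)

Eventually : (ℕ → Set) → Set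
Eventually P = ∃[ N ] (∀ n → N ℕ.≤ n → P n)

IsCauchy : (ℕ → ℚ) → Set
IsCauchy x = ∀ ε → 0ℚ ℚ.< ε →
  ∃[ N ] (∀ m n → N ℕ.≤ m → N ℕ.≤ n → ℚ.∣ x m ℚ.- x n ∣ ℚ.< ε)

record ℝ : Set where
  constructor mkℝ
  field
    seq    : ℕ → ℚ
    cauchy : IsCauchy seq

open ℝ public

infix 4 _≈ℝ_ _<ℝ_ _≤ℝ_

_≈ℝ_ : ℝ → ℝ → Set
x ≈ℝ y = ∀ ε → 0ℚ ℚ.< ε → Eventually λ n → ℚ.∣ seq x n ℚ.- seq y n ∣ ℚ.< ε

_<ℝ_ : ℝ → ℝ → Set
x <ℝ y = ∃[ ε ] (0ℚ ℚ.< ε × Eventually λ n → seq x n ℚ.+ ε ℚ.≤ seq y n)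

_≤ℝ_ : ℝ → ℝ → Set
x ≤ℝ y = ¬ (y <ℝ x)

private
  ½-pos : ∀ {ε} → 0ℚ ℚ.< ε → 0ℚ ℚ.< ½ ℚ.* ε
  ½-pos {ε} 0<ε = subst (ℚ._< ½ ℚ.* ε) (ℚ.*-zeroʳ ½) (ℚ.*-monoʳ-<-pos ½ 0<ε)

  ½+½ : ∀ ε → ½ ℚ.* ε ℚ.+ ½ ℚ.* ε ≡ ε
  ½+½ ε = trans (sym (ℚ.*-distribʳ-+ ε ½ ½)) (ℚ.*-identityˡ ε)

  +-<-½ : ∀ {a b ε} → a ℚ.< ½ ℚ.* ε → b ℚ.< ½ ℚ.* ε → a ℚ.+ b ℚ.< ε
  +-<-½ {ε = ε} a< b< = subst (_ ℚ.<_) (½+½ ε) (ℚ.+-mono-< a< b<)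

  self-diff : ∀ a → ℚ.∣ a ℚ.- a ∣ ≡ 0ℚ
  self-diff a = cong ℚ.∣_∣ (ℚ.+-inverseʳ a)

  diff-sym : ∀ a b → ℚ.∣ a ℚ.- b ∣ ≡ ℚ.∣ b ℚ.- a ∣
  diff-sym a b = trans (sym (ℚ.∣-p∣≡∣p∣ (a ℚ.- b))) (cong ℚ.∣_∣
    (solve 2 (λ a b → :- (a :- b) := b :- a) refl a b))
    where open +-*-Solver

  triangle : ∀ a b c → ℚ.∣ a ℚ.- c ∣ ℚ.≤ ℚ.∣ a ℚ.- b ∣ ℚ.+ ℚ.∣ b ℚ.- c ∣
  triangle a b c = subst (λ t → ℚ.∣ t ∣ ℚ.≤ ℚ.∣ a ℚ.- b ∣ ℚ.+ ℚ.∣ b ℚ.- c ∣)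
    (solve 3 (λ a b c → (a :- b) :+ (b :- c) := a :- c) refl a b c)
    (ℚ.∣p+q∣≤∣p∣+∣q∣ (a ℚ.- b) (b ℚ.- c))
    where open +-*-Solver

  product-diff : ∀ a b c d → ℚ.∣ a ℚ.* b ℚ.- c ℚ.* d ∣
    ℚ.≤ ℚ.∣ a ∣ ℚ.* ℚ.∣ b ℚ.- d ∣ ℚ.+ ℚ.∣ d ∣ ℚ.* ℚ.∣ a ℚ.- c ∣
  product-diff a b c d = begin
    ℚ.∣ a ℚ.* b ℚ.- c ℚ.* d ∣
      ≡⟨ cong ℚ.∣_∣ (solve 4 (λ a b c d →
           a :* b :- c :* d := a :* (b :- d) :+ d :* (a :- c)) refl a b c d) ⟩
    ℚ.∣ a ℚ.* (b ℚ.- d) ℚ.+ d ℚ.* (a ℚ.- c) ∣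
      ≤⟨ ℚ.∣p+q∣≤∣p∣+∣q∣ (a ℚ.* (b ℚ.- d)) (d ℚ.* (a ℚ.- c)) ⟩
    ℚ.∣ a ℚ.* (b ℚ.- d) ∣ ℚ.+ ℚ.∣ d ℚ.* (a ℚ.- c) ∣
      ≡⟨ cong₂ ℚ._+_ (ℚ.∣p*q∣≡∣p∣*∣q∣ a (b ℚ.- d)) (ℚ.∣p*q∣≡∣p∣*∣q∣ d (a ℚ.- c)) ⟩
    ℚ.∣ a ∣ ℚ.* ℚ.∣ b ℚ.- d ∣ ℚ.+ ℚ.∣ d ∣ ℚ.* ℚ.∣ a ℚ.- c ∣ ∎
    where
    open +-*-Solver
    open ℚ.≤-Reasoning

  product-close : ∀ ε a b c d →
    ℚ.∣ a ∣ ℚ.* ℚ.∣ b ℚ.- d ∣ ℚ.< ½ ℚ.* ε →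
    ℚ.∣ d ∣ ℚ.* ℚ.∣ a ℚ.- c ∣ ℚ.< ½ ℚ.* ε →
    ℚ.∣ a ℚ.* b ℚ.- c ℚ.* d ∣ ℚ.< ε
  product-close ε a b c d p q = ℚ.≤-<-trans (product-diff a b c d)
    (+-<-½ {ℚ.∣ a ∣ ℚ.* ℚ.∣ b ℚ.- d ∣} {ℚ.∣ d ∣ ℚ.* ℚ.∣ a ℚ.- c ∣} {ε} p q)

  eventually-bounded : (x : ℝ) →
    ∃[ B ] (0ℚ ℚ.< B × Eventually λ n → ℚ.∣ seq x n ∣ ℚ.≤ B)
  eventually-bounded x with cauchy x 1ℚ (ℚ.positive⁻¹ 1ℚ)
  ... | N , close = B , 0<B , N , bound
    where
    xN = seq x N
    B = 1ℚ ℚ.+ ℚ.∣ xN ∣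
    0<B : 0ℚ ℚ.< B
    0<B = ℚ.+-mono-<-≤ (ℚ.positive⁻¹ 1ℚ) (ℚ.0≤∣p∣ xN)
    bound : ∀ n → N ℕ.≤ n → ℚ.∣ seq x n ∣ ℚ.≤ B
    bound n N≤n = ℚ.≤-trans
      (subst (λ t → ℚ.∣ t ∣ ℚ.≤ ℚ.∣ seq x n ℚ.- xN ∣ ℚ.+ ℚ.∣ xN ∣)
        (solve 2 (λ a b → (a :- b) :+ b := a) refl (seq x n) xN)
        (ℚ.∣p+q∣≤∣p∣+∣q∣ (seq x n ℚ.- xN) xN))
      (ℚ.+-monoˡ-≤ ℚ.∣ xN ∣ (ℚ.<⇒≤ (close n N N≤n ℕ.≤-refl)))
      where open +-*-Solver

  shrink : ∀ B ε → 0ℚ ℚ.< B → 0ℚ ℚ.< ε → ∃[ δ ] (0ℚ ℚ.< δ ×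
    (∀ a b → ℚ.∣ a ∣ ℚ.≤ B → ℚ.∣ b ∣ ℚ.< δ → ℚ.∣ a ∣ ℚ.* ℚ.∣ b ∣ ℚ.< ½ ℚ.* ε))
  shrink B ε 0<B 0<ε = δ , 0<δ , small
    where
    instance
      B-pos : ℚ.Positive B
      B-pos = ℚ.positive 0<B
      B-nz : ℚ.NonZero B
      B-nz = ℚ.pos⇒nonZero B
      1/B-pos : ℚ.Positive (ℚ.1/ B)
      1/B-pos = ℚ.1/pos⇒pos B
    δ = ℚ.1/ B ℚ.* (½ ℚ.* ε)
    0<δ : 0ℚ ℚ.< δ
    0<δ = subst (ℚ._< δ) (ℚ.*-zeroʳ (ℚ.1/ B)) (ℚ.*-monoʳ-<-pos (ℚ.1/ B) (½-pos 0<ε))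
    Bδ : B ℚ.* δ ≡ ½ ℚ.* ε
    Bδ = trans (sym (ℚ.*-assoc B (ℚ.1/ B) (½ ℚ.* ε)))
      (trans (cong (ℚ._* (½ ℚ.* ε)) (ℚ.*-inverseʳ B)) (ℚ.*-identityˡ (½ ℚ.* ε)))
    small : ∀ a b → ℚ.∣ a ∣ ℚ.≤ B → ℚ.∣ b ∣ ℚ.< δ → ℚ.∣ a ∣ ℚ.* ℚ.∣ b ∣ ℚ.< ½ ℚ.* ε
    small a b a≤B b<δ = ℚ.≤-<-trans
      (ℚ.*-monoʳ-≤-nonNeg ℚ.∣ b ∣ {{ℚ.∣-∣-nonNeg b}} a≤B)
      (subst (B ℚ.* ℚ.∣ b ∣ ℚ.<_) Bδ (ℚ.*-monoʳ-<-pos B b<δ))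

≈ℝ-refl : ∀ {x} → x ≈ℝ x
≈ℝ-refl {x} ε 0<ε = 0 , λ n _ → subst (ℚ._< ε) (sym (self-diff (seq x n))) 0<ε

≈ℝ-sym : ∀ {x y} → x ≈ℝ y → y ≈ℝ x
≈ℝ-sym {x} {y} x≈y ε 0<ε with x≈y ε 0<ε
... | N , h = N , λ n N≤n → subst (ℚ._< ε) (diff-sym (seq x n) (seq y n)) (h n N≤n)

≈ℝ-trans : ∀ {x y z} → x ≈ℝ y → y ≈ℝ z → x ≈ℝ z
≈ℝ-trans {x} {y} {z} x≈y y≈z ε 0<ε
  with x≈y (½ ℚ.* ε) (½-pos 0<ε) | y≈z (½ ℚ.* ε) (½-pos 0<ε)
... | M , h | N , k = M ℕ.⊔ N , λ n le → ℚ.≤-<-trans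
  (triangle (seq x n) (seq y n) (seq z n))
  (+-<-½ {ε = ε} (h n (ℕ.m⊔n≤o⇒m≤o M N le)) (k n (ℕ.m⊔n≤o⇒n≤o M N le)))

ℚ→ℝ : ℚ → ℝ
ℚ→ℝ a = mkℝ (λ _ → a) λ ε 0<ε → 0 , λ _ _ _ _ → subst (ℚ._< ε) (sym (self-diff a)) 0<ε

0ℝ 1ℝ : ℝ
0ℝ = ℚ→ℝ 0ℚ
1ℝ = ℚ→ℝ 1ℚ

infixl 6 _+ℝ_ _-ℝ_
infixl 7 _*ℝ_
infix  8 -ℝ_

_+ℝ_ : ℝ → ℝ → ℝ
x +ℝ y = mkℝ (λ n → seq x n ℚ.+ seq y n) cauchy-+
  where
  open +-*-Solver
  cauchy-+ : IsCauchy (λ n → seq x n ℚ.+ seq y n)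
  cauchy-+ ε 0<ε with cauchy x (½ ℚ.* ε) (½-pos 0<ε) | cauchy y (½ ℚ.* ε) (½-pos 0<ε)
  ... | M , h | N , k = M ℕ.⊔ N , λ m n le le′ → ℚ.≤-<-trans
    (subst (λ t → ℚ.∣ t ∣ ℚ.≤ ℚ.∣ seq x m ℚ.- seq x n ∣ ℚ.+ ℚ.∣ seq y m ℚ.- seq y n ∣)
      (solve 4 (λ a b c d → (a :- b) :+ (c :- d) := (a :+ c) :- (b :+ d)) refl
        (seq x m) (seq x n) (seq y m) (seq y n))
      (ℚ.∣p+q∣≤∣p∣+∣q∣ (seq x m ℚ.- seq x n) (seq y m ℚ.- seq y n)))
    (+-<-½ {ε = ε}
      (h m n (ℕ.m⊔n≤o⇒m≤o M N le) (ℕ.m⊔n≤o⇒m≤o M N le′))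
      (k m n (ℕ.m⊔n≤o⇒n≤o M N le) (ℕ.m⊔n≤o⇒n≤o M N le′)))

-ℝ_ : ℝ → ℝ
-ℝ x = mkℝ (λ n → ℚ.- seq x n) cauchy-neg
  where
  open +-*-Solver
  cauchy-neg : IsCauchy (λ n → ℚ.- seq x n)
  cauchy-neg ε 0<ε with cauchy x ε 0<ε
  ... | N , h = N , λ m n le le′ → subst (ℚ._< ε)
    (trans (diff-sym (seq x m) (seq x n)) (cong ℚ.∣_∣
      (solve 2 (λ a b → b :- a := (:- a) :- (:- b)) refl (seq x m) (seq x n))))
    (h m n le le′)

_-ℝ_ : ℝ → ℝ → ℝ
x -ℝ y = x +ℝ -ℝ y

_*ℝ_ : ℝ → ℝ → ℝ
x *ℝ y = mkℝ (λ n → seq x n ℚ.* seq y n) cauchy-*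
  where
  cauchy-* : IsCauchy (λ n → seq x n ℚ.* seq y n)
  cauchy-* ε 0<ε =
    let A , 0<A , N₁ , x≤A = eventually-bounded x
        B , 0<B , N₂ , y≤B = eventually-bounded y
        δ , 0<δ , small-x  = shrink A ε 0<A 0<ε
        δ′ , 0<δ′ , small-y = shrink B ε 0<B 0<ε
        N₃ , h = cauchy y δ 0<δ
        N₄ , k = cauchy x δ′ 0<δ′
        M = N₁ ℕ.⊔ N₂
        N = N₃ ℕ.⊔ N₄
    in M ℕ.⊔ N , λ m n le le′ →
      product-close ε (seq x m) (seq y m) (seq x n) (seq y n)
        (small-x (seq x m) (seq y m ℚ.- seq y n)
          (x≤A m (ℕ.m⊔n≤o⇒m≤o N₁ N₂ (ℕ.m⊔n≤o⇒m≤o M N le)))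
          (h m n (ℕ.m⊔n≤o⇒m≤o N₃ N₄ (ℕ.m⊔n≤o⇒n≤o M N le))
                 (ℕ.m⊔n≤o⇒m≤o N₃ N₄ (ℕ.m⊔n≤o⇒n≤o M N le′))))
        (small-y (seq y n) (seq x m ℚ.- seq x n)
          (y≤B n (ℕ.m⊔n≤o⇒n≤o N₁ N₂ (ℕ.m⊔n≤o⇒m≤o M N le′)))
          (k m n (ℕ.m⊔n≤o⇒n≤o N₃ N₄ (ℕ.m⊔n≤o⇒n≤o M N le))
                 (ℕ.m⊔n≤o⇒n≤o N₃ N₄ (ℕ.m⊔n≤o⇒n≤o M N le′))))

record ℂ : Set where
  constructor _+i_
  field
    re im : ℝ

open ℂ public

ℂ-rawRing : RawRing 0ℓ 0ℓ
ℂ-rawRing = record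
  { Carrier = ℂ
  ; _≈_ = λ z w → re z ≈ℝ re w × im z ≈ℝ im w
  ; _+_ = λ z w → (re z +ℝ re w) +i (im z +ℝ im w)
  ; _*_ = λ z w → (re z *ℝ re w -ℝ im z *ℝ im w) +i (re z *ℝ im w +ℝ im z *ℝ re w)
  ; -_  = λ z → (-ℝ re z) +i (-ℝ im z)
  ; 0#  = 0ℝ +i 0ℝ
  ; 1#  = 1ℝ +i 0ℝ
  }

open RawRing ℂ-rawRing public
  using (_≈_; _+_; _*_; -_) renaming (0# to 0ℂ; 1# to 1ℂ)
open RawSemiringDefs (RawRing.rawSemiring ℂ-rawRing) public
  using (_^_; sum; product)

infixl 6 _-_
_-_ : ℂ → ℂ → ℂ
z - w = z + (- w)

ℂ-setoid : Setoid 0ℓ 0ℓ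
ℂ-setoid = record
  { Carrier = ℂ
  ; _≈_ = _≈_
  ; isEquivalence = record
    { refl  = λ {z} → ≈ℝ-refl {re z} , ≈ℝ-refl {im z}
    ; sym   = λ {z} {w} (p , q) → ≈ℝ-sym {re z} {re w} p , ≈ℝ-sym {im z} {im w} q
    ; trans = λ {z} {w} {v} (p , q) (p′ , q′) →
        ≈ℝ-trans {re z} {re w} {re v} p p′ , ≈ℝ-trans {im z} {im w} {im v} q q′
    }
  }

ℝ→ℂ : ℝ → ℂ
ℝ→ℂ x = x +i 0ℝ

ℚ→ℂ : ℚ → ℂ
ℚ→ℂ a = ℝ→ℂ (ℚ→ℝ a)

ℤ→ℂ : ℤ → ℂ
ℤ→ℂ a = ℚ→ℂ (a ℚ./ 1)

i : ℂ
i = 0ℝ +i 1ℝ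

∣_∣² : ℂ → ℝ
∣ z ∣² = re z *ℝ re z +ℝ im z *ℝ im z

-- Moduli enter only through their squares, so no square roots are needed.
infix 4 _⟶_
_⟶_ : (ℕ → ℂ) → ℂ → Set
s ⟶ w = ∀ ε → 0ℝ <ℝ ε → Eventually λ n → ∣ s n - w ∣² <ℝ ε *ℝ ε

-- Inverses and values of power series are given by their graphs; the value is
-- unique up to _≈_.  Here u = wʳ, where for r < 0 it is the inverse of w^∣r∣.
IsPower : ℂ → ℤ → ℂ → Set
IsPower w (+ n)    u = u ≈ w ^ n
IsPower w -[1+ n ] u = u * w ^ suc n ≈ 1ℂ

1/_! : ℕ → ℚ
1/ n ! = (+ 1 ℚ./ (n ℕ.!)) {{n ℕ.!≢0}}

-- w = exp z, as the limit of the partial sums of the power series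
IsExp : ℂ → ℂ → Set
IsExp z w = (λ N → sum {N} λ n → ℚ→ℂ 1/ toℕ n ! * z ^ toℕ n) ⟶ w

-- π is the least positive real t with exp (i t) = -1.
IsPi : ℝ → Set
IsPi π = 0ℝ <ℝ π
  × IsExp (i * ℝ→ℂ π) (- 1ℂ)
  × (∀ t → 0ℝ <ℝ t → t <ℝ π → ¬ IsExp (i * ℝ→ℂ t) (- 1ℂ))

record ℍ : Set where
  constructor mkℍ
  field
    point : ℂ
    im>0  : 0ℝ <ℝ im point

open ℍ public

ℍ-setoid : Setoid 0ℓ 0ℓ
ℍ-setoid = record
  { Carrier = ℍ
  ; _≈_ = λ z w → point z ≈ point w
  ; isEquivalence = record
    { refl  = λ {z} → ℂS.refl {point z}
    ; sym   = λ {z} {w} → ℂS.sym {point z} {point w}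
    ; trans = λ {z} {w} {v} → ℂS.trans {point z} {point w} {point v}
    }
  }
  where module ℂS = Setoid ℂ-setoid

Function : Set
Function = Func ℍ-setoid ℂ-setoid

infixl 9 _⟨_⟩
_⟨_⟩ : Function → ℍ → ℂ
f ⟨ z ⟩ = Func.to f z

infix 4 _≐_
_≐_ : Function → Function → Set
f ≐ g = ∀ z → f ⟨ z ⟩ ≈ g ⟨ z ⟩

LinearlyIndependent : (Function → Set) → Set
LinearlyIndependent S =
  ∀ n (f : Fin n → Function) → (∀ j → S (f j)) → Injective _≡_ _≐_ f →
  (c : Fin n → ℂ) → (∀ z → sum (λ j → c j * f j ⟨ z ⟩) ≈ 0ℂ) →
  ∀ j → c j ≈ 0ℂ

-- Complex differentiability at every point, with derivative L at z:
-- ∣f w − f z − L (w − z)∣ ≤ ε ∣w − z∣ whenever ∣w − z∣ < δ.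
Holomorphic : Function → Set
Holomorphic f = ∀ z → ∃[ L ] (∀ ε → 0ℝ <ℝ ε → ∃[ δ ] (0ℝ <ℝ δ ×
  (∀ w → ∣ point w - point z ∣² <ℝ δ *ℝ δ →
    ∣ f ⟨ w ⟩ - f ⟨ z ⟩ - L * (point w - point z) ∣²
      ≤ℝ ε *ℝ ε *ℝ ∣ point w - point z ∣²)))

record SL₂ℤ : Set where
  constructor mkSL₂ℤ
  field
    a b c d : ℤ
    det     : a ℤ.* d ℤ.- b ℤ.* c ≡ + 1

Γ₁ : ℕ → SL₂ℤ → Set
Γ₁ N γ = + N ℤ.∣ a ℤ.- + 1 × + N ℤ.∣ c × + N ℤ.∣ d ℤ.- + 1
  where open SL₂ℤ γ

automorphy : SL₂ℤ → ℍ → ℂ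
automorphy γ z = ℤ→ℂ c * point z + ℤ→ℂ d
  where open SL₂ℤ γ

-- w = (a z + b) / (c z + d)
IsMöbius : SL₂ℤ → ℍ → ℍ → Set
IsMöbius γ z w = point w * automorphy γ z ≈ ℤ→ℂ a * point z + ℤ→ℂ b
  where open SL₂ℤ γ

-- s = (f ∣ₖ γ)(z) = (c z + d)⁻ᵏ f(γ z)
IsSlash : ℤ → SL₂ℤ → Function → ℍ → ℂ → Set
IsSlash k γ f z s = ∃[ w ] ∃[ u ]
  (IsMöbius γ z w × IsPower (automorphy γ z) (ℤ.- k) u × s ≈ u * f ⟨ w ⟩)

Invariant : ℤ → (SL₂ℤ → Set) → Function → Set
Invariant k Γ f = ∀ γ → Γ γ → ∀ z s → IsSlash k γ f z s → s ≈ f ⟨ z ⟩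

-- Every f ∣ₖ γ with γ in SL₂(ℤ) is bounded as im z → ∞.  For a form invariant under
-- a congruence subgroup this says that its q-expansion at each cusp has no negative
-- exponents.
HolomorphicAtCusps : ℤ → Function → Set
HolomorphicAtCusps k f = ∀ (γ : SL₂ℤ) → Σ ℝ λ B → Σ ℝ λ Y →
  ∀ (z : ℍ) (s : ℂ) → Y <ℝ im (point z) → IsSlash k γ f z s → ∣ s ∣² ≤ℝ B

IsModularForm : ℤ → (SL₂ℤ → Set) → Function → Set
IsModularForm k Γ f = Holomorphic f × Invariant k Γ f × HolomorphicAtCusps k f

-- The index n is shifted: the partial product is ∏ (1 - qⁿ) over 1 ≤ n ≤ N.
IsEta : Function → Set
IsEta η = ∃[ π ] (IsPi π × (∀ z → ∃[ q ] ∃[ q^1/24 ]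
  let 2πiz = ℤ→ℂ (+ 2) * ℝ→ℂ π * i * point z in
    IsExp 2πiz q
  × IsExp (ℚ→ℂ (+ 1 ℚ./ 24) * 2πiz) q^1/24
  × (λ N → q^1/24 * product {N} λ n → 1ℂ - q ^ suc (toℕ n)) ⟶ η ⟨ z ⟩))

infixr 7 _·_
_·_ : (p : ℕ) .{{_ : ℕ.NonZero p}} → ℍ → ℍ
p · z = mkℍ ((ℚ→ℝ p′ *ℝ re (point z)) +i (ℚ→ℝ p′ *ℝ im (point z))) positive
  where
  p′ : ℚ
  p′ = + p ℚ./ 1
  p′-pos : ℚ.Positive p′
  p′-pos = ℚ.normalize-pos p 1
  positive : 0ℝ <ℝ ℚ→ℝ p′ *ℝ im (point z)
  positive with im>0 z
  ... | ε , 0<ε , N , h = p′ ℚ.* ε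
    , subst (ℚ._< p′ ℚ.* ε) (ℚ.*-zeroʳ p′) (ℚ.*-monoʳ-<-pos p′ {{p′-pos}} 0<ε)
    , N
    , λ n N≤n → subst (ℚ._≤ p′ ℚ.* seq (im (point z)) n) (sym (ℚ.+-identityˡ _))
        (ℚ.*-monoˡ-≤-nonNeg p′ {{ℚ.pos⇒nonNeg p′ {{p′-pos}}}}
          (subst (ℚ._≤ seq (im (point z)) n) (ℚ.+-identityˡ ε) (h n N≤n)))

IsEtaQuotient : (p : ℕ) .{{_ : ℕ.NonZero p}} → Function → Set
IsEtaQuotient p f = ∃[ η ] ∃[ r₁ ] ∃[ rₚ ] (IsEta η ×
  (∀ z → ∃[ u ] ∃[ v ]
    ( IsPower (η ⟨ z ⟩) r₁ u
    × IsPower (η ⟨ p · z ⟩) rₚ v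
    × f ⟨ z ⟩ ≈ u * v)))

{-# OPTIONS --safe #-}
-- The η-quotients η(z)^r η(pz)^s with distinct exponents (r , s) are linearly independent, whatever their
-- weights: they have different orders of magnitude at the cusp 0.  Let z = it with t → 0, put
-- y = exp (-2πt), h = 1 - y and E(y) = ∏ (1 - yⁿ), so that X = η(z) and Y = η(pz) are essentially E(y) and
-- E(yᵖ).  Comparing factors in blocks of p gives (h E(yᵖ))ᵖ ≤ E(y) ≤ ε E(yᵖ)ᵖ, with ε → 0 because the
-- harmonic series diverges, while E(yᵖ) = O(hᴹ) for every M.  Hence XᵃYᵇ dominates Xᵃ′Yᵇ′ as soon as
-- (pa + b , a) is lexicographically smaller than (pa′ + b′ , a′), and in a linear relation the coefficients
-- vanish one after the other.  All estimates are made for the rational approximations of the reals involved.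
module Submission where

-- The transformation formula of η would give X and Y, up to constants, the orders t^(-1/2) exp
-- (-π/12t) and t^(-1/2) exp (-π/12pt). The first entry of the key then reads off the exponential
-- and the second the remaining power of t. The two-sided block estimate is an elementary
-- substitute: up to a power of h, X behaves like Yᵖ, while Y is smaller than every power of h. So
-- one spare factor Y outweighs every loss of powers of h; at equal level only X / Yᵖ → 0 can
-- decide. The obstacle is that the order of the reals is undecidable and that π and the
-- exponentials are known only through their graphs. No limit t → 0 is taken: for each required δ
-- one rational t is chosen, and inequalities are shown for the n-th rational approximations with n
-- large. There the linear relation holds only up to an error that tends to 0 with n, so the
-- monomials must also exceed a positive rational independent of n. A coefficient vanishes because
-- being bounded away from 0 is refuted.

module EtaQuotients where

  open import Algebra.Bundles using (CommutativeRing; Semiring; RawRing)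
  open import Data.Empty using (⊥)
  open import Data.Fin using (Fin; zero; suc; toℕ)
  import Data.Fin.Properties as Fin
  open import Data.Integer as ℤ using (ℤ; -[1+_])
  import Data.Integer.Properties as ℤ
  open import Data.Nat as ℕ using (ℕ; zero; suc; z≤n; s≤s; _!)
  open import Data.Nat.Induction using (<-wellFounded)
  import Data.Nat.Properties as ℕ
  open import Data.Product using (∃; ∃-syntax; _×_; _,_; proj₁; proj₂)
  open import Data.Rational
  open import Data.Rational.Properties
  open import Data.Rational.Unnormalised as ℚᵘ using (mkℚᵘ)
  import Data.Rational.Unnormalised.Properties as ℚᵘ
  open import Data.Sum using (inj₁; inj₂)
  open import Function using (_∘_)
  open import Function.Definitions using (Injective)
  open import Induction.WellFounded using (Acc; acc)
  open import Level using (0ℓ)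
  open import Relation.Binary using (Setoid; tri<; tri≈; tri>)
  open import Relation.Binary.PropositionalEquality
    using (_≡_; _≢_; refl; sym; trans; cong; cong₂; subst; subst₂; module ≡-Reasoning)
  open import Relation.Nullary using (¬_; yes; no)
  open import Relation.Nullary.Decidable using (dec⇒maybe)
  open import Relation.Nullary.Negation using (contradiction)
  open import Tactic.RingSolver using (solve-∀)
  open import Tactic.RingSolver.Core.AlmostCommutativeRing using (AlmostCommutativeRing; fromCommutativeRing)
  open import Algebra.Properties.Semiring.Exp (CommutativeRing.semiring +-*-commutativeRing)
    using (_^_; ^-homo-*; ^-assocʳ)
  open import Algebra.Properties.CommutativeSemiring.Exp (CommutativeRing.commutativeSemiring +-*-commutativeRing)
    using (^-distrib-*)
  open import Algebra.Definitions.RawSemiring (Semiring.rawSemiring (CommutativeRing.semiring +-*-commutativeRing))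
    using (sum; product)

  solver-ring : AlmostCommutativeRing _ _
  solver-ring = fromCommutativeRing +-*-commutativeRing (λ x → dec⇒maybe (0ℚ ≟ x))

  -- Ordered field

  ≤-respˡ : ∀ {p q r} → p ≡ q → p ≤ r → q ≤ r
  ≤-respˡ {r = r} = subst (_≤ r)

  ≤-respʳ : ∀ {p q r} → p ≡ q → r ≤ p → r ≤ q
  ≤-respʳ {r = r} = subst (r ≤_)

  p≤q⇒0≤q-p : ∀ {p q} → p ≤ q → 0ℚ ≤ q - p
  p≤q⇒0≤q-p {p} p≤q = ≤-respˡ (+-inverseʳ p) (+-monoˡ-≤ (- p) p≤q)

  ≤-by : ∀ {p q} d → 0ℚ ≤ d → q ≡ p + d → p ≤ q
  ≤-by {p} {q} d 0≤d q≡p+d = subst₂ _≤_ (+-identityʳ p) (sym q≡p+d) (+-monoʳ-≤ p 0≤d)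

  0≤+ : ∀ {p q} → 0ℚ ≤ p → 0ℚ ≤ q → 0ℚ ≤ p + q
  0≤+ = +-mono-≤

  *-monoˡ-≤ : ∀ {r p q} → 0ℚ ≤ r → p ≤ q → r * p ≤ r * q
  *-monoˡ-≤ {r} 0≤r = *-monoˡ-≤-nonNeg r {{nonNegative 0≤r}}

  *-monoʳ-≤ : ∀ {r p q} → 0ℚ ≤ r → p ≤ q → p * r ≤ q * r
  *-monoʳ-≤ {r} 0≤r = *-monoʳ-≤-nonNeg r {{nonNegative 0≤r}}

  0≤* : ∀ {p q} → 0ℚ ≤ p → 0ℚ ≤ q → 0ℚ ≤ p * q
  0≤* {p} 0≤p 0≤q = ≤-respˡ (*-zeroʳ p) (*-monoˡ-≤ 0≤p 0≤q)

  0<* : ∀ {p q} → 0ℚ < p → 0ℚ < q → 0ℚ < p * q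
  0<* {p} {q} 0<p 0<q = subst (_< p * q) (*-zeroʳ p) (*-monoʳ-<-pos p {{positive 0<p}} 0<q)

  *-mono-≤ : ∀ {p q r s} → 0ℚ ≤ p → p ≤ q → 0ℚ ≤ r → r ≤ s → p * r ≤ q * s
  *-mono-≤ 0≤p p≤q 0≤r r≤s = ≤-trans (*-monoʳ-≤ 0≤r p≤q) (*-monoˡ-≤ (≤-trans 0≤p p≤q) r≤s)

  0<½ : 0ℚ < ½
  0<½ = positive⁻¹ ½

  0≤1 : 0ℚ ≤ 1ℚ
  0≤1 = nonNegative⁻¹ 1ℚ

  0≤½ : 0ℚ ≤ ½
  0≤½ = nonNegative⁻¹ ½

  *-cancelˡ-≤ : ∀ {r p q} → 0ℚ < r → r * p ≤ r * q → p ≤ q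
  *-cancelˡ-≤ {r} 0<r = *-cancelˡ-≤-pos r {{positive 0<r}}

  p*q≤p : ∀ {p q} → 0ℚ ≤ p → q ≤ 1ℚ → p * q ≤ p
  p*q≤p {p} 0≤p q≤1 = ≤-respʳ (*-identityʳ p) (*-monoˡ-≤ 0≤p q≤1)

  p*q≤q : ∀ {p q} → 0ℚ ≤ q → p ≤ 1ℚ → p * q ≤ q
  p*q≤q {q = q} 0≤q p≤1 = ≤-respʳ (*-identityˡ q) (*-monoʳ-≤ 0≤q p≤1)

  inverse : ∀ {p} → 0ℚ < p → ∃[ r ] (0ℚ < r × p * r ≡ 1ℚ)
  inverse {p} 0<p = 1/ p , positive⁻¹ (1/ p) {{1/pos⇒pos p}} , *-inverseʳ p
    where
    instance
      _ = positive 0<p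
      _ = pos⇒nonZero p

  ∣p∣≤⇒≤ : ∀ {p q} → ∣ p ∣ ≤ q → p ≤ q
  ∣p∣≤⇒≤ {p} ∣p∣≤q with ≤-total 0ℚ p
  ... | inj₁ 0≤p = ≤-respˡ (0≤p⇒∣p∣≡p 0≤p) ∣p∣≤q
  ... | inj₂ p≤0 = ≤-trans p≤0 (≤-trans (0≤∣p∣ p) ∣p∣≤q)

  ∣p∣≤⇒-≤ : ∀ {p q} → ∣ p ∣ ≤ q → - p ≤ q
  ∣p∣≤⇒-≤ {p} ∣p∣≤q = ∣p∣≤⇒≤ (≤-respˡ (sym (∣-p∣≡∣p∣ p)) ∣p∣≤q)

  ≤⇒∣p∣≤ : ∀ {p q} → p ≤ q → - p ≤ q → ∣ p ∣ ≤ q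
  ≤⇒∣p∣≤ {p} p≤q -p≤q with ∣p∣≡p∨∣p∣≡-p p
  ... | inj₁ e = ≤-respˡ (sym e) p≤q
  ... | inj₂ e = ≤-respˡ (sym e) -p≤q

  ∣p-q∣≡∣q-p∣ : ∀ p q → ∣ p - q ∣ ≡ ∣ q - p ∣
  ∣p-q∣≡∣q-p∣ p q = trans (sym (∣-p∣≡∣p∣ (p - q))) (cong ∣_∣ (lemma p q))
    where
    lemma : ∀ p q → - (p - q) ≡ q - p
    lemma = solve-∀ solver-ring

  ∣-∣-triangle : ∀ p q r → ∣ p - r ∣ ≤ ∣ p - q ∣ + ∣ q - r ∣
  ∣-∣-triangle p q r = ≤-respˡ (cong ∣_∣ (lemma p q r)) (∣p+q∣≤∣p∣+∣q∣ (p - q) (q - r))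
    where
    lemma : ∀ p q r → (p - q) + (q - r) ≡ p - r
    lemma = solve-∀ solver-ring

  ½*p+½*p≡p : ∀ p → ½ * p + ½ * p ≡ p
  ½*p+½*p≡p = solve-∀ solver-ring

  0<½* : ∀ {p} → 0ℚ < p → 0ℚ < ½ * p
  0<½* = 0<* 0<½

  ½*p≤p : ∀ {p} → 0ℚ ≤ p → ½ * p ≤ p
  ½*p≤p {p} 0≤p = ≤-by (½ * p) (0≤* 0≤½ 0≤p) (sym (½*p+½*p≡p p))

  -- Natural numbers in ℚ

  abstract
    -- Opaque versions of the library fractions, so that they act as atoms in identities; `ι≡/1` and
    -- `recip≡1/` lead back.
    ι : ℕ → ℚ
    ι n = ℤ.+ n / 1

    recip : (n : ℕ) .{{_ : ℕ.NonZero n}} → ℚ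
    recip n = ℤ.+ 1 / n

    toℚᵘ-ι : ∀ n → toℚᵘ (ι n) ℚᵘ.≃ mkℚᵘ (ℤ.+ n) 0
    toℚᵘ-ι n = toℚᵘ-fromℚᵘ (mkℚᵘ (ℤ.+ n) 0)

    toℚᵘ-recip : ∀ n → toℚᵘ (recip (suc n)) ℚᵘ.≃ mkℚᵘ (ℤ.+ 1) n
    toℚᵘ-recip n = toℚᵘ-fromℚᵘ (mkℚᵘ (ℤ.+ 1) n)

    ι-+ : ∀ m n → ι (m ℕ.+ n) ≡ ι m + ι n
    ι-+ m n = toℚᵘ-injective (ℚᵘ.≃-trans (toℚᵘ-ι (m ℕ.+ n)) (ℚᵘ.≃-trans e (ℚᵘ.≃-sym
      (ℚᵘ.≃-trans (toℚᵘ-homo-+ (ι m) (ι n)) (ℚᵘ.+-cong (toℚᵘ-ι m) (toℚᵘ-ι n))))))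
      where
      e : mkℚᵘ (ℤ.+ (m ℕ.+ n)) 0 ℚᵘ.≃ mkℚᵘ (ℤ.+ m) 0 ℚᵘ.+ mkℚᵘ (ℤ.+ n) 0
      e = ℚᵘ.*≡* (cong (ℤ._* ℤ.+ 1) (cong₂ ℤ._+_ (sym (ℤ.*-identityʳ (ℤ.+ m))) (sym (ℤ.*-identityʳ (ℤ.+ n)))))

    ι-* : ∀ m n → ι (m ℕ.* n) ≡ ι m * ι n
    ι-* zero    n = sym (*-zeroˡ (ι n))
    ι-* (suc m) n = trans (ι-+ n (m ℕ.* n)) (trans (cong (ι n +_) (ι-* m n))
      (trans (lemma (ι m) (ι n)) (cong (_* ι n) (sym (ι-+ 1 m)))))
      where
      lemma : ∀ a b → b + a * b ≡ (1ℚ + a) * b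
      lemma = solve-∀ solver-ring

    ι≡/1 : ∀ n → ι n ≡ ℤ.+ n / 1
    ι≡/1 n = refl

    recip≡1/ : ∀ n .{{_ : ℕ.NonZero n}} → recip n ≡ ℤ.+ 1 / n
    recip≡1/ n = refl

    ι1≡1 : ι 1 ≡ 1ℚ
    ι1≡1 = refl

    ι0≡0 : ι 0 ≡ 0ℚ
    ι0≡0 = refl

    0≤ι : ∀ n → 0ℚ ≤ ι n
    0≤ι n = nonNegative⁻¹ (ι n) {{normalize-nonNeg n 1}}

    0<ι : ∀ n .{{_ : ℕ.NonZero n}} → 0ℚ < ι n
    0<ι n = positive⁻¹ (ι n) {{normalize-pos n 1}}

    ι*recip : ∀ n .{{_ : ℕ.NonZero n}} → ι n * recip n ≡ 1ℚ
    ι*recip (suc n) = toℚᵘ-injective (ℚᵘ.≃-trans (toℚᵘ-homo-* (ι (suc n)) (recip (suc n)))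
      (ℚᵘ.≃-trans (ℚᵘ.*-cong (toℚᵘ-ι (suc n)) (toℚᵘ-recip n)) (ℚᵘ.*-inverseʳ (mkℚᵘ (ℤ.+ suc n) 0))))

    0<recip : ∀ n .{{_ : ℕ.NonZero n}} → 0ℚ < recip n
    0<recip n = positive⁻¹ (recip n) {{normalize-pos 1 n}}

    archimedean : ∀ q → ∃[ n ] q ≤ ι n
    archimedean q@(mkℚ (-[1+ a ]) _ _) = 0 , <⇒≤ (negative⁻¹ q)
    archimedean q@(mkℚ (ℤ.+ a) d _) = a , toℚᵘ-cancel-≤
      (ℚᵘ.≤-respʳ-≃ (ℚᵘ.≃-sym (toℚᵘ-ι a)) (ℚᵘ.*≤* (ℤ.*-monoˡ-≤-nonNeg (ℤ.+ a) (ℤ.+≤+ (s≤s z≤n)))))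

  ι-suc : ∀ n → ι (suc n) ≡ 1ℚ + ι n
  ι-suc n = trans (ι-+ 1 n) (cong (_+ ι n) ι1≡1)

  ι-mono : ∀ {m n} → m ℕ.≤ n → ι m ≤ ι n
  ι-mono {m} {n} m≤n = ≤-by (ι (n ℕ.∸ m)) (0≤ι (n ℕ.∸ m))
    (trans (cong ι (sym (ℕ.m+[n∸m]≡n m≤n))) (ι-+ m (n ℕ.∸ m)))

  recip-unique : ∀ n .{{_ : ℕ.NonZero n}} {r} → ι n * r ≡ 1ℚ → r ≡ recip n
  recip-unique n {r} e = trans (sym (*-identityʳ r)) (trans (cong (r *_) (sym (ι*recip n)))
    (trans (lemma r (ι n) (recip n)) (trans (cong (_* recip n) e) (*-identityˡ _))))
    where
    lemma : ∀ r a b → r * (a * b) ≡ (a * r) * b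
    lemma = solve-∀ solver-ring

  recip-* : ∀ m n .{{_ : ℕ.NonZero m}} .{{_ : ℕ.NonZero n}} .{{_ : ℕ.NonZero (m ℕ.* n)}} →
    recip (m ℕ.* n) ≡ recip m * recip n
  recip-* m n = sym (recip-unique (m ℕ.* n) (trans (cong (_* (recip m * recip n)) (ι-* m n))
    (trans (lemma (ι m) (ι n) (recip m) (recip n)) (trans (cong₂ _*_ (ι*recip m) (ι*recip n)) (*-identityˡ 1ℚ)))))
    where
    lemma : ∀ a b c d → (a * b) * (c * d) ≡ (a * c) * (b * d)
    lemma = solve-∀ solver-ring

  1≤ι : ∀ n .{{_ : ℕ.NonZero n}} → 1ℚ ≤ ι n
  1≤ι (suc n) = ≤-respˡ ι1≡1 (ι-mono {1} {suc n} (s≤s z≤n))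

  recip≤1 : ∀ n .{{_ : ℕ.NonZero n}} → recip n ≤ 1ℚ
  recip≤1 n = subst₂ _≤_ (*-identityˡ _) (ι*recip n) (*-monoʳ-≤ (<⇒≤ (0<recip n)) (1≤ι n))

  recip-antimono : ∀ m n .{{_ : ℕ.NonZero m}} .{{_ : ℕ.NonZero n}} → m ℕ.≤ n → recip n ≤ recip m
  recip-antimono m n m≤n = *-cancelˡ-≤ (0<ι n) (≤-trans (≤-reflexive (trans (ι*recip n) (sym (ι*recip m))))
    (*-monoʳ-≤ (<⇒≤ (0<recip m)) (ι-mono m≤n)))

  -- Powers, sums and products

  ∑ ∏ : ℕ → (ℕ → ℚ) → ℚ
  ∑ n f = sum {n} (f ∘ toℕ)
  ∏ n f = product {n} (f ∘ toℕ)

  0≤^ : ∀ {x} n → 0ℚ ≤ x → 0ℚ ≤ x ^ n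
  0≤^ zero    _   = 0≤1
  0≤^ (suc n) 0≤x = 0≤* 0≤x (0≤^ n 0≤x)

  0<^ : ∀ {x} n → 0ℚ < x → 0ℚ < x ^ n
  0<^ zero    _   = positive⁻¹ 1ℚ
  0<^ (suc n) 0<x = 0<* 0<x (0<^ n 0<x)

  ^-mono-≤ : ∀ {x y} n → 0ℚ ≤ x → x ≤ y → x ^ n ≤ y ^ n
  ^-mono-≤ zero    _   _   = ≤-refl
  ^-mono-≤ (suc n) 0≤x x≤y = *-mono-≤ 0≤x x≤y (0≤^ n 0≤x) (^-mono-≤ n 0≤x x≤y)

  1^n≡1 : ∀ n → 1ℚ ^ n ≡ 1ℚ
  1^n≡1 zero    = refl
  1^n≡1 (suc n) = trans (*-identityˡ _) (1^n≡1 n)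

  ^≤1 : ∀ {x} n → 0ℚ ≤ x → x ≤ 1ℚ → x ^ n ≤ 1ℚ
  ^≤1 n 0≤x x≤1 = ≤-respʳ (1^n≡1 n) (^-mono-≤ n 0≤x x≤1)

  ^-antimono-≤ : ∀ {x m n} → 0ℚ ≤ x → x ≤ 1ℚ → m ℕ.≤ n → x ^ n ≤ x ^ m
  ^-antimono-≤ {x} {m} {n} 0≤x x≤1 m≤n = subst (_≤ x ^ m)
    (trans (sym (^-homo-* x m (n ℕ.∸ m))) (cong (x ^_) (ℕ.m+[n∸m]≡n m≤n)))
    (p*q≤p (0≤^ m 0≤x) (^≤1 (n ℕ.∸ m) 0≤x x≤1))

  ∣x^n∣ : ∀ x n → ∣ x ^ n ∣ ≡ ∣ x ∣ ^ n
  ∣x^n∣ x zero    = refl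
  ∣x^n∣ x (suc n) = trans (∣p*q∣≡∣p∣*∣q∣ x (x ^ n)) (cong (∣ x ∣ *_) (∣x^n∣ x n))

  ∏-cong : ∀ n {f g : ℕ → ℚ} → (∀ k → f k ≡ g k) → ∏ n f ≡ ∏ n g
  ∏-cong zero    _  = refl
  ∏-cong (suc n) eq = cong₂ _*_ (eq 0) (∏-cong n (eq ∘ suc))

  ∏-nonneg : ∀ n {f : ℕ → ℚ} → (∀ k → 0ℚ ≤ f k) → 0ℚ ≤ ∏ n f
  ∏-nonneg zero    _  = 0≤1
  ∏-nonneg (suc n) 0≤f = 0≤* (0≤f 0) (∏-nonneg n (0≤f ∘ suc))

  ∏-pos : ∀ n {f : ℕ → ℚ} → (∀ k → 0ℚ < f k) → 0ℚ < ∏ n f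
  ∏-pos zero    _  = positive⁻¹ 1ℚ
  ∏-pos (suc n) 0<f = 0<* (0<f 0) (∏-pos n (0<f ∘ suc))

  ∏-mono-≤ : ∀ n {f g : ℕ → ℚ} → (∀ k → 0ℚ ≤ f k) → (∀ k → k ℕ.< n → f k ≤ g k) → ∏ n f ≤ ∏ n g
  ∏-mono-≤ zero    _   _   = ≤-refl
  ∏-mono-≤ (suc n) 0≤f f≤g = *-mono-≤ (0≤f 0) (f≤g 0 (s≤s z≤n)) (∏-nonneg n (0≤f ∘ suc))
    (∏-mono-≤ n (0≤f ∘ suc) (λ k k<n → f≤g (suc k) (s≤s k<n)))

  ∏-const : ∀ n x → ∏ n (λ _ → x) ≡ x ^ n
  ∏-const zero    x = refl
  ∏-const (suc n) x = cong (x *_) (∏-const n x)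

  ∏≤1 : ∀ n {f : ℕ → ℚ} → (∀ k → 0ℚ ≤ f k) → (∀ k → f k ≤ 1ℚ) → ∏ n f ≤ 1ℚ
  ∏≤1 n 0≤f f≤1 = ≤-respʳ (trans (∏-const n 1ℚ) (1^n≡1 n)) (∏-mono-≤ n 0≤f (λ k _ → f≤1 k))

  private
    *-interchange : ∀ a b c d → (a * b) * (c * d) ≡ (a * c) * (b * d)
    *-interchange = solve-∀ solver-ring

  ∏-* : ∀ n (f g : ℕ → ℚ) → ∏ n (λ k → f k * g k) ≡ ∏ n f * ∏ n g
  ∏-* zero    f g = refl
  ∏-* (suc n) f g = trans (cong (f 0 * g 0 *_) (∏-* n (f ∘ suc) (g ∘ suc))) (*-interchange (f 0) (g 0) _ _)

  ∏-^ : ∀ n (f : ℕ → ℚ) p → ∏ n (λ k → f k ^ p) ≡ ∏ n f ^ p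
  ∏-^ zero    f p = sym (1^n≡1 p)
  ∏-^ (suc n) f p = trans (cong (f 0 ^ p *_) (∏-^ n (f ∘ suc) p)) (sym (^-distrib-* (f 0) _ p))

  ∏-++ : ∀ m n (f : ℕ → ℚ) → ∏ (m ℕ.+ n) f ≡ ∏ m f * ∏ n (λ k → f (m ℕ.+ k))
  ∏-++ zero    n f = sym (*-identityˡ _)
  ∏-++ (suc m) n f = trans (cong (f 0 *_) (∏-++ m n (f ∘ suc))) (sym (*-assoc (f 0) _ _))

  ∏-antimono : ∀ {m n} {f : ℕ → ℚ} → (∀ k → 0ℚ ≤ f k) → (∀ k → f k ≤ 1ℚ) → m ℕ.≤ n → ∏ n f ≤ ∏ m f
  ∏-antimono {m} {n} {f} 0≤f f≤1 m≤n = subst (_≤ ∏ m f)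
    (trans (sym (∏-++ m (n ℕ.∸ m) f)) (cong (λ k → ∏ k f) (ℕ.m+[n∸m]≡n m≤n)))
    (p*q≤p (∏-nonneg m 0≤f) (∏≤1 (n ℕ.∸ m) (λ k → 0≤f (m ℕ.+ k)) (λ k → f≤1 (m ℕ.+ k))))

  ∏-blocks : ∀ n p (f : ℕ → ℚ) → ∏ (n ℕ.* p) f ≡ ∏ n (λ k → ∏ p (λ l → f (k ℕ.* p ℕ.+ l)))
  ∏-blocks zero    p f = refl
  ∏-blocks (suc n) p f = trans (∏-++ p (n ℕ.* p) f) (cong (∏ p f *_)
    (trans (∏-blocks n p (λ k → f (p ℕ.+ k)))
      (∏-cong n (λ k → ∏-cong p (λ l → cong f (sym (ℕ.+-assoc p (k ℕ.* p) l)))))))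

  ∑-cong : ∀ n {f g : ℕ → ℚ} → (∀ k → f k ≡ g k) → ∑ n f ≡ ∑ n g
  ∑-cong zero    _  = refl
  ∑-cong (suc n) eq = cong₂ _+_ (eq 0) (∑-cong n (eq ∘ suc))

  ∑-++ : ∀ m n (f : ℕ → ℚ) → ∑ (m ℕ.+ n) f ≡ ∑ m f + ∑ n (λ k → f (m ℕ.+ k))
  ∑-++ zero    n f = sym (+-identityˡ _)
  ∑-++ (suc m) n f = trans (cong (f 0 +_) (∑-++ m n (f ∘ suc))) (sym (+-assoc (f 0) _ _))

  ∑-nonneg : ∀ n {f : ℕ → ℚ} → (∀ k → 0ℚ ≤ f k) → 0ℚ ≤ ∑ n f
  ∑-nonneg zero    _  = ≤-refl
  ∑-nonneg (suc n) 0≤f = 0≤+ (0≤f 0) (∑-nonneg n (0≤f ∘ suc))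

  -- A rational substitute for 1 - c ≤ exp (-c): since (1 - c)(1 + c + S) ≤ 1 + S, each new factor
  -- pays for its summand. A divergent sum thus forces the product to 0.
  ∏[1-c]*[1+∑c]≤1 : ∀ n {c : ℕ → ℚ} → (∀ k → 0ℚ ≤ c k) → (∀ k → c k ≤ 1ℚ) →
    ∏ n (λ k → 1ℚ - c k) * (1ℚ + ∑ n c) ≤ 1ℚ
  ∏[1-c]*[1+∑c]≤1 zero    _   _   = ≤-refl
  ∏[1-c]*[1+∑c]≤1 (suc n) {c} 0≤c c≤1 = ≤-trans
    (≤-by (P * c₀ * (S + c₀)) (0≤* (0≤* 0≤P (0≤c 0)) (0≤+ (∑-nonneg n (0≤c ∘ suc)) (0≤c 0)))
      (lemma P S c₀))
    (∏[1-c]*[1+∑c]≤1 n (0≤c ∘ suc) (c≤1 ∘ suc))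
    where
    c₀ = c 0
    P = ∏ n (λ k → 1ℚ - c (suc k))
    S = ∑ n (c ∘ suc)
    0≤P : 0ℚ ≤ P
    0≤P = ∏-nonneg n (λ k → p≤q⇒0≤q-p (c≤1 (suc k)))
    lemma : ∀ P S c → P * (1ℚ + S) ≡ (1ℚ - c) * P * (1ℚ + (c + S)) + P * c * (S + c)
    lemma = solve-∀ solver-ring

  bernoulli : ∀ {y} m → 0ℚ ≤ y → y ≤ 1ℚ → 1ℚ - y ^ m ≤ ι m * (1ℚ - y)
  bernoulli {y} zero    _   _   = ≤-reflexive (trans (+-inverseʳ 1ℚ) (sym (trans (cong (_* (1ℚ - y)) ι0≡0) (*-zeroˡ (1ℚ - y)))))
  bernoulli {y} (suc m) 0≤y y≤1 = ≤-trans
    (≤-by ((1ℚ - y) * (1ℚ - y ^ m)) (0≤* (p≤q⇒0≤q-p y≤1) (p≤q⇒0≤q-p (^≤1 m 0≤y y≤1)))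
      (lemma y (y ^ m)))
    (≤-trans (+-monoʳ-≤ (1ℚ - y) (bernoulli m 0≤y y≤1))
      (≤-reflexive (trans (lemma₂ (ι m) (1ℚ - y)) (cong (_* (1ℚ - y)) (sym (ι-suc m))))))
    where
    lemma : ∀ y z → (1ℚ - y) + (1ℚ - z) ≡ 1ℚ - y * z + (1ℚ - y) * (1ℚ - z)
    lemma = solve-∀ solver-ring
    lemma₂ : ∀ a b → b + a * b ≡ (1ℚ + a) * b
    lemma₂ = solve-∀ solver-ring

  archimedean-* : ∀ {p} → 0ℚ < p → ∃[ n ] 1ℚ ≤ ι n * p
  archimedean-* {p} 0<p =
    let r , 0<r , pr≡1 = inverse 0<p
        n , r≤n = archimedean r
    in n , ≤-trans (≤-reflexive (trans (sym pr≡1) (*-comm p r))) (*-monoʳ-≤ (<⇒≤ 0<p) r≤n)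

  ≤1/[1+s]⇒≤ : ∀ {d s ε} → 0ℚ ≤ s → 0ℚ ≤ ε → d * (1ℚ + s) ≤ 1ℚ → 1ℚ ≤ s * ε → d ≤ ε
  ≤1/[1+s]⇒≤ {d} {s} {ε} 0≤s 0≤ε d≤ 1≤ = *-cancelˡ-≤ {1ℚ + s} (+-mono-<-≤ (positive⁻¹ 1ℚ) 0≤s)
    (≤-trans (≤-reflexive (*-comm (1ℚ + s) d)) (≤-trans d≤ (≤-trans 1≤ (≤-by ε 0≤ε (lemma s ε)))))
    where
    lemma : ∀ s e → (1ℚ + s) * e ≡ s * e + e
    lemma = solve-∀ solver-ring

  -- The product bound with constant `c` reads (1 - h)ⁿ (1 + nh) ≤ 1; take n with nhε ≥ 1.
  ^-small : ∀ {h ε} → 0ℚ < h → h ≤ 1ℚ → 0ℚ < ε → ∃[ n ] (1ℚ - h) ^ n ≤ ε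
  ^-small {h} {ε} 0<h h≤1 0<ε =
    let n , 1≤ = archimedean-* (0<* 0<h 0<ε)
    in n , ≤1/[1+s]⇒≤ (0≤* (0≤ι n) (<⇒≤ 0<h)) (<⇒≤ 0<ε)
      (subst₂ (λ a b → a * (1ℚ + b) ≤ 1ℚ) (∏-const n (1ℚ - h)) (∑-const n)
        (∏[1-c]*[1+∑c]≤1 n (λ _ → <⇒≤ 0<h) (λ _ → h≤1)))
      (≤-respʳ (sym (*-assoc (ι n) h ε)) 1≤)
    where
    ∑-const : ∀ n → ∑ n (λ _ → h) ≡ ι n * h
    ∑-const zero    = sym (trans (cong (_* h) ι0≡0) (*-zeroˡ h))
    ∑-const (suc n) = trans (cong (h +_) (∑-const n)) (trans (lemma (ι n) h) (cong (_* h) (sym (ι-suc n))))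
      where
      lemma : ∀ a b → b + a * b ≡ (1ℚ + a) * b
      lemma = solve-∀ solver-ring

  -- The exponential series

  expTerm : ℚ → ℕ → ℚ
  expTerm x k = recip (k !) {{k ℕ.!≢0}} * x ^ k

  expSum : ℕ → ℚ → ℚ
  expSum n x = ∑ n (expTerm x)

  recip1≡1 : recip 1 ≡ 1ℚ
  recip1≡1 = sym (recip-unique 1 (trans (*-identityʳ _) ι1≡1))

  expTerm-zero : ∀ x → expTerm x 0 ≡ 1ℚ
  expTerm-zero x = trans (*-identityʳ (recip 1)) recip1≡1

  ι-suc-cancel : ∀ n {a b} → ι (suc n) * a ≡ ι (suc n) * b → a ≡ b
  ι-suc-cancel n {a} {b} e = trans (sym (lemma a)) (trans (cong (recip (suc n) *_) e) (lemma b))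
    where
    lemma : ∀ a → recip (suc n) * (ι (suc n) * a) ≡ a
    lemma a = trans (sym (*-assoc (recip (suc n)) (ι (suc n)) a))
      (trans (cong (_* a) (trans (*-comm (recip (suc n)) (ι (suc n))) (ι*recip (suc n)))) (*-identityˡ a))

  expTerm-suc : ∀ x k → ι (suc k) * expTerm x (suc k) ≡ x * expTerm x k
  expTerm-suc x k = trans
    (cong (λ r → ι (suc k) * (r * x ^ suc k)) (recip-* (suc k) (k !) {{_}} {{k ℕ.!≢0}} {{suc k ℕ.!≢0}}))
    (trans (lemma (ι (suc k)) (recip (suc k)) (recip (k !) {{k ℕ.!≢0}}) x (x ^ k))
    (trans (cong (_* (x * expTerm x k)) (ι*recip (suc k))) (*-identityˡ _)))
    where
    lemma : ∀ a b c x y → a * (b * c * (x * y)) ≡ a * b * (x * (c * y))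
    lemma = solve-∀ solver-ring

  -- Cauchy products and the addition theorem

  conv : (ℕ → ℚ) → (ℕ → ℚ) → ℕ → ℚ
  conv u v zero    = u 0 * v 0
  conv u v (suc n) = u 0 * v (suc n) + conv (u ∘ suc) v n

  conv-cong : ∀ n {u u′ v v′ : ℕ → ℚ} → (∀ k → u k ≡ u′ k) → (∀ k → v k ≡ v′ k) → conv u v n ≡ conv u′ v′ n
  conv-cong zero    p q = cong₂ _*_ (p 0) (q 0)
  conv-cong (suc n) p q = cong₂ _+_ (cong₂ _*_ (p 0) (q (suc n))) (conv-cong n (p ∘ suc) q)

  conv-+ : ∀ n (u w v : ℕ → ℚ) → conv (λ k → u k + w k) v n ≡ conv u v n + conv w v n
  conv-+ zero    u w v = *-distribʳ-+ (v 0) (u 0) (w 0)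
  conv-+ (suc n) u w v = trans (cong ((u 0 + w 0) * v (suc n) +_) (conv-+ n (u ∘ suc) (w ∘ suc) v))
    (lemma (u 0) (w 0) (v (suc n)) _ _)
    where
    lemma : ∀ a b c d e → (a + b) * c + (d + e) ≡ (a * c + d) + (b * c + e)
    lemma = solve-∀ solver-ring

  conv-*ˡ : ∀ n c (u v : ℕ → ℚ) → conv (λ k → c * u k) v n ≡ c * conv u v n
  conv-*ˡ zero    c u v = *-assoc c (u 0) (v 0)
  conv-*ˡ (suc n) c u v = trans (cong (c * u 0 * v (suc n) +_) (conv-*ˡ n c (u ∘ suc) v))
    (lemma c (u 0) (v (suc n)) _)
    where
    lemma : ∀ a b c d → a * b * c + a * d ≡ a * (b * c + d)
    lemma = solve-∀ solver-ring

  conv-*ʳ : ∀ n c (u v : ℕ → ℚ) → conv u (λ k → c * v k) n ≡ c * conv u v n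
  conv-*ʳ zero    c u v = lemma c (u 0) (v 0)
    where
    lemma : ∀ a b c → b * (a * c) ≡ a * (b * c)
    lemma = solve-∀ solver-ring
  conv-*ʳ (suc n) c u v = trans (cong (u 0 * (c * v (suc n)) +_) (conv-*ʳ n c (u ∘ suc) v))
    (lemma c (u 0) (v (suc n)) _)
    where
    lemma : ∀ a b c d → b * (a * c) + a * d ≡ a * (b * c + d)
    lemma = solve-∀ solver-ring

  -- Coefficients of the formal derivative of the power series with coefficients `u`.
  deriv : (ℕ → ℚ) → ℕ → ℚ
  deriv u k = ι (suc k) * u (suc k)

  -- The product rule for formal power series. The induction strips the constant term of `u` alone;
  -- differentiating the stripped series misses one copy of each coefficient, which `shift`
  -- restores.
  leibniz : ∀ n (u v : ℕ → ℚ) → ι (suc n) * conv u v (suc n) ≡ conv (deriv u) v n + conv u (deriv v) n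
  leibniz zero    u v = lemma (ι 1) (u 0) (u 1) (v 0) (v 1)
    where
    lemma : ∀ i a b c d → i * (a * d + b * c) ≡ i * b * c + a * (i * d)
    lemma = solve-∀ solver-ring
  leibniz (suc n) u v = begin
    ι (suc (suc n)) * (u 0 * w + conv Su v (suc n))
      ≡⟨ cong (λ t → t * (u 0 * w + conv Su v (suc n))) (ι-suc (suc n)) ⟩
    (1ℚ + ι (suc n)) * (u 0 * w + conv Su v (suc n))
      ≡⟨ lemma₁ (ι (suc n)) (u 0) w (conv Su v (suc n)) ⟩
    u 0 * ((1ℚ + ι (suc n)) * w) + (conv Su v (suc n) + ι (suc n) * conv Su v (suc n))
      ≡⟨ cong₂ (λ t s → u 0 * (t * w) + (conv Su v (suc n) + s)) (sym (ι-suc (suc n))) (leibniz n Su v) ⟩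
    u 0 * deriv v (suc n) + (conv Su v (suc n) + (conv (deriv Su) v n + conv Su (deriv v) n))
      ≡⟨ lemma₂ (u 0 * deriv v (suc n)) (u 1 * v (suc n)) (conv (Su ∘ suc) v n) (conv (deriv Su) v n) (conv Su (deriv v) n) ⟩
    u 1 * v (suc n) + (conv (deriv Su) v n + conv (Su ∘ suc) v n) + conv u (deriv v) (suc n)
      ≡⟨ cong (λ t → t * v (suc n) + (conv (deriv Su) v n + conv (Su ∘ suc) v n) + conv u (deriv v) (suc n))
           (sym (trans (cong (_* u 1) ι1≡1) (*-identityˡ (u 1)))) ⟩
    deriv u 0 * v (suc n) + (conv (deriv Su) v n + conv (Su ∘ suc) v n) + conv u (deriv v) (suc n)
      ≡⟨ cong (λ t → deriv u 0 * v (suc n) + t + conv u (deriv v) (suc n))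
           (trans (sym (conv-+ n (deriv Su) (Su ∘ suc) v)) (conv-cong n shift (λ _ → refl))) ⟩
    conv (deriv u) v (suc n) + conv u (deriv v) (suc n) ∎
    where
    open ≡-Reasoning
    Su = u ∘ suc
    w = v (suc (suc n))
    lemma₁ : ∀ i a w c → (1ℚ + i) * (a * w + c) ≡ a * ((1ℚ + i) * w) + (c + i * c)
    lemma₁ = solve-∀ solver-ring
    lemma₂ : ∀ a b c d e → a + (b + c + (d + e)) ≡ b + (d + c) + (a + e)
    lemma₂ = solve-∀ solver-ring
    lemma₃ : ∀ i a → i * a + a ≡ (1ℚ + i) * a
    lemma₃ = solve-∀ solver-ring
    shift : ∀ k → deriv Su k + Su (suc k) ≡ deriv u (suc k)
    shift k = trans (lemma₃ (ι (suc k)) (Su (suc k))) (cong (_* Su (suc k)) (sym (ι-suc (suc k))))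

  -- Both sides have constant term 1 and satisfy the formal differential equation E′ = (x + y) E,
  -- which determines all coefficients. This takes the place of the binomial theorem.
  conv-expTerm : ∀ x y n → conv (expTerm x) (expTerm y) n ≡ expTerm (x + y) n
  conv-expTerm x y zero = trans (cong₂ _*_ (expTerm-zero x) (expTerm-zero y))
    (trans (*-identityˡ 1ℚ) (sym (expTerm-zero (x + y))))
  conv-expTerm x y (suc n) = ι-suc-cancel n (begin
    ι (suc n) * conv ex ey (suc n)             ≡⟨ leibniz n ex ey ⟩
    conv (deriv ex) ey n + conv ex (deriv ey) n
      ≡⟨ cong₂ _+_ (trans (conv-cong n (expTerm-suc x) (λ _ → refl)) (conv-*ˡ n x ex ey))
                   (trans (conv-cong n (λ _ → refl) (expTerm-suc y)) (conv-*ʳ n y ex ey)) ⟩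
    x * conv ex ey n + y * conv ex ey n        ≡⟨ sym (*-distribʳ-+ (conv ex ey n) x y) ⟩
    (x + y) * conv ex ey n                     ≡⟨ cong ((x + y) *_) (conv-expTerm x y n) ⟩
    (x + y) * expTerm (x + y) n                ≡⟨ sym (expTerm-suc (x + y) n) ⟩
    ι (suc n) * expTerm (x + y) (suc n) ∎)
    where
    open ≡-Reasoning
    ex = expTerm x
    ey = expTerm y

  -- Dropping the first term halves `a`, and a + 2(a/2) = 2a reproduces the bound.
  geometric-bound : ∀ n a {w : ℕ → ℚ} → (∀ k → ∣ w k ∣ ≤ a * ½ ^ k) → ∣ ∑ n w ∣ ≤ a + a
  geometric-bound zero    a {w} w≤ = 0≤+ 0≤a 0≤a
    where
    0≤a : 0ℚ ≤ a
    0≤a = ≤-respʳ (*-identityʳ a) (≤-trans (0≤∣p∣ (w 0)) (w≤ 0))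
  geometric-bound (suc n) a {w} w≤ = ≤-trans (∣p+q∣≤∣p∣+∣q∣ (w 0) _)
    (≤-trans (+-mono-≤ (≤-respʳ (*-identityʳ a) (w≤ 0))
        (geometric-bound n (a * ½) (λ k → ≤-respʳ (sym (*-assoc a ½ (½ ^ k))) (w≤ (suc k)))))
      (≤-reflexive (cong (a +_) (lemma a))))
    where
    lemma : ∀ a → a * ½ + a * ½ ≡ a
    lemma = solve-∀ solver-ring

  ¼ : ℚ
  ¼ = ½ * ½

  ¼≤½ : ¼ ≤ ½
  ¼≤½ = ½*p≤p 0≤½

  ∑-+ : ∀ n (f g : ℕ → ℚ) → ∑ n (λ k → f k + g k) ≡ ∑ n f + ∑ n g
  ∑-+ zero    f g = refl
  ∑-+ (suc n) f g = trans (cong (f 0 + g 0 +_) (∑-+ n (f ∘ suc) (g ∘ suc))) (lemma (f 0) (g 0) _ _)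
    where
    lemma : ∀ a b c d → a + b + (c + d) ≡ a + c + (b + d)
    lemma = solve-∀ solver-ring

  *-∑ : ∀ n c (f : ℕ → ℚ) → ∑ n (λ k → c * f k) ≡ c * ∑ n f
  *-∑ zero    c f = sym (*-zeroʳ c)
  *-∑ (suc n) c f = trans (cong (c * f 0 +_) (*-∑ n c (f ∘ suc))) (sym (*-distribˡ-+ c (f 0) _))

  ∑-conv-suc : ∀ n (u v : ℕ → ℚ) →
    ∑ (suc n) (conv u v) ≡ u 0 * ∑ (suc n) v + ∑ n (conv (u ∘ suc) v)
  ∑-conv-suc n u v = trans (cong (u 0 * v 0 +_)
      (trans (∑-+ n (λ k → u 0 * v (suc k)) (conv (u ∘ suc) v)) (cong (_+ ∑ n (conv (u ∘ suc) v)) (*-∑ n (u 0) (v ∘ suc)))))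
    (lemma (u 0) (v 0) _ _)
    where
    lemma : ∀ a b c d → a * b + (a * c + d) ≡ a * (b + c) + d
    lemma = solve-∀ solver-ring

  -- The difference consists of the products with i + j ≥ N. The ratio ¼ for `u` makes the induction
  -- close: the first row leaves at most 2a/2ᴺ⁺¹, and the shifted `u`, with a/4 in place of `a`, as
  -- much again. With ratio ½ for both series this estimate would only give order N/2ᴺ. `M` is
  -- separate from `N` because `v` is never shifted.
  cauchy-product : ∀ N M a {u v : ℕ → ℚ} → N ℕ.≤ M →
    (∀ k → ∣ u k ∣ ≤ a * ¼ ^ k) → (∀ k → ∣ v k ∣ ≤ ½ ^ k) →
    ∣ ∑ N u * ∑ M v - ∑ N (conv u v) ∣ ≤ (a + a + (a + a)) * ½ ^ N
  cauchy-product zero    M a {u} {v} _ u≤ v≤ = ≤-respˡ (sym (cong ∣_∣ (lemma (∑ M v))))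
    (0≤* (0≤+ (0≤+ 0≤a 0≤a) (0≤+ 0≤a 0≤a)) 0≤1)
    where
    0≤a : 0ℚ ≤ a
    0≤a = ≤-respʳ (*-identityʳ a) (≤-trans (0≤∣p∣ (u 0)) (u≤ 0))
    lemma : ∀ s → 0ℚ * s - 0ℚ ≡ 0ℚ
    lemma = solve-∀ solver-ring
  cauchy-product (suc N) M a {u} {v} N<M u≤ v≤ = begin
    ∣ ∑ (suc N) u * ∑ M v - ∑ (suc N) (conv u v) ∣
      ≡⟨ cong ∣_∣ (trans (cong₂ (λ s t → ∑ (suc N) u * s - t) split (∑-conv-suc N u v))
           (trans (lemma (u 0) (∑ N Su) (∑ (suc N) v) tail (∑ N (conv Su v)))
             (cong (λ s → u 0 * tail + (∑ N Su * s - ∑ N (conv Su v))) (sym split)))) ⟩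
    ∣ u 0 * tail + (∑ N Su * ∑ M v - ∑ N (conv Su v)) ∣
      ≤⟨ ∣p+q∣≤∣p∣+∣q∣ (u 0 * tail) _ ⟩
    ∣ u 0 * tail ∣ + ∣ ∑ N Su * ∑ M v - ∑ N (conv Su v) ∣
      ≤⟨ +-mono-≤
           (≤-respˡ (sym (∣p*q∣≡∣p∣*∣q∣ (u 0) tail))
             (*-mono-≤ (0≤∣p∣ (u 0)) (≤-respʳ (*-identityʳ a) (u≤ 0)) (0≤∣p∣ tail) tail-bound))
           (cauchy-product N M (a * ¼) (ℕ.<⇒≤ N<M)
             (λ k → ≤-respʳ (sym (*-assoc a ¼ (¼ ^ k))) (u≤ (suc k))) v≤) ⟩
    a * (½ ^ suc N + ½ ^ suc N) + (a * ¼ + a * ¼ + (a * ¼ + a * ¼)) * ½ ^ N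
      ≡⟨ lemma₂ a (½ ^ N) ⟩
    (a + a + (a + a)) * ½ ^ suc N ∎
    where
    open ≤-Reasoning
    Su = u ∘ suc
    tail = ∑ (M ℕ.∸ suc N) (λ k → v (suc N ℕ.+ k))
    split : ∑ M v ≡ ∑ (suc N) v + tail
    split = trans (cong (λ m → ∑ m v) (sym (ℕ.m+[n∸m]≡n N<M))) (∑-++ (suc N) (M ℕ.∸ suc N) v)
    tail-bound : ∣ tail ∣ ≤ ½ ^ suc N + ½ ^ suc N
    tail-bound = geometric-bound (M ℕ.∸ suc N) (½ ^ suc N)
      (λ k → ≤-respʳ (^-homo-* ½ (suc N) k) (v≤ (suc N ℕ.+ k)))
    lemma : ∀ a b c d e → (a + b) * (c + d) - (a * c + e) ≡ a * d + (b * (c + d) - e)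
    lemma = solve-∀ solver-ring
    lemma₂ : ∀ a h → a * (½ * h + ½ * h) + (a * (½ * ½) + a * (½ * ½) + (a * (½ * ½) + a * (½ * ½))) * h
      ≡ (a + a + (a + a)) * (½ * h)
    lemma₂ = solve-∀ solver-ring

  ∣expTerm∣≤ : ∀ {x r} k → ∣ x ∣ ≤ r → ∣ expTerm x k ∣ ≤ r ^ k
  ∣expTerm∣≤ {x} {r} k ∣x∣≤r = ≤-respˡ (sym (∣p*q∣≡∣p∣*∣q∣ 1/k! (x ^ k)))
    (≤-trans (*-mono-≤ (0≤∣p∣ 1/k!) ∣1/k!∣≤1 (0≤∣p∣ (x ^ k)) ∣x^k∣≤) (≤-reflexive (*-identityˡ _)))
    where
    instance
      _ = k ℕ.!≢0
    1/k! = recip (k !)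
    ∣1/k!∣≤1 : ∣ 1/k! ∣ ≤ 1ℚ
    ∣1/k!∣≤1 = ≤-respˡ (sym (0≤p⇒∣p∣≡p (<⇒≤ (0<recip (k !))))) (recip≤1 (k !))
    ∣x^k∣≤ : ∣ x ^ k ∣ ≤ r ^ k
    ∣x^k∣≤ = ≤-respˡ (sym (∣x^n∣ x k)) (^-mono-≤ k (0≤∣p∣ x) ∣x∣≤r)

  four : ℚ
  four = 1ℚ + 1ℚ + (1ℚ + 1ℚ)

  expSum-+ : ∀ N {x y} → ∣ x ∣ ≤ ¼ → ∣ y ∣ ≤ ¼ →
    ∣ expSum N x * expSum N y - expSum N (x + y) ∣ ≤ four * ½ ^ N
  expSum-+ N {x} {y} x≤ y≤ = ≤-respˡ
    (cong (λ s → ∣ expSum N x * expSum N y - s ∣) (∑-cong N (conv-expTerm x y)))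
    (cauchy-product N N 1ℚ ℕ.≤-refl
      (λ k → ≤-respʳ (sym (*-identityˡ _)) (∣expTerm∣≤ k x≤)) (λ k → ∣expTerm∣≤ k (≤-trans y≤ ¼≤½)))

  ∣expSum∣≤2 : ∀ N {x} → ∣ x ∣ ≤ ¼ → ∣ expSum N x ∣ ≤ 1ℚ + 1ℚ
  ∣expSum∣≤2 N {x} x≤ = geometric-bound N 1ℚ
    (λ k → ≤-respʳ (sym (*-identityˡ _)) (∣expTerm∣≤ k (≤-trans x≤ ¼≤½)))

  -- Truncated exponentials are multiplicative up to 4/2ᴺ. One more factor adds this error and at
  -- most doubles the old one, as partial sums are bounded by 2; hence `C` becomes 4 + 2C.
  expSum-^ : ∀ m → ∃[ C ] (0ℚ ≤ C × (∀ N {θ} → ι (suc m) * ∣ θ ∣ ≤ ¼ →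
    ∣ expSum N (ι (suc m) * θ) - expSum N θ ^ suc m ∣ ≤ C * ½ ^ N))
  expSum-^ zero = 0ℚ , ≤-refl , λ N {θ} _ → ≤-reflexive (trans
    (cong ∣_∣ (trans (cong₂ _-_ (cong (expSum N) (trans (cong (_* θ) ι1≡1) (*-identityˡ θ)))
      (*-identityʳ (expSum N θ))) (+-inverseʳ (expSum N θ)))) (sym (*-zeroˡ (½ ^ N))))
  expSum-^ (suc m) with expSum-^ m
  ... | C , 0≤C , ih = four + (1ℚ + 1ℚ) * C , 0≤+ (nonNegative⁻¹ four) (0≤* (nonNegative⁻¹ (1ℚ + 1ℚ)) 0≤C) , bound
    where
    bound : ∀ N {θ} → ι (suc (suc m)) * ∣ θ ∣ ≤ ¼ →
      ∣ expSum N (ι (suc (suc m)) * θ) - expSum N θ ^ suc (suc m) ∣ ≤ (four + (1ℚ + 1ℚ) * C) * ½ ^ N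
    bound N {θ} hθ = begin
      ∣ expSum N (ι (suc (suc m)) * θ) - P * P ^ suc m ∣
        ≡⟨ cong (λ t → ∣ expSum N t - P * P ^ suc m ∣) arg ⟩
      ∣ expSum N (θ + mθ) - P * P ^ suc m ∣
        ≡⟨ cong ∣_∣ (lemma (expSum N (θ + mθ)) P (expSum N mθ) (P ^ suc m)) ⟩
      ∣ (expSum N (θ + mθ) - P * expSum N mθ) + P * (expSum N mθ - P ^ suc m) ∣
        ≤⟨ ∣p+q∣≤∣p∣+∣q∣ (expSum N (θ + mθ) - P * expSum N mθ) _ ⟩
      ∣ expSum N (θ + mθ) - P * expSum N mθ ∣ + ∣ P * (expSum N mθ - P ^ suc m) ∣
        ≡⟨ cong₂ _+_ (∣p-q∣≡∣q-p∣ (expSum N (θ + mθ)) _) (∣p*q∣≡∣p∣*∣q∣ P _) ⟩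
      ∣ P * expSum N mθ - expSum N (θ + mθ) ∣ + ∣ P ∣ * ∣ expSum N mθ - P ^ suc m ∣
        ≤⟨ +-mono-≤ (expSum-+ N ∣θ∣≤ ∣mθ∣≤)
             (*-mono-≤ (0≤∣p∣ P) (∣expSum∣≤2 N ∣θ∣≤) (0≤∣p∣ (expSum N mθ - P ^ suc m)) (ih N hmθ)) ⟩
      four * ½ ^ N + (1ℚ + 1ℚ) * (C * ½ ^ N)
        ≡⟨ lemma₂ (½ ^ N) C ⟩
      (four + (1ℚ + 1ℚ) * C) * ½ ^ N ∎
      where
      open ≤-Reasoning
      P = expSum N θ
      mθ = ι (suc m) * θ
      arg : ι (suc (suc m)) * θ ≡ θ + mθ
      arg = trans (cong (_* θ) (ι-suc (suc m))) (lemma₀ (ι (suc m)) θ)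
        where
        lemma₀ : ∀ i t → (1ℚ + i) * t ≡ t + i * t
        lemma₀ = solve-∀ solver-ring
      hmθ : ι (suc m) * ∣ θ ∣ ≤ ¼
      hmθ = ≤-trans (*-monoʳ-≤ (0≤∣p∣ θ) (ι-mono (ℕ.n≤1+n (suc m)))) hθ
      ∣θ∣≤ : ∣ θ ∣ ≤ ¼
      ∣θ∣≤ = ≤-trans (≤-respˡ (*-identityˡ ∣ θ ∣) (*-monoʳ-≤ (0≤∣p∣ θ) (1≤ι (suc (suc m))))) hθ
      ∣mθ∣≤ : ∣ mθ ∣ ≤ ¼
      ∣mθ∣≤ = ≤-respˡ (sym (trans (∣p*q∣≡∣p∣*∣q∣ (ι (suc m)) θ)
        (cong (_* ∣ θ ∣) (0≤p⇒∣p∣≡p (0≤ι (suc m)))))) hmθ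
      lemma : ∀ e p q r → e - p * r ≡ (e - p * q) + p * (q - r)
      lemma = solve-∀ solver-ring
      lemma₂ : ∀ h c → (1ℚ + 1ℚ + (1ℚ + 1ℚ)) * h + (1ℚ + 1ℚ) * (c * h) ≡ (1ℚ + 1ℚ + (1ℚ + 1ℚ) + (1ℚ + 1ℚ) * c) * h
      lemma₂ = solve-∀ solver-ring

  -- From the quadratic term on, the terms are at most ¼∣θ∣ times those of a geometric series with
  -- ratio ½.
  expSum-linear : ∀ N {θ} → ∣ θ ∣ ≤ ¼ → ∣ expSum (2 ℕ.+ N) θ - (1ℚ + θ) ∣ ≤ ½ * ∣ θ ∣
  expSum-linear N {θ} ∣θ∣≤ = ≤-respˡ (cong ∣_∣ (sym split))
    (≤-respʳ (lemma₂ ∣ θ ∣) (geometric-bound N (¼ * ∣ θ ∣) tail-bound))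
    where
    tail = ∑ N (λ k → expTerm θ (2 ℕ.+ k))
    lemma : ∀ θ t → (1ℚ * 1ℚ + (1ℚ * (θ * 1ℚ) + t)) - (1ℚ + θ) ≡ t
    lemma = solve-∀ solver-ring
    lemma₂ : ∀ t → (½ * ½) * t + (½ * ½) * t ≡ ½ * t
    lemma₂ = solve-∀ solver-ring
    split : expSum (2 ℕ.+ N) θ - (1ℚ + θ) ≡ tail
    split = trans (cong (λ r → (r * 1ℚ + (r * (θ * 1ℚ) + tail)) - (1ℚ + θ)) recip1≡1) (lemma θ tail)
    tail-bound : ∀ k → ∣ expTerm θ (2 ℕ.+ k) ∣ ≤ ¼ * ∣ θ ∣ * ½ ^ k
    tail-bound k = ≤-trans (∣expTerm∣≤ {θ} {∣ θ ∣} (2 ℕ.+ k) ≤-refl)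
      (≤-respˡ (*-assoc ∣ θ ∣ ∣ θ ∣ (∣ θ ∣ ^ k))
        (*-mono-≤ (0≤* (0≤∣p∣ θ) (0≤∣p∣ θ)) (*-monoʳ-≤ (0≤∣p∣ θ) ∣θ∣≤) (0≤^ k (0≤∣p∣ θ))
          (^-mono-≤ k (0≤∣p∣ θ) (≤-trans ∣θ∣≤ ¼≤½))))

  ∏-first : ∀ n .{{_ : ℕ.NonZero n}} {f : ℕ → ℚ} {c m} → (∀ k → 0ℚ ≤ f k) →
    f 0 ≤ c * m → (∀ k → k ℕ.< n → f k ≤ m) → ∏ n f ≤ c * m ^ n
  ∏-first (suc n) {f} {c} {m} 0≤f f₀≤ f≤ = ≤-respʳ (*-assoc c m (m ^ n))
    (*-mono-≤ (0≤f 0) f₀≤ (∏-nonneg n (λ k → 0≤f (suc k)))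
      (≤-respʳ (∏-const n m) (∏-mono-≤ n (λ k → 0≤f (suc k)) (λ k k<n → f≤ (suc k) (s≤s k<n)))))

  -- Partial Euler products

  euler : ℕ → ℚ → ℚ
  euler K y = ∏ K (λ k → 1ℚ - y ^ suc k)

  module _ {y : ℚ} (0≤y : 0ℚ ≤ y) (y≤1 : y ≤ 1ℚ) where

    0≤1-^ : ∀ n → 0ℚ ≤ 1ℚ - y ^ n
    0≤1-^ n = p≤q⇒0≤q-p (^≤1 n 0≤y y≤1)

    1-^≤1 : ∀ n → 1ℚ - y ^ n ≤ 1ℚ
    1-^≤1 n = ≤-by (y ^ n) (0≤^ n 0≤y) (lemma (y ^ n))
      where
      lemma : ∀ z → 1ℚ ≡ 1ℚ - z + z
      lemma = solve-∀ solver-ring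

    1-^-mono : ∀ {m n} → m ℕ.≤ n → 1ℚ - y ^ m ≤ 1ℚ - y ^ n
    1-^-mono m≤n = +-monoʳ-≤ 1ℚ (neg-antimono-≤ (^-antimono-≤ 0≤y y≤1 m≤n))

    0≤euler : ∀ K → 0ℚ ≤ euler K y
    0≤euler K = ∏-nonneg K (λ k → 0≤1-^ (suc k))

    euler-antimono : ∀ {K L} → K ℕ.≤ L → euler L y ≤ euler K y
    euler-antimono = ∏-antimono (λ k → 0≤1-^ (suc k)) (λ k → 1-^≤1 (suc k))

    -- y^a - y^m ≥ y^(m-1) (1 - y) ≥ (1 - y) / 2 ≥ (1 - y^m) / 2m as long as m (1 - y) ≤ 1/2.
    1-^-gap : ∀ {a} m .{{_ : ℕ.NonZero m}} → a ℕ.< m → ι m * (1ℚ - y) ≤ ½ →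
      1ℚ - y ^ a ≤ (1ℚ - ½ * recip m) * (1ℚ - y ^ m)
    1-^-gap {a} (suc m) (s≤s a≤m) small = ≤-trans (1-^-mono a≤m) (≤-by (g₁ + g₂) (0≤+ 0≤g₁ 0≤g₂)
      (trans (lemma (½ * recip (suc m)) (y ^ m) y)
        (cong (λ t → 1ℚ - y ^ m + ((y ^ m - ½) * (1ℚ - y) + (t * (½ * (1ℚ - y)) - ½ * recip (suc m) * (1ℚ - y ^ suc m))))
          (sym (ι*recip (suc m))))))
      where
      g₁ = (y ^ m - ½) * (1ℚ - y)
      g₂ = ι (suc m) * recip (suc m) * (½ * (1ℚ - y)) - ½ * recip (suc m) * (1ℚ - y ^ suc m)
      ½≤y^m : ½ ≤ y ^ m
      ½≤y^m = ≤-trans (≤-by (½ - (1ℚ - y ^ suc m))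
          (p≤q⇒0≤q-p (≤-trans (bernoulli (suc m) 0≤y y≤1) small)) (lemma₁ (y ^ suc m)))
        (^-antimono-≤ 0≤y y≤1 (ℕ.n≤1+n m))
        where
        lemma₁ : ∀ z → z ≡ ½ + (½ - (1ℚ - z))
        lemma₁ = solve-∀ solver-ring
      0≤g₁ : 0ℚ ≤ g₁
      0≤g₁ = 0≤* (p≤q⇒0≤q-p ½≤y^m) (p≤q⇒0≤q-p y≤1)
      0≤g₂ : 0ℚ ≤ g₂
      0≤g₂ = ≤-respʳ (lemma₂ (recip (suc m)) (ι (suc m)) (1ℚ - y) (1ℚ - y ^ suc m))
        (0≤* (0≤* 0≤½ (<⇒≤ (0<recip (suc m)))) (p≤q⇒0≤q-p (bernoulli (suc m) 0≤y y≤1)))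
        where
        lemma₂ : ∀ r i h z → ½ * r * (i * h - z) ≡ i * r * (½ * h) - ½ * r * z
        lemma₂ = solve-∀ solver-ring
      lemma : ∀ c z y → (1ℚ - c) * (1ℚ - y * z) ≡
        1ℚ - z + ((z - ½) * (1ℚ - y) + (1ℚ * (½ * (1ℚ - y)) - c * (1ℚ - y * z)))
      lemma = solve-∀ solver-ring

    -- In the block of exponents kp + 1, ..., kp + p every factor is at least 1 - yᵏᵖ, which is a
    -- factor of the Euler product at yᵖ.
    [1-y]*euler^p≤ : ∀ p K → ((1ℚ - y) * euler K (y ^ p)) ^ p ≤ euler (suc K ℕ.* p) y
    [1-y]*euler^p≤ p K = begin
      (∏ (suc K) l) ^ p                     ≡⟨ sym (∏-^ (suc K) l p) ⟩
      ∏ (suc K) (λ k → l k ^ p)             ≡⟨ ∏-cong (suc K) (λ k → sym (∏-const p (l k))) ⟩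
      ∏ (suc K) (λ k → ∏ p (λ _ → l k))
        ≤⟨ ∏-mono-≤ (suc K) (λ k → ∏-nonneg p (λ _ → 0≤l k))
             (λ k _ → ∏-mono-≤ p (λ _ → 0≤l k) (λ j _ → l≤ k j)) ⟩
      ∏ (suc K) (λ k → ∏ p (λ j → 1ℚ - y ^ suc (k ℕ.* p ℕ.+ j)))
        ≡⟨ sym (∏-blocks (suc K) p (λ k → 1ℚ - y ^ suc k)) ⟩
      euler (suc K ℕ.* p) y ∎
      where
      open ≤-Reasoning
      l : ℕ → ℚ
      -- For k = 0 the bound 1 - yᵏᵖ would be 0, so the least factor of the block replaces it. This
      -- is the origin of the loss h, and the reason why `suc K` blocks face `K` factors.
      l zero    = 1ℚ - y
      l (suc k) = 1ℚ - (y ^ p) ^ suc k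
      0≤l : ∀ k → 0ℚ ≤ l k
      0≤l zero    = p≤q⇒0≤q-p y≤1
      0≤l (suc k) = ≤-respʳ (cong (λ t → 1ℚ - t) (sym (^-assocʳ y p (suc k)))) (0≤1-^ (p ℕ.* suc k))
      l≤ : ∀ k j → l k ≤ 1ℚ - y ^ suc (k ℕ.* p ℕ.+ j)
      l≤ zero    j = ≤-respˡ (cong (λ t → 1ℚ - t) (*-identityʳ y)) (1-^-mono {1} {suc j} (s≤s z≤n))
      l≤ (suc k) j = ≤-respˡ (cong (λ t → 1ℚ - t) (sym (^-assocʳ y p (suc k))))
        (1-^-mono (ℕ.≤-trans (ℕ.≤-reflexive (ℕ.*-comm p (suc k)))
          (ℕ.≤-trans (ℕ.m≤m+n _ j) (ℕ.n≤1+n _))))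

    -- Every factor is O(1 - y) by `bernoulli` and at most 1, so any fixed number `M` of factors
    -- yields decay like that power of 1 - y.
    euler≤C*[1-y]^ : ∀ p {M K} → M ℕ.≤ K →
      euler K (y ^ p) ≤ ∏ M (λ k → ι (p ℕ.* suc k)) * (1ℚ - y) ^ M
    euler≤C*[1-y]^ p {M} {K} M≤K = begin
      euler K (y ^ p)                               ≡⟨ ∏-cong K (λ k → cong (λ t → 1ℚ - t) (^-assocʳ y p (suc k))) ⟩
      ∏ K (λ k → 1ℚ - y ^ (p ℕ.* suc k))
        ≤⟨ ∏-antimono (λ k → 0≤1-^ (p ℕ.* suc k)) (λ k → 1-^≤1 (p ℕ.* suc k)) M≤K ⟩
      ∏ M (λ k → 1ℚ - y ^ (p ℕ.* suc k))
        ≤⟨ ∏-mono-≤ M (λ k → 0≤1-^ (p ℕ.* suc k)) (λ k _ → bernoulli (p ℕ.* suc k) 0≤y y≤1) ⟩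
      ∏ M (λ k → ι (p ℕ.* suc k) * (1ℚ - y))        ≡⟨ ∏-* M (λ k → ι (p ℕ.* suc k)) (λ _ → 1ℚ - y) ⟩
      ∏ M (λ k → ι (p ℕ.* suc k)) * ∏ M (λ _ → 1ℚ - y) ≡⟨ cong (∏ M (λ k → ι (p ℕ.* suc k)) *_) (∏-const M (1ℚ - y)) ⟩
      ∏ M (λ k → ι (p ℕ.* suc k)) * (1ℚ - y) ^ M ∎
      where open ≤-Reasoning

    -- The factors of each block of p consecutive ones are at most the last factor of the block.
    euler≤D*euler^p : ∀ p .{{_ : ℕ.NonZero p}} {n K} → 1 ℕ.< p → n ℕ.≤ K → ι (n ℕ.* p) * (1ℚ - y) ≤ ½ →
      euler (K ℕ.* p) y ≤ ∏ n (λ k → 1ℚ - ½ * recip (suc k ℕ.* p) {{ℕ.m*n≢0 (suc k) p}}) * euler K (y ^ p) ^ p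
    euler≤D*euler^p p {n} {K} 1<p n≤K small = begin
      euler (K ℕ.* p) y         ≡⟨ ∏-blocks K p (λ k → 1ℚ - y ^ suc k) ⟩
      ∏ K block                 ≡⟨ cong (λ k → ∏ k block) (sym K≡) ⟩
      ∏ (n ℕ.+ K′) block        ≡⟨ ∏-++ n K′ block ⟩
      ∏ n block * ∏ K′ (λ k → block (n ℕ.+ k))
        ≤⟨ *-mono-≤ (∏-nonneg n 0≤block) (∏-mono-≤ n 0≤block (λ k k<n → block-gap k (d k) (first-gap k k<n)))
             (∏-nonneg K′ (λ k → 0≤block (n ℕ.+ k)))
             (∏-mono-≤ K′ (λ k → 0≤block (n ℕ.+ k)) (λ k _ → block≤ (n ℕ.+ k))) ⟩
      ∏ n (λ k → d k * m k ^ p) * rest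
        ≡⟨ cong (_* rest) (∏-* n d (λ k → m k ^ p)) ⟩
      ∏ n d * ∏ n (λ k → m k ^ p) * rest
        ≡⟨ *-assoc (∏ n d) (∏ n (λ k → m k ^ p)) rest ⟩
      ∏ n d * (∏ n (λ k → m k ^ p) * rest)
        ≡⟨ cong (∏ n d *_) (sym (∏-++ n K′ (λ k → m k ^ p))) ⟩
      ∏ n d * ∏ (n ℕ.+ K′) (λ k → m k ^ p)
        ≡⟨ cong (∏ n d *_) (trans (cong (λ k → ∏ k (λ k → m k ^ p)) K≡) (∏-^ K m p)) ⟩
      ∏ n d * ∏ K m ^ p
        ≡⟨ cong (λ t → ∏ n d * t ^ p) (∏-cong K (λ k → cong (λ t → 1ℚ - t) (e k))) ⟩
      ∏ n d * euler K (y ^ p) ^ p ∎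
      where
      open ≤-Reasoning
      K′ = K ℕ.∸ n
      K≡ : n ℕ.+ K′ ≡ K
      K≡ = ℕ.m+[n∸m]≡n n≤K
      f : ℕ → ℕ → ℚ
      f k j = 1ℚ - y ^ suc (k ℕ.* p ℕ.+ j)
      block d m : ℕ → ℚ
      block k = ∏ p (f k)
      d k = 1ℚ - ½ * recip (suc k ℕ.* p) {{ℕ.m*n≢0 (suc k) p}}
      m k = 1ℚ - y ^ (suc k ℕ.* p)
      rest = ∏ K′ (λ k → m (n ℕ.+ k) ^ p)
      e : ∀ k → y ^ (suc k ℕ.* p) ≡ (y ^ p) ^ suc k
      e k = trans (cong (y ^_) (ℕ.*-comm (suc k) p)) (sym (^-assocʳ y p (suc k)))
      0≤block : ∀ k → 0ℚ ≤ block k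
      0≤block k = ∏-nonneg p (λ j → 0≤1-^ (suc (k ℕ.* p ℕ.+ j)))
      index≤ : ∀ k {j} → j ℕ.< p → suc (k ℕ.* p ℕ.+ j) ℕ.≤ suc k ℕ.* p
      index≤ k {j} j<p = ℕ.≤-trans (ℕ.≤-reflexive (sym (ℕ.+-suc (k ℕ.* p) j)))
        (ℕ.≤-trans (ℕ.+-monoʳ-≤ (k ℕ.* p) j<p) (ℕ.≤-reflexive (ℕ.+-comm (k ℕ.* p) p)))
      0<p : 0 ℕ.< p
      0<p = ℕ.<-trans (s≤s z≤n) 1<p
      -- As `1 < p`, the first exponent of a block lies strictly below the last one, so this factor
      -- saves the ratio `d k`. The saving is claimed for the first `n` blocks, where the exponents
      -- times 1 - y stay below ½.
      first-gap : ∀ k → k ℕ.< n → f k 0 ≤ d k * m k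
      first-gap k k<n = 1-^-gap (suc k ℕ.* p) {{ℕ.m*n≢0 (suc k) p}}
        (ℕ.≤-trans (ℕ.≤-reflexive (cong suc (sym (ℕ.+-suc (k ℕ.* p) 0)))) (index≤ k 1<p))
        (≤-trans (*-monoʳ-≤ (p≤q⇒0≤q-p y≤1) (ι-mono (ℕ.*-monoˡ-≤ p k<n))) small)
      block-gap : ∀ k c → f k 0 ≤ c * m k → block k ≤ c * m k ^ p
      block-gap k c h = ∏-first p {f k} {c} {m k} (λ j → 0≤1-^ (suc (k ℕ.* p ℕ.+ j))) h (λ j j<p → 1-^-mono (index≤ k j<p))
      block≤ : ∀ k → block k ≤ m k ^ p
      block≤ k = ≤-respʳ (*-identityˡ (m k ^ p))
        (block-gap k 1ℚ (≤-respʳ (sym (*-identityˡ (m k))) (1-^-mono (index≤ k 0<p))))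

    -- This is ∏ (1 - aₖ) ≥ 1 - ∑ aₖ with the geometric sum yˢ / (1 - y), multiplied by 1 - y to
    -- avoid the division. Peeling the front factor works because (1 - yˢ)(1 - y - yˢ⁺¹) exceeds 1 -
    -- y - yˢ by yˢ yˢ⁺¹.
    euler-tail : ∀ K s → 1ℚ - y - y ^ s ≤ (1ℚ - y) * ∏ K (λ k → 1ℚ - y ^ (s ℕ.+ k))
    euler-tail zero    s = ≤-by (y ^ s) (0≤^ s 0≤y) (lemma y (y ^ s))
      where
      lemma : ∀ y z → (1ℚ - y) * 1ℚ ≡ 1ℚ - y - z + z
      lemma = solve-∀ solver-ring
    euler-tail (suc K) s = ≤-trans
      (≤-by (y ^ s * y ^ suc s) (0≤* (0≤^ s 0≤y) (0≤^ (suc s) 0≤y)) (lemma y (y ^ s)))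
      (≤-trans (*-monoˡ-≤ (0≤1-^ s) (euler-tail K (suc s)))
        (≤-reflexive (trans (lemma₂ (1ℚ - y ^ s) (1ℚ - y) (∏ K (λ k → 1ℚ - y ^ suc (s ℕ.+ k))))
          (cong ((1ℚ - y) *_) (cong₂ (λ a b → (1ℚ - y ^ a) * b) (sym (ℕ.+-identityʳ s))
            (∏-cong K (λ k → cong (λ t → 1ℚ - y ^ t) (sym (ℕ.+-suc s k)))))))))
      where
      lemma : ∀ y z → (1ℚ - z) * (1ℚ - y - y * z) ≡ 1ℚ - y - z + z * (y * z)
      lemma = solve-∀ solver-ring
      lemma₂ : ∀ a b c → a * (b * c) ≡ b * (a * c)
      lemma₂ = solve-∀ solver-ring

  -- Past an index `M` with yᴹ ≤ h/2 the tail stays above ½ whatever its length, and the finitely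
  -- many earlier factors are positive. Uniformity in `K` keeps the infinite product away from 0.
  euler-lower : ∀ {y} → 0ℚ ≤ y → y < 1ℚ →
    ∃[ ρ ] (0ℚ < ρ × (∀ K {w} → 0ℚ ≤ w → w ≤ y → ρ ≤ euler K w))
  euler-lower {y} 0≤y y<1 = bound (^-small 0<h h≤1 (0<½* 0<h))
    where
    y≤1 : y ≤ 1ℚ
    y≤1 = <⇒≤ y<1
    h = 1ℚ - y
    0<h : 0ℚ < h
    0<h = subst (_< h) (+-inverseʳ y) (+-monoˡ-< (- y) y<1)
    h≤1 : h ≤ 1ℚ
    h≤1 = ≤-by y 0≤y (lemma y)
      where
      lemma : ∀ y → 1ℚ ≡ (1ℚ - y) + y
      lemma = solve-∀ solver-ring
    0<factor : ∀ k → 0ℚ < 1ℚ - y ^ suc k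
    0<factor k = <-≤-trans 0<h (+-monoʳ-≤ 1ℚ (neg-antimono-≤ (p*q≤p 0≤y (^≤1 k 0≤y y≤1))))
    tail : ℕ → ℕ → ℚ
    tail M K = ∏ K (λ k → 1ℚ - y ^ (suc M ℕ.+ k))
    tail≥½ : ∀ {M} → y ^ M ≤ ½ * h → ∀ K → ½ ≤ tail M K
    tail≥½ {M} y^M≤ K = *-cancelˡ-≤ {h} {½} {tail M K} 0<h (≤-trans
      (≤-by {h * ½} {h - y ^ suc M} (½ * h - y ^ suc M)
        (p≤q⇒0≤q-p (≤-trans (p*q≤q (0≤^ M 0≤y) y≤1) y^M≤)) (lemma₂ h (y ^ suc M)))
      (euler-tail 0≤y y≤1 K (suc M)))
      where
      lemma₂ : ∀ h z → h - z ≡ h * ½ + (½ * h - z)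
      lemma₂ = solve-∀ solver-ring
    bound : ∃[ M ] (1ℚ - h) ^ M ≤ ½ * h →
      ∃[ ρ ] (0ℚ < ρ × (∀ K {w} → 0ℚ ≤ w → w ≤ y → ρ ≤ euler K w))
    bound (M , small) = ½ * euler M y , 0<½* (∏-pos M 0<factor) , λ K {w} 0≤w w≤y → begin
      ½ * euler M y         ≡⟨ *-comm ½ (euler M y) ⟩
      euler M y * ½         ≤⟨ *-monoˡ-≤ (0≤euler 0≤y y≤1 M) (tail≥½ {M} y^M≤ K) ⟩
      euler M y * tail M K  ≡⟨ sym (∏-++ M K (λ k → 1ℚ - y ^ suc k)) ⟩
      euler (M ℕ.+ K) y     ≤⟨ euler-antimono 0≤y y≤1 (ℕ.m≤n+m K M) ⟩
      euler K y             ≤⟨ ∏-mono-≤ K (λ k → 0≤1-^ 0≤y y≤1 (suc k))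
                                 (λ k _ → +-monoʳ-≤ 1ℚ (neg-antimono-≤ (^-mono-≤ {w} {y} (suc k) 0≤w w≤y))) ⟩
      euler K w ∎
      where
      open ≤-Reasoning
      y^M≤ : y ^ M ≤ ½ * h
      y^M≤ = ≤-respˡ (cong (_^ M) (lemma y)) small
        where
        lemma : ∀ y → 1ℚ - (1ℚ - y) ≡ y
        lemma = solve-∀ solver-ring

  -- Divergence of the harmonic series

  module _ (p : ℕ) .{{_ : ℕ.NonZero p}} where

    private
      suc*≢0 : ∀ k → ℕ.NonZero (suc k ℕ.* p)
      suc*≢0 k = ℕ.m*n≢0 (suc k) p

      c : ℕ → ℚ
      c k = ½ * recip (suc k ℕ.* p) {{suc*≢0 k}}

      gain : ℚ
      gain = ½ * (½ * recip p)

      ∑-lower : ∀ n {b} {f : ℕ → ℚ} → (∀ k → k ℕ.< n → b ≤ f k) → ι n * b ≤ ∑ n f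
      ∑-lower zero    {b} _ = ≤-reflexive (trans (cong (_* b) ι0≡0) (*-zeroˡ b))
      ∑-lower (suc n) {b} b≤f = ≤-trans
        (≤-reflexive (trans (cong (_* b) (ι-suc n)) (lemma (ι n) b)))
        (+-mono-≤ (b≤f 0 (s≤s z≤n)) (∑-lower n (λ k k<n → b≤f (suc k) (s≤s k<n))))
        where
        lemma : ∀ i b → (1ℚ + i) * b ≡ b + i * b
        lemma = solve-∀ solver-ring

      -- Oresme's argument: each of the n + 1 new terms is at least 1/(4(n + 1)p), so together they
      -- contribute the fixed amount 1/(4p).
      doubling : ∀ n → ∑ (suc n) c + gain ≤ ∑ (suc n ℕ.+ suc n) c
      doubling n = ≤-trans (+-monoʳ-≤ (∑ (suc n) c) (≤-respˡ half
          (∑-lower (suc n) (λ k k<n → *-monoˡ-≤ 0≤½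
            (recip-antimono (suc (suc n ℕ.+ k) ℕ.* p) (2n ℕ.* p) {{suc*≢0 (suc n ℕ.+ k)}} {{suc*≢0 (n ℕ.+ suc n)}} (ℕ.*-monoˡ-≤ p
              (ℕ.≤-trans (ℕ.≤-reflexive (sym (ℕ.+-suc (suc n) k))) (ℕ.+-monoʳ-≤ (suc n) k<n))))))))
        (≤-reflexive (sym (∑-++ (suc n) (suc n) c)))
        where
        2n = suc n ℕ.+ suc n
        lemma : ∀ i r s → i * (½ * (r * s)) ≡ ½ * (½ * (i + i) * r * s)
        lemma = solve-∀ solver-ring
        half : ι (suc n) * (½ * recip (2n ℕ.* p) {{suc*≢0 (n ℕ.+ suc n)}}) ≡ gain
        half = trans (cong (λ r → ι (suc n) * (½ * r)) (recip-* 2n p {{_}} {{_}} {{suc*≢0 (n ℕ.+ suc n)}}))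
          (trans (lemma (ι (suc n)) (recip 2n) (recip p))
          (cong (λ t → ½ * (t * recip p)) (trans (*-assoc ½ (ι (suc n) + ι (suc n)) (recip 2n))
            (trans (cong (λ t → ½ * (t * recip 2n)) (sym (ι-+ (suc n) (suc n))))
              (trans (cong (½ *_) (ι*recip 2n)) (*-identityʳ ½))))))

      ∑-unbounded : ∀ m → ∃[ n ] ι m * gain ≤ ∑ (suc n) c
      ∑-unbounded zero = 0 , ≤-trans (≤-reflexive (trans (cong (_* gain) ι0≡0) (*-zeroˡ gain)))
        (∑-nonneg 1 (λ k → 0≤* 0≤½ (<⇒≤ (0<recip (suc k ℕ.* p) {{suc*≢0 k}}))))
      ∑-unbounded (suc m) with ∑-unbounded m
      ... | n , h = n ℕ.+ suc n , ≤-trans (≤-reflexive (trans (cong (_* gain) (ι-suc m)) (lemma (ι m) gain)))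
        (≤-trans (+-monoˡ-≤ gain h) (doubling n))
        where
        lemma : ∀ i b → (1ℚ + i) * b ≡ i * b + b
        lemma = solve-∀ solver-ring

    ∏[1-1/2k]-small : ∀ {ε} → 0ℚ < ε → ∃[ n ] ∏ n (λ k → 1ℚ - ½ * recip (suc k ℕ.* p) {{ℕ.m*n≢0 (suc k) p}}) ≤ ε
    ∏[1-1/2k]-small {ε} 0<ε =
      let m , 1≤ = archimedean-* (0<* 0<gain 0<ε)
          n , m≤ = ∑-unbounded m
      in suc n , ≤1/[1+s]⇒≤ (∑-nonneg (suc n) 0≤c) (<⇒≤ 0<ε) (∏[1-c]*[1+∑c]≤1 (suc n) 0≤c c≤1)
        (≤-trans (≤-respʳ (sym (*-assoc (ι m) gain ε)) 1≤) (*-monoʳ-≤ (<⇒≤ 0<ε) m≤))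
      where
      0<gain : 0ℚ < gain
      0<gain = 0<½* (0<½* (0<recip p))
      0≤c : ∀ k → 0ℚ ≤ c k
      0≤c k = 0≤* 0≤½ (<⇒≤ (0<recip (suc k ℕ.* p) {{suc*≢0 k}}))
      c≤1 : ∀ k → c k ≤ 1ℚ
      c≤1 k = ≤-trans (½*p≤p (<⇒≤ (0<recip (suc k ℕ.* p) {{suc*≢0 k}}))) (recip≤1 (suc k ℕ.* p) {{suc*≢0 k}})

  -- The order of magnitude of η(z) and η(pz) near the cusp 0

  two ⅛ : ℚ
  two = 1ℚ + 1ℚ
  ⅛ = ½ * (½ * ½)

  0≤two : 0ℚ ≤ two
  0≤two = nonNegative⁻¹ two

  0≤⅛ : 0ℚ ≤ ⅛
  0≤⅛ = nonNegative⁻¹ ⅛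

  ½≤1 : ½ ≤ 1ℚ
  ½≤1 = ≤-by ½ 0≤½ refl

  ¼≤1 : ½ * ½ ≤ 1ℚ
  ¼≤1 = ≤-trans (½*p≤p 0≤½) ½≤1

  ⅛≤1 : ⅛ ≤ 1ℚ
  ⅛≤1 = ≤-trans (½*p≤p (0≤* 0≤½ 0≤½)) ¼≤1

  -- What the independence argument knows about one pair of rational approximations X, Y of η(z),
  -- η(pz). `A` will bound the exponents of X, `δ` is the factor of domination, and `ρ` is a floor
  -- under both numbers. Up to a constant, `h` is 1 - exp (-2πt).
  record Magnitudes (p A : ℕ) (δ ρ X Y : ℚ) : Set where
    field
      h     : ℚ
      0≤h   : 0ℚ ≤ h
      h≤1   : h ≤ 1ℚ
      ρ≤X   : ρ ≤ X
      ρ≤Y   : ρ ≤ Y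
      X≤δYᵖ : X ≤ δ * Y ^ p
      hYᵖ≤X : (h * Y) ^ p ≤ X
      Y≤δhᵖᴬ : Y ≤ δ * h ^ (p ℕ.* A)

  module Domination {p A δ ρ X Y} (0≤δ : 0ℚ ≤ δ) (δ≤1 : δ ≤ 1ℚ) (0≤ρ : 0ℚ ≤ ρ) (M : Magnitudes p A δ ρ X Y) where
    open Magnitudes M

    0≤X : 0ℚ ≤ X
    0≤X = ≤-trans 0≤ρ ρ≤X

    0≤Y : 0ℚ ≤ Y
    0≤Y = ≤-trans 0≤ρ ρ≤Y

    Y≤1 : Y ≤ 1ℚ
    Y≤1 = ≤-trans Y≤δhᵖᴬ (≤-trans (p*q≤p 0≤δ (^≤1 (p ℕ.* A) 0≤h h≤1)) δ≤1)

    X≤Yᵖ : X ≤ Y ^ p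
    X≤Yᵖ = ≤-trans X≤δYᵖ (p*q≤q (0≤^ p 0≤Y) δ≤1)

    X≤1 : X ≤ 1ℚ
    X≤1 = ≤-trans X≤Yᵖ (^≤1 p 0≤Y Y≤1)

    monomial : ℕ → ℕ → ℚ
    monomial a b = X ^ a * Y ^ b

    0≤monomial : ∀ a b → 0ℚ ≤ monomial a b
    0≤monomial a b = 0≤* (0≤^ a 0≤X) (0≤^ b 0≤Y)

    monomial≤1 : ∀ a b → monomial a b ≤ 1ℚ
    monomial≤1 a b = ≤-trans (p*q≤p (0≤^ a 0≤X) (^≤1 b 0≤Y Y≤1)) (^≤1 a 0≤X X≤1)

    ρ^≤monomial : ∀ a b → ρ ^ a * ρ ^ b ≤ monomial a b
    ρ^≤monomial a b = *-mono-≤ (0≤^ a 0≤ρ) (^-mono-≤ a 0≤ρ ρ≤X) (0≤^ b 0≤ρ) (^-mono-≤ b 0≤ρ ρ≤Y)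

    -- Replacing X by Yᵖ on the left leaves at least one spare factor Y. It is at most δhᵖᴬ, and hᵖᵃ
    -- is the price for turning Yᵖᵃ back into Xᵃ.
    dominated-level : ∀ {a b a′ b′} → a ℕ.≤ A → p ℕ.* a ℕ.+ b ℕ.< p ℕ.* a′ ℕ.+ b′ →
      monomial a′ b′ ≤ δ * monomial a b
    dominated-level {a} {b} {a′} {b′} a≤A lt = begin
      X ^ a′ * Y ^ b′                 ≤⟨ *-monoʳ-≤ (0≤^ b′ 0≤Y) (^-mono-≤ a′ 0≤X X≤Yᵖ) ⟩
      (Y ^ p) ^ a′ * Y ^ b′           ≡⟨ cong (_* Y ^ b′) (^-assocʳ Y p a′) ⟩
      Y ^ (p ℕ.* a′) * Y ^ b′         ≡⟨ sym (^-homo-* Y (p ℕ.* a′) b′) ⟩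
      Y ^ (p ℕ.* a′ ℕ.+ b′)           ≤⟨ ^-antimono-≤ 0≤Y Y≤1 lt ⟩
      Y * Y ^ (p ℕ.* a ℕ.+ b)
        ≤⟨ *-monoʳ-≤ (0≤^ (p ℕ.* a ℕ.+ b) 0≤Y) (≤-trans Y≤δhᵖᴬ
             (*-monoˡ-≤ 0≤δ (^-antimono-≤ 0≤h h≤1 (ℕ.*-monoʳ-≤ p a≤A)))) ⟩
      δ * h ^ (p ℕ.* a) * Y ^ (p ℕ.* a ℕ.+ b)
        ≡⟨ cong₂ (λ s t → δ * s * t) (sym (^-assocʳ h p a))
             (trans (^-homo-* Y (p ℕ.* a) b) (cong (_* Y ^ b) (sym (^-assocʳ Y p a)))) ⟩
      δ * (h ^ p) ^ a * ((Y ^ p) ^ a * Y ^ b)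
        ≡⟨ lemma δ ((h ^ p) ^ a) ((Y ^ p) ^ a) (Y ^ b) ⟩
      δ * ((h ^ p) ^ a * (Y ^ p) ^ a * Y ^ b)
        ≡⟨ cong (λ t → δ * (t * Y ^ b)) (trans (sym (^-distrib-* (h ^ p) (Y ^ p) a))
             (cong (_^ a) (sym (^-distrib-* h Y p)))) ⟩
      δ * (((h * Y) ^ p) ^ a * Y ^ b)
        ≤⟨ *-monoˡ-≤ 0≤δ (*-monoʳ-≤ (0≤^ b 0≤Y) (^-mono-≤ a (0≤^ p (0≤* 0≤h 0≤Y)) hYᵖ≤X)) ⟩
      δ * (X ^ a * Y ^ b) ∎
      where
      open ≤-Reasoning
      lemma : ∀ d s t u → d * s * (t * u) ≡ d * (s * t * u)
      lemma = solve-∀ solver-ring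

    -- At equal level each surplus factor X on the left faces a Yᵖ on the right. One use of X ≤ δYᵖ
    -- produces the `δ`; X ≤ Yᵖ does for the others.
    dominated-power : ∀ {a b a′ b′} → p ℕ.* a ℕ.+ b ≡ p ℕ.* a′ ℕ.+ b′ → a ℕ.< a′ →
      monomial a′ b′ ≤ δ * monomial a b
    dominated-power {a} {b} {a′} {b′} eq a<a′ = begin
      X ^ a′ * Y ^ b′                 ≡⟨ cong (λ t → X ^ t * Y ^ b′) (sym a′≡) ⟩
      X ^ (a ℕ.+ suc d) * Y ^ b′      ≡⟨ cong (_* Y ^ b′) (^-homo-* X a (suc d)) ⟩
      X ^ a * (X * X ^ d) * Y ^ b′
        ≤⟨ *-monoʳ-≤ (0≤^ b′ 0≤Y) (*-monoˡ-≤ (0≤^ a 0≤X)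
             (*-mono-≤ 0≤X X≤δYᵖ (0≤^ d 0≤X) (^-mono-≤ d 0≤X X≤Yᵖ))) ⟩
      X ^ a * (δ * Y ^ p * (Y ^ p) ^ d) * Y ^ b′
        ≡⟨ lemma (X ^ a) δ (Y ^ p) ((Y ^ p) ^ d) (Y ^ b′) ⟩
      δ * (X ^ a * ((Y ^ p) ^ suc d * Y ^ b′))
        ≡⟨ cong (λ t → δ * (X ^ a * t)) (trans (cong (_* Y ^ b′) (^-assocʳ Y p (suc d)))
             (trans (sym (^-homo-* Y (p ℕ.* suc d) b′)) (cong (Y ^_) (sym b≡)))) ⟩
      δ * (X ^ a * Y ^ b) ∎
      where
      open ≤-Reasoning
      d = a′ ℕ.∸ suc a
      a′≡ : a ℕ.+ suc d ≡ a′
      a′≡ = trans (ℕ.+-suc a d) (ℕ.m+[n∸m]≡n a<a′)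
      b≡ : b ≡ p ℕ.* suc d ℕ.+ b′
      b≡ = ℕ.+-cancelˡ-≡ (p ℕ.* a) _ _ (trans eq (trans (cong (λ t → p ℕ.* t ℕ.+ b′) (sym a′≡))
        (trans (cong (ℕ._+ b′) (ℕ.*-distribˡ-+ p a (suc d))) (ℕ.+-assoc (p ℕ.* a) (p ℕ.* suc d) b′))))
      lemma : ∀ x d y z b → x * (d * y * z) * b ≡ d * (x * (y * z * b))
      lemma = solve-∀ solver-ring

  within-half : ∀ {X X′ σ} → two * σ ≤ X′ → ∣ X - X′ ∣ ≤ σ → 0ℚ ≤ σ →
    (σ ≤ X) × (½ * X′ ≤ X) × (X ≤ two * X′)
  within-half {X} {X′} {σ} 2σ≤ close 0≤σ =
      ≤-by (X - (X′ - σ) + (X′ - two * σ)) (0≤+ (p≤q⇒0≤q-p lower) (p≤q⇒0≤q-p 2σ≤)) (lemma₁ X X′ σ)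
    , ≤-by (X - (X′ - σ) + ½ * (X′ - two * σ)) (0≤+ (p≤q⇒0≤q-p lower) (0≤* 0≤½ (p≤q⇒0≤q-p 2σ≤))) (lemma₂ X X′ σ)
    , ≤-by (σ - (X - X′) + (X′ - two * σ + σ)) (0≤+ (p≤q⇒0≤q-p (∣p∣≤⇒≤ close)) (0≤+ (p≤q⇒0≤q-p 2σ≤) 0≤σ)) (lemma₃ X X′ σ)
    where
    lower : X′ - σ ≤ X
    lower = ≤-by (σ - - (X - X′)) (p≤q⇒0≤q-p (∣p∣≤⇒-≤ close)) (lemma X X′ σ)
      where
      lemma : ∀ a b s → a ≡ b - s + (s - - (a - b))
      lemma = solve-∀ solver-ring
    lemma₁ : ∀ a b s → a ≡ s + (a - (b - s) + (b - (1ℚ + 1ℚ) * s))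
    lemma₁ = solve-∀ solver-ring
    lemma₂ : ∀ a b s → a ≡ ½ * b + (a - (b - s) + ½ * (b - (1ℚ + 1ℚ) * s))
    lemma₂ = solve-∀ solver-ring
    lemma₃ : ∀ a b s → (1ℚ + 1ℚ) * b ≡ a + (s - (a - b) + (b - (1ℚ + 1ℚ) * s + s))
    lemma₃ = solve-∀ solver-ring

  module _ {p A : ℕ} {δ σ x h P Q X Y D C : ℚ} (1≤p : 1 ℕ.≤ p) (0≤δ : 0ℚ ≤ δ) (0≤σ : 0ℚ ≤ σ)
    (½≤x : ½ ≤ x) (x≤1 : x ≤ 1ℚ) (0≤h : 0ℚ ≤ h) (h≤1 : h ≤ 1ℚ) (0≤P : 0ℚ ≤ P) (0≤Q : 0ℚ ≤ Q)
    (lower : (h * Q) ^ p ≤ P) (upper : P ≤ D * Q ^ p) (small : Q ≤ C * h ^ suc (p ℕ.* A))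
    (2σ≤xP : two * σ ≤ x * P) (2σ≤xᵖQ : two * σ ≤ x ^ p * Q)
    (X-close : ∣ X - x * P ∣ ≤ σ) (Y-close : ∣ Y - x ^ p * Q ∣ ≤ σ)
    (D≤ : two * D ≤ δ * (½ ^ suc p) ^ p) (C≤ : two * C * h ≤ δ * ⅛ ^ (p ℕ.* A)) where

    private
      0≤x : 0ℚ ≤ x
      0≤x = ≤-trans 0≤½ ½≤x
      X-within = within-half {X} 2σ≤xP X-close 0≤σ
      Y-within = within-half {Y} 2σ≤xᵖQ Y-close 0≤σ
      σ≤X = proj₁ X-within
      σ≤Y = proj₁ Y-within
      X≤2P : X ≤ two * P
      X≤2P = ≤-trans (proj₂ (proj₂ X-within)) (*-monoˡ-≤ 0≤two (p*q≤q 0≤P x≤1))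
      Y≤2Q : Y ≤ two * Q
      Y≤2Q = ≤-trans (proj₂ (proj₂ Y-within)) (*-monoˡ-≤ 0≤two (p*q≤q 0≤Q (^≤1 p 0≤x x≤1)))
      P≤4X : (½ * ½) * P ≤ X
      P≤4X = ≤-trans (≤-respˡ (sym (*-assoc ½ ½ P)) (*-monoˡ-≤ 0≤½ (*-monoʳ-≤ 0≤P ½≤x))) (proj₁ (proj₂ X-within))
      Q≤Y : ½ ^ suc p * Q ≤ Y
      Q≤Y = ≤-trans (≤-respˡ (sym (*-assoc ½ (½ ^ p) Q))
        (*-monoˡ-≤ 0≤½ (*-monoʳ-≤ 0≤Q (^-mono-≤ p 0≤½ ½≤x)))) (proj₁ (proj₂ Y-within))
      0≤Y : 0ℚ ≤ Y
      0≤Y = ≤-trans 0≤σ σ≤Y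

    -- As ½ ≤ x ≤ 1 and the errors are at most half of the main terms, passing from P and Q to X and
    -- Y loses only constants: P/4 ≤ X ≤ 2P and Q/2ᵖ⁺¹ ≤ Y ≤ 2Q. The bounds on `D` and `C` leave
    -- room for them.
    magnitudes : Magnitudes p A δ σ X Y
    magnitudes = record
      -- With Y ≤ 2Q the factor ⅛ gives ⅛hY ≤ ¼hQ, and ¼ᵖ ≤ ¼ supplies the ¼ of P/4 ≤ X.
      { h = ⅛ * h
      ; 0≤h = 0≤* 0≤⅛ 0≤h
      ; h≤1 = ≤-trans (p*q≤p 0≤⅛ h≤1) ⅛≤1
      ; ρ≤X = σ≤X
      ; ρ≤Y = σ≤Y
      ; X≤δYᵖ = begin
          X                                ≤⟨ X≤2P ⟩
          two * P                          ≤⟨ *-monoˡ-≤ 0≤two upper ⟩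
          two * (D * Q ^ p)                ≡⟨ sym (*-assoc two D (Q ^ p)) ⟩
          two * D * Q ^ p                  ≤⟨ *-monoʳ-≤ (0≤^ p 0≤Q) D≤ ⟩
          δ * (½ ^ suc p) ^ p * Q ^ p      ≡⟨ trans (*-assoc δ _ (Q ^ p)) (cong (δ *_) (sym (^-distrib-* (½ ^ suc p) Q p))) ⟩
          δ * (½ ^ suc p * Q) ^ p          ≤⟨ *-monoˡ-≤ 0≤δ (^-mono-≤ p (0≤* (0≤^ (suc p) 0≤½) 0≤Q) Q≤Y) ⟩
          δ * Y ^ p ∎
      ; hYᵖ≤X = begin
          (⅛ * h * Y) ^ p          ≤⟨ ^-mono-≤ p (0≤* (0≤* 0≤⅛ 0≤h) 0≤Y) (*-monoˡ-≤ (0≤* 0≤⅛ 0≤h) Y≤2Q) ⟩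
          (⅛ * h * (two * Q)) ^ p  ≡⟨ cong (_^ p) (lemma h Q) ⟩
          (½ * ½ * (h * Q)) ^ p    ≡⟨ ^-distrib-* (½ * ½) (h * Q) p ⟩
          (½ * ½) ^ p * (h * Q) ^ p
            ≤⟨ *-mono-≤ (0≤^ p (0≤* 0≤½ 0≤½)) (≤-respʳ (*-identityʳ (½ * ½)) (^-antimono-≤ (0≤* 0≤½ 0≤½) ¼≤1 1≤p))
                 (0≤^ p (0≤* 0≤h 0≤Q)) lower ⟩
          ½ * ½ * P                ≤⟨ P≤4X ⟩
          X ∎
      ; Y≤δhᵖᴬ = begin
          Y                                    ≤⟨ Y≤2Q ⟩
          two * Q                              ≤⟨ *-monoˡ-≤ 0≤two small ⟩
          two * (C * (h * h ^ (p ℕ.* A)))      ≡⟨ lemma₂ two C h (h ^ (p ℕ.* A)) ⟩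
          two * C * h * h ^ (p ℕ.* A)          ≤⟨ *-monoʳ-≤ (0≤^ (p ℕ.* A) 0≤h) C≤ ⟩
          δ * ⅛ ^ (p ℕ.* A) * h ^ (p ℕ.* A)    ≡⟨ trans (*-assoc δ _ _) (cong (δ *_) (sym (^-distrib-* ⅛ h (p ℕ.* A)))) ⟩
          δ * (⅛ * h) ^ (p ℕ.* A) ∎
      }
      where
      open ≤-Reasoning
      lemma : ∀ h q → ½ * (½ * ½) * h * ((1ℚ + 1ℚ) * q) ≡ ½ * ½ * (h * q)
      lemma = solve-∀ solver-ring
      lemma₂ : ∀ t c h g → t * (c * (h * g)) ≡ t * c * h * g
      lemma₂ = solve-∀ solver-ring

  module _ {p A : ℕ} .{{_ : ℕ.NonZero p}} {δ : ℚ} (1<p : 1 ℕ.< p) (0<δ : 0ℚ < δ) (δ≤1 : δ ≤ 1ℚ) where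

    private
      d : ℕ → ℚ
      d k = 1ℚ - ½ * recip (suc k ℕ.* p) {{ℕ.m*n≢0 (suc k) p}}
      -- One factor h more than the required hᵖᴬ: it absorbs the constant `C` once h is small.
      M : ℕ
      M = suc (p ℕ.* A)
      C : ℚ
      C = ∏ M (λ k → ι (p ℕ.* suc k))
      0≤C : 0ℚ ≤ C
      0≤C = ∏-nonneg M (λ k → 0≤ι (p ℕ.* suc k))
      ε : ℚ
      ε = δ * ⅛ ^ (p ℕ.* A)
      0≤ε : 0ℚ ≤ ε
      0≤ε = 0≤* (<⇒≤ 0<δ) (0≤^ (p ℕ.* A) 0≤⅛)
      ε≤1 : ε ≤ 1ℚ
      ε≤1 = ≤-trans (p*q≤p (<⇒≤ 0<δ) (^≤1 (p ℕ.* A) 0≤⅛ ⅛≤1)) δ≤1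

      harmonic : ∃[ n ] ∏ n d ≤ ½ * (δ * (½ ^ suc p) ^ p)
      harmonic = ∏[1-1/2k]-small p (0<½* (0<* 0<δ (0<^ p (0<^ (suc p) 0<½))))
      n : ℕ
      n = proj₁ harmonic
      -- The inverse `r` of `s` serves two ends: h ≤ rε yields both 2Ch ≤ ε and nph ≤ ½.
      s : ℚ
      s = 1ℚ + two * (C + ι (n ℕ.* p))
      0<s : 0ℚ < s
      0<s = +-mono-<-≤ (positive⁻¹ 1ℚ) (0≤* 0≤two (0≤+ 0≤C (0≤ι (n ℕ.* p))))
      1/s = inverse 0<s
      r : ℚ
      r = proj₁ 1/s
      0≤r : 0ℚ ≤ r
      0≤r = <⇒≤ (proj₁ (proj₂ 1/s))

      2D≤ : two * ∏ n d ≤ δ * (½ ^ suc p) ^ p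
      2D≤ = ≤-respʳ (lemma (δ * (½ ^ suc p) ^ p)) (*-monoˡ-≤ 0≤two (proj₂ harmonic))
        where
        lemma : ∀ a → (1ℚ + 1ℚ) * (½ * a) ≡ a
        lemma = solve-∀ solver-ring

      2C≤ : ∀ {h} → h ≤ r * ε → two * C * h ≤ ε
      2C≤ {h} h≤ = ≤-trans (*-monoˡ-≤ (0≤* 0≤two 0≤C) h≤)
        (≤-by (ε * r * (1ℚ + two * ι (n ℕ.* p)))
          (0≤* (0≤* 0≤ε 0≤r) (0≤+ 0≤1 (0≤* 0≤two (0≤ι (n ℕ.* p)))))
          (trans (sym (*-identityʳ ε)) (trans (cong (ε *_) (sym (proj₂ (proj₂ 1/s)))) (lemma C (ι (n ℕ.* p)) r ε))))
        where
        lemma : ∀ c i r e → e * ((1ℚ + (1ℚ + 1ℚ) * (c + i)) * r) ≡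
          (1ℚ + 1ℚ) * c * (r * e) + e * r * (1ℚ + (1ℚ + 1ℚ) * i)
        lemma = solve-∀ solver-ring

      ιnp≤½ : ∀ {h} → h ≤ r * ε → ι (n ℕ.* p) * h ≤ ½
      ιnp≤½ {h} h≤ = ≤-trans (*-monoˡ-≤ (0≤ι (n ℕ.* p)) (≤-trans h≤ (p*q≤p 0≤r ε≤1)))
        (≤-by (½ * r * (1ℚ + two * C)) (0≤* (0≤* 0≤½ 0≤r) (0≤+ 0≤1 (0≤* 0≤two 0≤C)))
          (trans (cong (½ *_) (sym (proj₂ (proj₂ 1/s)))) (lemma C (ι (n ℕ.* p)) r)))
        where
        lemma : ∀ c i r → ½ * ((1ℚ + (1ℚ + 1ℚ) * (c + i)) * r) ≡ i * r + ½ * r * (1ℚ + (1ℚ + 1ℚ) * c)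
        lemma = solve-∀ solver-ring

    abstract
      -- The order of choices matters. The threshold `η` for h and the length `K₀` are fixed first,
      -- and t will be chosen by them. Only then is a floor `g` under h available, and it determines
      -- the precision `σ` demanded of X and Y.
      eta-magnitudes : ∃[ η ] ∃[ K₀ ] (0ℚ < η × (∀ {g} → 0ℚ < g → g ≤ 1ℚ → ∃[ σ ] (0ℚ < σ ×
        (∀ m {K x X Y} → K₀ ℕ.≤ K → ½ ≤ x → x ≤ 1ℚ → g ≤ 1ℚ - x ^ m → 1ℚ - x ^ m ≤ η →
          ∣ X - x * euler (K ℕ.* p) (x ^ m) ∣ ≤ σ → ∣ Y - x ^ p * euler K ((x ^ m) ^ p) ∣ ≤ σ →
          Magnitudes p A δ σ X Y))))
      eta-magnitudes = r * ε , suc (n ℕ.+ M) ,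
        0<* (proj₁ (proj₂ 1/s)) (0<* 0<δ (0<^ (p ℕ.* A) (0<* 0<½ (0<* 0<½ 0<½)))) , bounds
        where
        bounds : ∀ {g} → 0ℚ < g → g ≤ 1ℚ → ∃[ σ ] (0ℚ < σ ×
          (∀ m {K x X Y} → suc (n ℕ.+ M) ℕ.≤ K → ½ ≤ x → x ≤ 1ℚ → g ≤ 1ℚ - x ^ m → 1ℚ - x ^ m ≤ r * ε →
            ∣ X - x * euler (K ℕ.* p) (x ^ m) ∣ ≤ σ → ∣ Y - x ^ p * euler K ((x ^ m) ^ p) ∣ ≤ σ →
            Magnitudes p A δ σ X Y))
        bounds {g} 0<g g≤1 = σ , 0<½* (0<* 0<α 0<β) , result
          where
          1-g<1 : 1ℚ - g < 1ℚ
          1-g<1 = +-monoʳ-< 1ℚ (neg-antimono-< 0<g)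
          lower-bound : ∃[ ρ ] (0ℚ < ρ × (∀ K {w} → 0ℚ ≤ w → w ≤ 1ℚ - g → ρ ≤ euler K w))
          lower-bound = euler-lower (p≤q⇒0≤q-p g≤1) 1-g<1
          -- `α` and `β` lie below the main terms of X and Y. Both are at most 1, so half of their
          -- product is at most half of each.
          ρ α β σ : ℚ
          ρ = proj₁ lower-bound
          0<ρ : 0ℚ < ρ
          0<ρ = proj₁ (proj₂ lower-bound)
          ρ≤1 : ρ ≤ 1ℚ
          ρ≤1 = proj₂ (proj₂ lower-bound) 0 {0ℚ} ≤-refl (p≤q⇒0≤q-p g≤1)
          α = ½ * (g * ρ) ^ p
          β = ½ ^ p * ρ
          σ = ½ * (α * β)
          0<gρ : 0ℚ < g * ρ
          0<gρ = 0<* 0<g 0<ρ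
          0<α : 0ℚ < α
          0<α = 0<½* (0<^ p 0<gρ)
          0<β : 0ℚ < β
          0<β = 0<* (0<^ p 0<½) 0<ρ
          α≤1 : α ≤ 1ℚ
          α≤1 = ≤-trans (p*q≤p 0≤½ (^≤1 p (<⇒≤ 0<gρ) (≤-trans (p*q≤p (<⇒≤ 0<g) ρ≤1) g≤1))) ½≤1
          β≤1 : β ≤ 1ℚ
          β≤1 = ≤-trans (p*q≤p (0≤^ p 0≤½) ρ≤1) (^≤1 p 0≤½ ½≤1)
          lemma : ∀ a b → (1ℚ + 1ℚ) * (½ * (a * b)) ≡ a * b
          lemma = solve-∀ solver-ring
          2σ≤α : two * σ ≤ α
          2σ≤α = ≤-respˡ (sym (lemma α β)) (p*q≤p (<⇒≤ 0<α) β≤1)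
          2σ≤β : two * σ ≤ β
          2σ≤β = ≤-respˡ (sym (lemma α β)) (p*q≤q (<⇒≤ 0<β) α≤1)

          result : ∀ m {K x X Y} → suc (n ℕ.+ M) ℕ.≤ K → ½ ≤ x → x ≤ 1ℚ → g ≤ 1ℚ - x ^ m → 1ℚ - x ^ m ≤ r * ε →
            ∣ X - x * euler (K ℕ.* p) (x ^ m) ∣ ≤ σ → ∣ Y - x ^ p * euler K ((x ^ m) ^ p) ∣ ≤ σ →
            Magnitudes p A δ σ X Y
          result m {suc K} {x} {X} {Y} (s≤s n+M≤K) ½≤x x≤1 g≤h h≤ X-close Y-close = finish (x ^ m) refl g≤h h≤ X-close Y-close
            where
            0≤x : 0ℚ ≤ x
            0≤x = ≤-trans 0≤½ ½≤x
            finish : ∀ y → y ≡ x ^ m → g ≤ 1ℚ - y → 1ℚ - y ≤ r * ε →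
              ∣ X - x * euler (suc K ℕ.* p) y ∣ ≤ σ → ∣ Y - x ^ p * euler (suc K) (y ^ p) ∣ ≤ σ →
              Magnitudes p A δ σ X Y
            finish y y≡ g≤h h≤ X-close Y-close = magnitudes {D = ∏ n d} {C = C} (ℕ.<⇒≤ 1<p) (<⇒≤ 0<δ) (<⇒≤ (0<½* (0<* 0<α 0<β)))
              ½≤x x≤1 0≤h h≤1 (0≤euler 0≤y y≤1 (suc K ℕ.* p)) 0≤Q lower
              (euler≤D*euler^p 0≤y y≤1 p 1<p (ℕ.≤-trans (ℕ.m≤m+n n M) (ℕ.≤-trans n+M≤K (ℕ.n≤1+n K))) (ιnp≤½ h≤))
              (euler≤C*[1-y]^ 0≤y y≤1 p (ℕ.≤-trans (ℕ.m≤n+m M n) (ℕ.≤-trans n+M≤K (ℕ.n≤1+n K))))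
              (≤-trans 2σ≤α (*-mono-≤ 0≤½ ½≤x (0≤^ p (<⇒≤ 0<gρ)) (≤-trans
                (^-mono-≤ p (<⇒≤ 0<gρ) (*-mono-≤ (<⇒≤ 0<g) g≤h (<⇒≤ 0<ρ) ρ≤Q)) lower)))
              (≤-trans 2σ≤β (*-mono-≤ (0≤^ p 0≤½) (^-mono-≤ p 0≤½ ½≤x) (<⇒≤ 0<ρ) ρ≤Q))
              X-close Y-close 2D≤ (2C≤ h≤)
              where
              0≤y : 0ℚ ≤ y
              0≤y = ≤-respʳ (sym y≡) (0≤^ m 0≤x)
              y≤1 : y ≤ 1ℚ
              y≤1 = ≤-respˡ (sym y≡) (^≤1 m 0≤x x≤1)
              0≤yᵖ : 0ℚ ≤ y ^ p
              0≤yᵖ = 0≤^ p 0≤y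
              yᵖ≤1 : y ^ p ≤ 1ℚ
              yᵖ≤1 = ^≤1 p 0≤y y≤1
              y≤1-g : y ≤ 1ℚ - g
              y≤1-g = ≤-by (1ℚ - y - g) (p≤q⇒0≤q-p g≤h) (lemma′ y g)
                where
                lemma′ : ∀ y g → 1ℚ - g ≡ y + (1ℚ - y - g)
                lemma′ = solve-∀ solver-ring
              yᵖ≤1-g : y ^ p ≤ 1ℚ - g
              yᵖ≤1-g = ≤-trans (≤-respʳ (*-identityʳ y) (^-antimono-≤ 0≤y y≤1 (ℕ.<⇒≤ 1<p))) y≤1-g
              0≤h : 0ℚ ≤ 1ℚ - y
              0≤h = p≤q⇒0≤q-p y≤1
              h≤1 : 1ℚ - y ≤ 1ℚ
              h≤1 = ≤-respˡ (cong (λ t → 1ℚ - t) (*-identityʳ y)) (1-^≤1 0≤y y≤1 1)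
              Q : ℚ
              Q = euler (suc K) (y ^ p)
              0≤Q : 0ℚ ≤ Q
              0≤Q = 0≤euler 0≤yᵖ yᵖ≤1 (suc K)
              ρ≤Q : ρ ≤ Q
              ρ≤Q = proj₂ (proj₂ lower-bound) (suc K) 0≤yᵖ yᵖ≤1-g
              -- The block estimate has `K` factors where `Q` has `suc K`; the additional factor is
              -- at most 1.
              lower : ((1ℚ - y) * Q) ^ p ≤ euler (suc K ℕ.* p) y
              lower = ≤-trans (^-mono-≤ p (0≤* 0≤h 0≤Q) (*-monoˡ-≤ 0≤h (euler-antimono 0≤yᵖ yᵖ≤1 (ℕ.n≤1+n K))))
                ([1-y]*euler^p≤ 0≤y y≤1 p K)

  -- Powers, inverses and sums in a commutative ring

  module Powers {c ℓ} (R : CommutativeRing c ℓ) where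
    private
      module R = CommutativeRing R
    open R using (_≈_; 1#; 0#; Carrier) renaming (_*_ to _∙_)
    open import Algebra.Properties.Semiring.Exp R.semiring
      using () renaming (_^_ to _↑_; ^-homo-* to ↑-homo; ^-cong to ↑-cong)
    open import Algebra.Properties.Semiring.Sum R.semiring using (*-distribʳ-sum; sum-cong-≋)
    open import Algebra.Definitions.RawSemiring (Semiring.rawSemiring R.semiring) using () renaming (sum to Σ)
    open import Algebra.Properties.CommutativeSemigroup R.*-commutativeSemigroup using (x∙yz≈xz∙y; interchange)
    open import Relation.Binary.Reasoning.Setoid R.setoid

    inverse-unique : ∀ {u u′ w} → u ∙ w ≈ 1# → u′ ∙ w ≈ 1# → u ≈ u′
    inverse-unique {u} {u′} {w} uw u′w = begin
      u               ≈⟨ R.sym (R.*-identityʳ u) ⟩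
      u ∙ 1#          ≈⟨ R.*-congˡ (R.sym u′w) ⟩
      u ∙ (u′ ∙ w)    ≈⟨ x∙yz≈xz∙y u u′ w ⟩
      (u ∙ w) ∙ u′    ≈⟨ R.*-congʳ uw ⟩
      1# ∙ u′         ≈⟨ R.*-identityˡ u′ ⟩
      u′ ∎

    nonneg-shift : ∀ {u w} n m → u ≈ w ↑ n → u ∙ w ↑ m ≈ w ↑ (n ℕ.+ m)
    nonneg-shift {u} {w} n m u≈ = R.trans (R.*-congʳ u≈) (R.sym (↑-homo w n m))

    -- Here `u` is the power of `w` with exponent -n; a sufficiently high power of `w` clears it
    -- without any division.
    neg-shift : ∀ {u w} n m → n ℕ.≤ m → u ∙ w ↑ n ≈ 1# → u ∙ w ↑ m ≈ w ↑ (m ℕ.∸ n)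
    neg-shift {u} {w} n m n≤m uw = begin
      u ∙ w ↑ m                      ≈⟨ R.*-congˡ (↑-cong (R.refl {w}) (sym (ℕ.m+[n∸m]≡n n≤m))) ⟩
      u ∙ w ↑ (n ℕ.+ (m ℕ.∸ n))      ≈⟨ R.*-congˡ (↑-homo w n (m ℕ.∸ n)) ⟩
      u ∙ (w ↑ n ∙ w ↑ (m ℕ.∸ n))    ≈⟨ R.sym (R.*-assoc u (w ↑ n) (w ↑ (m ℕ.∸ n))) ⟩
      (u ∙ w ↑ n) ∙ w ↑ (m ℕ.∸ n)    ≈⟨ R.*-congʳ uw ⟩
      1# ∙ w ↑ (m ℕ.∸ n)             ≈⟨ R.*-identityˡ _ ⟩
      w ↑ (m ℕ.∸ n) ∎

    scale-term : ∀ {c f u v s t x y} → f ≈ u ∙ v → u ∙ s ≈ x → v ∙ t ≈ y → (c ∙ f) ∙ (s ∙ t) ≈ c ∙ (x ∙ y)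
    scale-term {c} {f} {u} {v} {s} {t} {x} {y} f≈ us vt = begin
      (c ∙ f) ∙ (s ∙ t)          ≈⟨ R.*-assoc c f (s ∙ t) ⟩
      c ∙ (f ∙ (s ∙ t))          ≈⟨ R.*-congˡ (R.*-congʳ f≈) ⟩
      c ∙ ((u ∙ v) ∙ (s ∙ t))    ≈⟨ R.*-congˡ (interchange u v s t) ⟩
      c ∙ ((u ∙ s) ∙ (v ∙ t))    ≈⟨ R.*-congˡ (R.*-cong us vt) ⟩
      c ∙ (x ∙ y) ∎

    scale-sum : ∀ {n} (f g : Fin n → Carrier) w → (∀ j → f j ∙ w ≈ g j) → Σ f ≈ 0# → Σ g ≈ 0#
    scale-sum f g w fw≈g Σf≈0 = begin
      Σ g                       ≈⟨ R.sym (sum-cong-≋ fw≈g) ⟩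
      Σ (λ j → f j ∙ w)         ≈⟨ R.sym (*-distribʳ-sum w f) ⟩
      Σ f ∙ w                   ≈⟨ R.*-congʳ Σf≈0 ⟩
      0# ∙ w                    ≈⟨ R.zeroˡ w ⟩
      0# ∎

  open import Defs hiding (_+_; _*_; -_; _-_; _^_; sum; product)
  import Defs as ℂ

  -- Sequences of rationals

  eventually-map : ∀ {P Q : ℕ → Set} → (∀ n → P n → Q n) → Eventually P → Eventually Q
  eventually-map f (N , h) = N , λ n N≤n → f n (h n N≤n)

  eventually-zip : ∀ {P Q R : ℕ → Set} → (∀ n → P n → Q n → R n) → Eventually P → Eventually Q → Eventually R
  eventually-zip f (M , h) (N , k) = M ℕ.⊔ N , λ n le →
    f n (h n (ℕ.≤-trans (ℕ.m≤m⊔n M N) le)) (k n (ℕ.≤-trans (ℕ.m≤n⊔m M N) le))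

  eventually-witness : ∀ {P : ℕ → Set} → Eventually P → ∃[ n ] P n
  eventually-witness (N , h) = N , h N ℕ.≤-refl

  eventually-Fin : ∀ {k} {P : Fin k → ℕ → Set} → (∀ j → Eventually (P j)) → Eventually (λ n → ∀ j → P j n)
  eventually-Fin {zero}  h = 0 , λ _ _ ()
  eventually-Fin {suc k} h = eventually-zip (λ n h₀ hₛ → λ { zero → h₀ ; (suc j) → hₛ j })
    (h zero) (eventually-Fin (h ∘ suc))

  infix 4 _≃ₛ_
  -- `_≈ℝ_` on bare sequences, without the Cauchy proofs; it also applies to sequences that are not
  -- packaged as reals.
  _≃ₛ_ : (ℕ → ℚ) → (ℕ → ℚ) → Set
  f ≃ₛ g = ∀ ε → 0ℚ < ε → Eventually λ n → ∣ f n - g n ∣ < ε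

  ≡⇒∣-∣<ε : ∀ {p q ε} → p ≡ q → 0ℚ < ε → ∣ p - q ∣ < ε
  ≡⇒∣-∣<ε {p} {ε = ε} refl = subst (_< ε) (sym (cong ∣_∣ (+-inverseʳ p)))

  ≡⇒≃ₛ : ∀ {f g : ℕ → ℚ} → (∀ n → f n ≡ g n) → f ≃ₛ g
  ≡⇒≃ₛ e ε 0<ε = 0 , λ n _ → ≡⇒∣-∣<ε (e n) 0<ε

  abstract
    small-multiple : ∀ {C ε} → 0ℚ ≤ C → 0ℚ < ε → ∃[ μ ] (0ℚ < μ × C * μ ≤ ε)
    small-multiple {C} {ε} 0≤C 0<ε =
      let r , 0<r , e = inverse {1ℚ + C} (+-mono-<-≤ (positive⁻¹ 1ℚ) 0≤C)
      in r * ε , 0<* 0<r 0<ε , ≤-by (r * ε) (<⇒≤ (0<* 0<r 0<ε))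
           (trans (sym (*-identityˡ ε)) (trans (cong (_* ε) (sym e)) (lemma C r ε)))
      where
      lemma : ∀ c r e → (1ℚ + c) * r * e ≡ c * (r * e) + r * e
      lemma = solve-∀ solver-ring

    min-pos : ∀ {p q} → 0ℚ < p → 0ℚ < q → ∃[ μ ] (0ℚ < μ × μ ≤ p × μ ≤ q)
    min-pos {p} {q} 0<p 0<q with ≤-total p q
    ... | inj₁ p≤q = p , 0<p , ≤-refl , p≤q
    ... | inj₂ q≤p = q , 0<q , q≤p , ≤-refl

  ½*p<p : ∀ {p} → 0ℚ < p → ½ * p < p
  ½*p<p {p} 0<p = subst₂ _<_ (+-identityʳ (½ * p)) (½*p+½*p≡p p) (+-monoʳ-< (½ * p) (0<½* 0<p))

  cauchy⇒bounded : ∀ {f} → IsCauchy f → ∃[ B ] (0ℚ < B × Eventually λ n → ∣ f n ∣ ≤ B)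
  cauchy⇒bounded {f} cau with cau 1ℚ (positive⁻¹ 1ℚ)
  ... | N , close = 1ℚ + ∣ f N ∣ , +-mono-<-≤ (positive⁻¹ 1ℚ) (0≤∣p∣ (f N)) , N , λ n N≤n →
    ≤-trans (≤-respˡ (cong ∣_∣ (lemma (f n) (f N))) (∣p+q∣≤∣p∣+∣q∣ (f n - f N) (f N)))
      (+-monoˡ-≤ ∣ f N ∣ (<⇒≤ (close n N N≤n ℕ.≤-refl)))
    where
    lemma : ∀ a b → a - b + b ≡ a
    lemma = solve-∀ solver-ring

  +-cong-≃ₛ : ∀ {f g f′ g′ : ℕ → ℚ} → f ≃ₛ f′ → g ≃ₛ g′ → (λ n → f n + g n) ≃ₛ (λ n → f′ n + g′ n)
  +-cong-≃ₛ {f} {g} {f′} {g′} p q ε 0<ε = eventually-zip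
    (λ n a b → subst (∣ f n + g n - (f′ n + g′ n) ∣ <_) (½*p+½*p≡p ε)
      (≤-<-trans (≤-respˡ (cong ∣_∣ (lemma (f n) (g n) (f′ n) (g′ n))) (∣p+q∣≤∣p∣+∣q∣ (f n - f′ n) (g n - g′ n)))
        (+-mono-< a b)))
    (p (½ * ε) (0<½* 0<ε)) (q (½ * ε) (0<½* 0<ε))
    where
    lemma : ∀ a b c d → a - c + (b - d) ≡ a + b - (c + d)
    lemma = solve-∀ solver-ring

  neg-cong-≃ₛ : ∀ {f g : ℕ → ℚ} → f ≃ₛ g → (λ n → - f n) ≃ₛ (λ n → - g n)
  neg-cong-≃ₛ {f} {g} p ε 0<ε = eventually-map (λ n → subst (_< ε)
    (trans (∣p-q∣≡∣q-p∣ (f n) (g n)) (cong ∣_∣ (lemma (f n) (g n))))) (p ε 0<ε)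
    where
    lemma : ∀ a b → b - a ≡ - a - - b
    lemma = solve-∀ solver-ring

  ∣product-diff∣≤ : ∀ {a b c d B C μ} → ∣ a ∣ ≤ B → ∣ d ∣ ≤ C → ∣ a - c ∣ ≤ μ → ∣ b - d ∣ ≤ μ →
    ∣ a * b - c * d ∣ ≤ (B + C) * μ
  ∣product-diff∣≤ {a} {b} {c} {d} {B} {C} {μ} a≤ d≤ ac bd = begin
    ∣ a * b - c * d ∣                       ≡⟨ cong ∣_∣ (lemma a b c d) ⟩
    ∣ a * (b - d) + d * (a - c) ∣           ≤⟨ ∣p+q∣≤∣p∣+∣q∣ (a * (b - d)) (d * (a - c)) ⟩
    ∣ a * (b - d) ∣ + ∣ d * (a - c) ∣       ≡⟨ cong₂ _+_ (∣p*q∣≡∣p∣*∣q∣ a (b - d)) (∣p*q∣≡∣p∣*∣q∣ d (a - c)) ⟩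
    ∣ a ∣ * ∣ b - d ∣ + ∣ d ∣ * ∣ a - c ∣
      ≤⟨ +-mono-≤ (*-mono-≤ (0≤∣p∣ a) a≤ (0≤∣p∣ (b - d)) bd) (*-mono-≤ (0≤∣p∣ d) d≤ (0≤∣p∣ (a - c)) ac) ⟩
    B * μ + C * μ                           ≡⟨ sym (*-distribʳ-+ μ B C) ⟩
    (B + C) * μ ∎
    where
    open ≤-Reasoning
    lemma : ∀ a b c d → a * b - c * d ≡ a * (b - d) + d * (a - c)
    lemma = solve-∀ solver-ring

  *-cong-≃ₛ : ∀ {f g f′ g′ : ℕ → ℚ} → IsCauchy f → IsCauchy g′ → f ≃ₛ f′ → g ≃ₛ g′ →
    (λ n → f n * g n) ≃ₛ (λ n → f′ n * g′ n)
  *-cong-≃ₛ {f} {g} {f′} {g′} cf cg′ p q ε 0<ε =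
    let B , 0<B , f≤B = cauchy⇒bounded cf
        C , 0<C , g′≤C = cauchy⇒bounded cg′
        μ , 0<μ , small = small-multiple (0≤+ (<⇒≤ 0<B) (<⇒≤ 0<C)) (0<½* 0<ε)
    in eventually-zip
        (λ n (a≤ , d≤) (ac , bd) → ≤-<-trans
          (∣product-diff∣≤ {f n} {g n} {f′ n} {g′ n} a≤ d≤ (<⇒≤ ac) (<⇒≤ bd)) (≤-<-trans small (½*p<p 0<ε)))
        (eventually-zip (λ _ → _,_) f≤B g′≤C)
        (eventually-zip (λ _ → _,_) (p μ 0<μ) (q μ 0<μ))

  -- One late term is compared with ½ε, which is decidable in ℚ. If it is smaller, all later terms
  -- are below ε; otherwise they all stay above ¼ε, which is excluded. No excluded middle for reals
  -- is involved.
  cauchy-≃ₛ0 : ∀ {f} → IsCauchy f → (∀ κ → 0ℚ < κ → ¬ Eventually (λ n → κ ≤ ∣ f n ∣)) → f ≃ₛ (λ _ → 0ℚ)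
  cauchy-≃ₛ0 {f} cau away ε 0<ε with cau (½ * (½ * ε)) (0<½* (0<½* 0<ε))
  ... | N , close with ∣ f N ∣ <? ½ * ε
  ...   | yes fN< = N , λ n N≤n → subst₂ _<_ (cong ∣_∣ (lemma (f n) (f N))) (½*p+½*p≡p ε)
            (≤-<-trans (∣p+q∣≤∣p∣+∣q∣ (f n - f N) (f N))
              (+-mono-< (<-trans (close n N N≤n ℕ.≤-refl) (½*p<p (0<½* 0<ε))) fN<))
    where
    lemma : ∀ a b → a - b + b ≡ a - 0ℚ
    lemma = solve-∀ solver-ring
  ...   | no  fN≮ = contradiction (N , far) (away (½ * (½ * ε)) (0<½* (0<½* 0<ε)))
    where
    lemma : ∀ a b → b + (a - b) ≡ a
    lemma = solve-∀ solver-ring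
    lemma₂ : ∀ a b → a ≡ b + (a + b - (b + b))
    lemma₂ = solve-∀ solver-ring
    far : ∀ n → N ℕ.≤ n → ½ * (½ * ε) ≤ ∣ f n ∣
    far n N≤n = ≤-by _ (p≤q⇒0≤q-p (≤-trans (≤-reflexive (½*p+½*p≡p (½ * ε)))
        (≤-trans (≮⇒≥ fN≮) (≤-trans (≤-respˡ (cong ∣_∣ (lemma (f N) (f n))) (∣p+q∣≤∣p∣+∣q∣ (f n) (f N - f n)))
          (+-monoʳ-≤ ∣ f n ∣ (<⇒≤ (close N n ℕ.≤-refl N≤n)))))))
      (lemma₂ ∣ f n ∣ (½ * (½ * ε)))

  -- A single late term above ½ε would keep all late terms above ¼ε and so make the sequence
  -- positive.
  cauchy-sign : ∀ {f ε} → IsCauchy f → 0ℚ < ε → ¬ (∃[ δ ] (0ℚ < δ × Eventually λ n → δ ≤ f n)) →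
    Eventually λ n → f n ≤ ½ * ε
  cauchy-sign {f} {ε} cau 0<ε f≯0 = bound (cau δ 0<δ)
    where
    δ = ½ * (½ * ε)
    0<δ : 0ℚ < δ
    0<δ = 0<½* (0<½* 0<ε)
    far : ∀ a b → ½ * ε < a → a - b ≤ δ → δ ≤ b
    far a b ½ε< a-b≤ = ≤-by (a - ½ * ε + (δ - (a - b))) (0≤+ (p≤q⇒0≤q-p (<⇒≤ ½ε<)) (p≤q⇒0≤q-p a-b≤)) (lemma′ ε a b)
      where
      lemma′ : ∀ e a b → b ≡ ½ * (½ * e) + (a - ½ * e + (½ * (½ * e) - (a - b)))
      lemma′ = solve-∀ solver-ring
    bound : ∃[ N ] (∀ m n → N ℕ.≤ m → N ℕ.≤ n → ∣ f m - f n ∣ < δ) → Eventually λ n → f n ≤ ½ * ε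
    bound (N , close) = N , λ n N≤n → ≮⇒≥ λ ½ε< → f≯0
      (δ , 0<δ , N , λ m N≤m → far (f n) (f m) ½ε< (∣p∣≤⇒≤ (<⇒≤ (close n m N≤n N≤m))))

  -- Tightness of the order. It makes π unique, as minimality only refutes strict inequalities.
  ≮∧≯⇒≈ℝ : ∀ {x y} → ¬ (x <ℝ y) → ¬ (y <ℝ x) → x ≈ℝ y
  ≮∧≯⇒≈ℝ {x} {y} x≮y y≮x ε 0<ε = eventually-zip
    (λ n u l → ≤-<-trans (≤⇒∣p∣≤ u (≤-respˡ (lemma (seq x n) (seq y n)) l)) (½*p<p 0<ε))
    (cauchy-sign {λ n → seq x n - seq y n} (cauchy (x -ℝ y)) 0<ε λ (δ , 0<δ , h) →
      y≮x (δ , 0<δ , eventually-map (λ n → shift (seq y n) (seq x n)) h))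
    (cauchy-sign {λ n → seq y n - seq x n} (cauchy (y -ℝ x)) 0<ε λ (δ , 0<δ , h) →
      x≮y (δ , 0<δ , eventually-map (λ n → shift (seq x n) (seq y n)) h))
    where
    lemma : ∀ a b → b - a ≡ - (a - b)
    lemma = solve-∀ solver-ring
    shift : ∀ a b {δ} → δ ≤ b - a → a + δ ≤ b
    shift a b {δ} δ≤ = ≤-by (b - a - δ) (p≤q⇒0≤q-p δ≤) (lemma′ a b δ)
      where
      lemma′ : ∀ a b d → b ≡ a + d + (b - a - d)
      lemma′ = solve-∀ solver-ring

  -- The field of complex numbers

  ≗⇒≈ : ∀ z w → (∀ n → seq (re z) n ≡ seq (re w) n) → (∀ n → seq (im z) n ≡ seq (im w) n) → z ≈ w
  ≗⇒≈ z w p q = ≡⇒≃ₛ p , ≡⇒≃ₛ q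

  +ℝ-cong : ∀ x x′ y y′ → x ≈ℝ x′ → y ≈ℝ y′ → x +ℝ y ≈ℝ x′ +ℝ y′
  +ℝ-cong x x′ y y′ = +-cong-≃ₛ {seq x} {seq y} {seq x′} {seq y′}

  -ℝ-cong : ∀ x y → x ≈ℝ y → -ℝ x ≈ℝ -ℝ y
  -ℝ-cong x y = neg-cong-≃ₛ {seq x} {seq y}

  *ℝ-cong : ∀ x x′ y y′ → x ≈ℝ x′ → y ≈ℝ y′ → x *ℝ y ≈ℝ x′ *ℝ y′
  *ℝ-cong x x′ y y′ = *-cong-≃ₛ {seq x} {seq y} {seq x′} {seq y′} (cauchy x) (cauchy y′)

  ℂ-+-cong : ∀ {z z′ w w′} → z ≈ z′ → w ≈ w′ → z ℂ.+ w ≈ z′ ℂ.+ w′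
  ℂ-+-cong {a +i b} {a′ +i b′} {c +i d} {c′ +i d′} (p , q) (r , s) = +ℝ-cong a a′ c c′ p r , +ℝ-cong b b′ d d′ q s

  ℂ-neg-cong : ∀ {z w} → z ≈ w → ℂ.- z ≈ ℂ.- w
  ℂ-neg-cong {a +i b} {c +i d} (p , q) = -ℝ-cong a c p , -ℝ-cong b d q

  ℂ-*-cong : ∀ {z z′ w w′} → z ≈ z′ → w ≈ w′ → z ℂ.* w ≈ z′ ℂ.* w′
  ℂ-*-cong {a +i b} {a′ +i b′} {c +i d} {c′ +i d′} (p , q) (r , s) =
      +ℝ-cong (a *ℝ c) (a′ *ℝ c′) (-ℝ (b *ℝ d)) (-ℝ (b′ *ℝ d′)) (*ℝ-cong a a′ c c′ p r)
        (-ℝ-cong (b *ℝ d) (b′ *ℝ d′) (*ℝ-cong b b′ d d′ q s))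
    , +ℝ-cong (a *ℝ d) (a′ *ℝ d′) (b *ℝ c) (b′ *ℝ c′) (*ℝ-cong a a′ d d′ p s) (*ℝ-cong b b′ c c′ q r)

  -- The ring identities hold index by index in ℚ; limits enter only through the congruences.
  ℂ-commutativeRing : CommutativeRing 0ℓ 0ℓ
  ℂ-commutativeRing = record
    { RawRing ℂ-rawRing
    ; isCommutativeRing = record
      { isRing = record
        { +-isAbelianGroup = record
          { isGroup = record
            { isMonoid = record
              { isSemigroup = record
                { isMagma = record
                  { isEquivalence = Setoid.isEquivalence ℂ-setoid
                  ; ∙-cong = λ {z} {z′} {w} {w′} → ℂ-+-cong {z} {z′} {w} {w′}
                  }
                ; assoc = λ z w v → ≗⇒≈ ((z ℂ.+ w) ℂ.+ v) (z ℂ.+ (w ℂ.+ v))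
                  (λ n → +-assoc (seq (re z) n) (seq (re w) n) (seq (re v) n))
                  (λ n → +-assoc (seq (im z) n) (seq (im w) n) (seq (im v) n))
                }
              ; identity = (λ z → ≗⇒≈ (0ℂ ℂ.+ z) z
                  (λ n → +-identityˡ (seq (re z) n))
                  (λ n → +-identityˡ (seq (im z) n)))
                         , (λ z → ≗⇒≈ (z ℂ.+ 0ℂ) z
                  (λ n → +-identityʳ (seq (re z) n))
                  (λ n → +-identityʳ (seq (im z) n)))
              }
            ; inverse = (λ z → ≗⇒≈ ((ℂ.- z) ℂ.+ z) 0ℂ
                  (λ n → +-inverseˡ (seq (re z) n))
                  (λ n → +-inverseˡ (seq (im z) n)))
                      , (λ z → ≗⇒≈ (z ℂ.+ (ℂ.- z)) 0ℂ
                  (λ n → +-inverseʳ (seq (re z) n))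
                  (λ n → +-inverseʳ (seq (im z) n)))
            ; ⁻¹-cong = λ {z} {w} → ℂ-neg-cong {z} {w}
            }
          ; comm = λ z w → ≗⇒≈ (z ℂ.+ w) (w ℂ.+ z)
                  (λ n → +-comm (seq (re z) n) (seq (re w) n))
                  (λ n → +-comm (seq (im z) n) (seq (im w) n))
          }
        ; *-cong = λ {z} {z′} {w} {w′} → ℂ-*-cong {z} {z′} {w} {w′}
        ; *-assoc = λ z w v → ≗⇒≈ ((z ℂ.* w) ℂ.* v) (z ℂ.* (w ℂ.* v))
                  (λ n → assoc-re (seq (re z) n) (seq (im z) n) (seq (re w) n) (seq (im w) n) (seq (re v) n) (seq (im v) n))
                  (λ n → assoc-im (seq (re z) n) (seq (im z) n) (seq (re w) n) (seq (im w) n) (seq (re v) n) (seq (im v) n))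
        ; *-identity = (λ z → ≗⇒≈ (1ℂ ℂ.* z) z
                  (λ n → idˡ-re (seq (re z) n) (seq (im z) n))
                  (λ n → idˡ-im (seq (re z) n) (seq (im z) n))) , (λ z → ≗⇒≈ (z ℂ.* 1ℂ) z
                  (λ n → idʳ-re (seq (re z) n) (seq (im z) n))
                  (λ n → idʳ-im (seq (re z) n) (seq (im z) n)))
        ; distrib = (λ z w v → ≗⇒≈ (z ℂ.* (w ℂ.+ v)) (z ℂ.* w ℂ.+ z ℂ.* v)
                  (λ n → distˡ-re (seq (re z) n) (seq (im z) n) (seq (re w) n) (seq (im w) n) (seq (re v) n) (seq (im v) n))
                  (λ n → distˡ-im (seq (re z) n) (seq (im z) n) (seq (re w) n) (seq (im w) n) (seq (re v) n) (seq (im v) n)))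
                  , (λ z w v → ≗⇒≈ ((w ℂ.+ v) ℂ.* z) (w ℂ.* z ℂ.+ v ℂ.* z)
                  (λ n → distʳ-re (seq (re z) n) (seq (im z) n) (seq (re w) n) (seq (im w) n) (seq (re v) n) (seq (im v) n))
                  (λ n → distʳ-im (seq (re z) n) (seq (im z) n) (seq (re w) n) (seq (im w) n) (seq (re v) n) (seq (im v) n)))
        }
      ; *-comm = λ z w → ≗⇒≈ (z ℂ.* w) (w ℂ.* z)
                  (λ n → comm-re (seq (re z) n) (seq (im z) n) (seq (re w) n) (seq (im w) n))
                  (λ n → comm-im (seq (re z) n) (seq (im z) n) (seq (re w) n) (seq (im w) n))
      }
    }
    where
    comm-re : ∀ a b c d → a * c - b * d ≡ c * a - d * b
    comm-re = solve-∀ solver-ring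
    comm-im : ∀ a b c d → a * d + b * c ≡ c * b + d * a
    comm-im = solve-∀ solver-ring
    idˡ-re : ∀ a b → 1ℚ * a - 0ℚ * b ≡ a
    idˡ-re = solve-∀ solver-ring
    idˡ-im : ∀ a b → 1ℚ * b + 0ℚ * a ≡ b
    idˡ-im = solve-∀ solver-ring
    idʳ-re : ∀ a b → a * 1ℚ - b * 0ℚ ≡ a
    idʳ-re = solve-∀ solver-ring
    idʳ-im : ∀ a b → a * 0ℚ + b * 1ℚ ≡ b
    idʳ-im = solve-∀ solver-ring
    assoc-re : ∀ a b c d e f →
      (a * c - b * d) * e - (a * d + b * c) * f ≡ a * (c * e - d * f) - b * (c * f + d * e)
    assoc-re = solve-∀ solver-ring
    assoc-im : ∀ a b c d e f →
      (a * c - b * d) * f + (a * d + b * c) * e ≡ a * (c * f + d * e) + b * (c * e - d * f)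
    assoc-im = solve-∀ solver-ring
    distˡ-re : ∀ a b c d e f → a * (c + e) - b * (d + f) ≡ a * c - b * d + (a * e - b * f)
    distˡ-re = solve-∀ solver-ring
    distˡ-im : ∀ a b c d e f → a * (d + f) + b * (c + e) ≡ a * d + b * c + (a * f + b * e)
    distˡ-im = solve-∀ solver-ring
    distʳ-re : ∀ a b c d e f → (c + e) * a - (d + f) * b ≡ c * a - d * b + (e * a - f * b)
    distʳ-re = solve-∀ solver-ring
    distʳ-im : ∀ a b c d e f → (c + e) * b + (d + f) * a ≡ c * b + d * a + (e * b + f * a)
    distʳ-im = solve-∀ solver-ring

  module ℂR = CommutativeRing ℂ-commutativeRing

  ≈-refl : ∀ z → z ≈ z
  ≈-refl z = ℂR.refl {z}

  ≈-sym : ∀ z w → z ≈ w → w ≈ z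
  ≈-sym z w = ℂR.sym {z} {w}

  ≈-trans : ∀ z w v → z ≈ w → w ≈ v → z ≈ v
  ≈-trans z w v = ℂR.trans {z} {w} {v}

  -- The library lemmas about ℂ-commutativeRing are not used for these congruences: matching their statements
  -- with the operations of ℂ would unfold the proofs that the sequences are Cauchy.

  ℂ-minus-cong : ∀ {z z′ w w′} → z ≈ z′ → w ≈ w′ → z ℂ.- w ≈ z′ ℂ.- w′
  ℂ-minus-cong {z} {z′} {w} {w′} p q = ℂ-+-cong {z} {z′} {ℂ.- w} {ℂ.- w′} p (ℂ-neg-cong {w} {w′} q)

  ℂ-^-cong : ∀ k {z w} → z ≈ w → z ℂ.^ k ≈ w ℂ.^ k
  ℂ-^-cong zero    {z} {w} _ = ≈-refl 1ℂ
  ℂ-^-cong (suc k) {z} {w} p = ℂ-*-cong {z} {w} {z ℂ.^ k} {w ℂ.^ k} p (ℂ-^-cong k {z} {w} p)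

  ℂ-sum-cong : ∀ k (f g : Fin k → ℂ) → (∀ j → f j ≈ g j) → ℂ.sum f ≈ ℂ.sum g
  ℂ-sum-cong zero    f g _ = ≈-refl 0ℂ
  ℂ-sum-cong (suc k) f g p = ℂ-+-cong {f zero} {g zero} {ℂ.sum (f ∘ suc)} {ℂ.sum (g ∘ suc)} (p zero)
    (ℂ-sum-cong k (f ∘ suc) (g ∘ suc) (λ j → p (suc j)))

  ℂ-product-cong : ∀ k (f g : Fin k → ℂ) → (∀ j → f j ≈ g j) → ℂ.product f ≈ ℂ.product g
  ℂ-product-cong zero    f g _ = ≈-refl 1ℂ
  ℂ-product-cong (suc k) f g p = ℂ-*-cong {f zero} {g zero} {ℂ.product (f ∘ suc)} {ℂ.product (g ∘ suc)} (p zero)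
    (ℂ-product-cong k (f ∘ suc) (g ∘ suc) (λ j → p (suc j)))

  ∣-∣-triangle₃ : ∀ {ε} a b c d → ∣ a - b ∣ < ½ * (½ * ε) → ∣ b - c ∣ ≤ ½ * (½ * ε) → ∣ c - d ∣ < ½ * (½ * ε) →
    0ℚ < ε → ∣ a - d ∣ < ε
  ∣-∣-triangle₃ {ε} a b c d ab bc cd 0<ε = ≤-<-trans
    (≤-trans (∣-∣-triangle a b d) (+-monoʳ-≤ ∣ a - b ∣ (∣-∣-triangle b c d)))
    (<-≤-trans (+-mono-<-≤ ab (+-mono-≤ bc (<⇒≤ cd)))
      (≤-by (½ * (½ * ε)) (<⇒≤ (0<½* (0<½* 0<ε))) (lemma ε)))
    where
    lemma : ∀ e → e ≡ ½ * (½ * e) + (½ * (½ * e) + ½ * (½ * e)) + ½ * (½ * e)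
    lemma = solve-∀ solver-ring

  -- Complex numbers that are real at a given stage of the approximation

  record IsReal (x y a : ℚ) : Set where
    constructor realAt
    field
      re≡ : x ≡ a
      im≡ : y ≡ 0ℚ

  open IsReal

  -- Exact equality in ℚ at stage `n`, not up to a limit. It is preserved by the ring operations, so
  -- expressions at z = it can be computed in ℚ.
  RealAt : ℕ → ℂ → ℚ → Set
  RealAt n z a = IsReal (seq (re z) n) (seq (im z) n) a

  real-+ : ∀ {n a b} z w → RealAt n z a → RealAt n w b → RealAt n (z ℂ.+ w) (a + b)
  real-+ z w (realAt p q) (realAt r s) = realAt (cong₂ _+_ p r) (trans (cong₂ _+_ q s) (+-identityˡ 0ℚ))

  real-neg : ∀ {n a} z → RealAt n z a → RealAt n (ℂ.- z) (- a)
  real-neg z (realAt p q) = realAt (cong -_ p) (cong -_ q)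

  real-minus : ∀ {n a b} z w → RealAt n z a → RealAt n w b → RealAt n (z ℂ.- w) (a - b)
  real-minus z w h k = real-+ z (ℂ.- w) h (real-neg w k)

  real-* : ∀ {n a b} z w → RealAt n z a → RealAt n w b → RealAt n (z ℂ.* w) (a * b)
  real-* {a = a} {b} z w (realAt p q) (realAt r s) = realAt
    (trans (cong₂ _-_ (cong₂ _*_ p r) (cong₂ _*_ q s)) (lemma a b))
    (trans (cong₂ _+_ (cong₂ _*_ p s) (cong₂ _*_ q r)) (lemma₂ a b))
    where
    lemma : ∀ a b → a * b - 0ℚ * 0ℚ ≡ a * b
    lemma = solve-∀ solver-ring
    lemma₂ : ∀ a b → a * 0ℚ + 0ℚ * b ≡ 0ℚ
    lemma₂ = solve-∀ solver-ring

  real-1 : ∀ n → RealAt n 1ℂ 1ℚ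
  real-1 n = realAt refl refl

  real-^ : ∀ {n a} z k → RealAt n z a → RealAt n (z ℂ.^ k) (a ^ k)
  real-^ {n} z zero    _ = real-1 n
  real-^ z (suc k) h = real-* z (z ℂ.^ k) h (real-^ z k h)

  real-sum : ∀ {n} k (f : Fin k → ℂ) (g : Fin k → ℚ) → (∀ j → RealAt n (f j) (g j)) → RealAt n (ℂ.sum f) (sum g)
  real-sum zero    f g _ = realAt refl refl
  real-sum (suc k) f g h = real-+ (f zero) (ℂ.sum (f ∘ suc)) (h zero)
    (real-sum k (f ∘ suc) (g ∘ suc) (λ j → h (suc j)))

  real-product : ∀ {n} k (f : Fin k → ℂ) (g : Fin k → ℚ) → (∀ j → RealAt n (f j) (g j)) →
    RealAt n (ℂ.product f) (product g)
  real-product {n} zero    f g _ = real-1 n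
  real-product (suc k) f g h = real-* (f zero) (ℂ.product (f ∘ suc)) (h zero)
    (real-product k (f ∘ suc) (g ∘ suc) (λ j → h (suc j)))

  real-ℝ : ∀ n x → RealAt n (ℝ→ℂ x) (seq x n)
  real-ℝ n x = realAt refl refl

  ≈-real : ∀ {z w} {f : ℕ → ℚ} → seq (im z) ≃ₛ (λ _ → 0ℚ) → seq (re z) ≃ₛ f → (∀ n → RealAt n w (f n)) → z ≈ w
  ≈-real {z} {w} im≃ re≃ h =
      (λ ε 0<ε → eventually-map (λ n → subst (λ t → ∣ seq (re z) n - t ∣ < ε) (sym (re≡ (h n)))) (re≃ ε 0<ε))
    , (λ ε 0<ε → eventually-map (λ n → subst (λ t → ∣ seq (im z) n - t ∣ < ε) (sym (im≡ (h n)))) (im≃ ε 0<ε))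

  ≈-re : ∀ {z} → seq (im z) ≃ₛ (λ _ → 0ℚ) → z ≈ ℝ→ℂ (re z)
  ≈-re {z} im≃ = ≈-real {z} {ℝ→ℂ (re z)} im≃ (≡⇒≃ₛ {seq (re z)} (λ _ → refl)) (λ n → real-ℝ n (re z))

  -- Limits

  square-< : ∀ {a e} → 0ℚ ≤ e → a * a < e * e → ∣ a ∣ < e
  square-< {a} {e} 0≤e a²<e² = ≰⇒> λ e≤∣a∣ → (λ lt le → <-irrefl refl (<-≤-trans lt le)) (subst (_< e * e) (sym square) a²<e²) (*-mono-≤ 0≤e e≤∣a∣ 0≤e e≤∣a∣)
    where
    lemma : ∀ a → - a * - a ≡ a * a
    lemma = solve-∀ solver-ring
    square : ∣ a ∣ * ∣ a ∣ ≡ a * a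
    square with ∣p∣≡p∨∣p∣≡-p a
    ... | inj₁ e = cong₂ _*_ e e
    ... | inj₂ e = trans (cong₂ _*_ e e) (lemma a)

  0≤square : ∀ a → 0ℚ ≤ a * a
  0≤square a with ≤-total 0ℚ a
  ... | inj₁ 0≤a = 0≤* 0≤a 0≤a
  ... | inj₂ a≤0 = ≤-respʳ (lemma a) (0≤* (neg-antimono-≤ a≤0) (neg-antimono-≤ a≤0))
    where
    lemma : ∀ a → - a * - a ≡ a * a
    lemma = solve-∀ solver-ring

  ε<ℝ : ∀ {ε} → 0ℚ < ε → 0ℝ <ℝ ℚ→ℝ ε
  ε<ℝ {ε} 0<ε = ε , 0<ε , 0 , λ _ _ → ≤-reflexive (+-identityˡ ε)

  ⟶-close : ∀ {s w} → s ⟶ w → ∀ ε → 0ℚ < ε → Eventually λ N → Eventually λ n →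
    ∣ seq (re (s N)) n - seq (re w) n ∣ < ε × ∣ seq (im (s N)) n - seq (im w) n ∣ < ε
  ⟶-close {s} {w} lim ε 0<ε = eventually-map
    (λ N (ε′ , 0<ε′ , h) → eventually-map (λ n → coordinates ε′ 0<ε′ (seq (re (s N)) n - seq (re w) n) (seq (im (s N)) n - seq (im w) n)) h)
    (lim (ℚ→ℝ ε) (ε<ℝ 0<ε))
    where
    coordinates : ∀ ε′ → 0ℚ < ε′ → ∀ a b → a * a + b * b + ε′ ≤ ε * ε → ∣ a ∣ < ε × ∣ b ∣ < ε
    coordinates ε′ 0<ε′ a b h =
        square-< {a} (<⇒≤ 0<ε) (<-≤-trans (subst₂ _<_ (+-identityʳ (a * a)) (sym (+-assoc (a * a) (b * b) ε′))
          (+-monoʳ-< (a * a) (+-mono-≤-< (0≤square b) 0<ε′))) h)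
      , square-< {b} (<⇒≤ 0<ε) (<-≤-trans (subst₂ _<_ (+-identityʳ (b * b)) (lemma (a * a) (b * b) ε′)
          (+-monoʳ-< (b * b) (+-mono-≤-< (0≤square a) 0<ε′))) h)
      where
      lemma : ∀ a b e → b + (a + e) ≡ a + b + e
      lemma = solve-∀ solver-ring

  -- An iterated limit: neither f nor the rows r N are assumed to be Cauchy.
  Approximates : (ℕ → ℕ → ℚ) → (ℕ → ℚ) → Set
  Approximates r f = ∀ ε → 0ℚ < ε → Eventually λ N → Eventually λ n → ∣ r N n - f n ∣ < ε

  -- One common row `N` suffices: through it `f` and `f′` are joined by three steps of at most ¼ε
  -- each.
  approximates-unique : ∀ {r r′ f f′} → Approximates r f → Approximates r′ f′ →
    (∀ ε → 0ℚ < ε → Eventually λ N → Eventually λ n → ∣ r N n - r′ N n ∣ ≤ ε) → f ≃ₛ f′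
  approximates-unique {r} {r′} {f} {f′} p q e ε 0<ε = conclude (eventually-witness
    (eventually-zip {Near r f} {λ N → Near r′ f′ N × Close N} (λ _ → _,_) (p μ 0<μ)
      (eventually-zip {Near r′ f′} {Close} (λ _ → _,_) (q μ 0<μ) (e μ 0<μ))))
    where
    μ = ½ * (½ * ε)
    0<μ : 0ℚ < μ
    0<μ = 0<½* (0<½* 0<ε)
    Near : (ℕ → ℕ → ℚ) → (ℕ → ℚ) → ℕ → Set
    Near r f N = Eventually λ n → ∣ r N n - f n ∣ < μ
    Close : ℕ → Set
    Close N = Eventually λ n → ∣ r N n - r′ N n ∣ ≤ μ
    conclude : ∃[ N ] (Near r f N × Near r′ f′ N × Close N) → Eventually λ n → ∣ f n - f′ n ∣ < ε
    conclude (N , h , h′ , k) = eventually-zip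
      {λ n → ∣ r N n - f n ∣ < μ} {λ n → (∣ r′ N n - f′ n ∣ < μ) × (∣ r N n - r′ N n ∣ ≤ μ)}
      (λ n a (b , c) → ∣-∣-triangle₃ (f n) (r N n) (r′ N n) (f′ n) (subst (_< μ) (∣p-q∣≡∣q-p∣ (r N n) (f n)) a) c b 0<ε)
      h (eventually-zip {λ n → ∣ r′ N n - f′ n ∣ < μ} {λ n → ∣ r N n - r′ N n ∣ ≤ μ} (λ _ → _,_) h′ k)

  ⟶-unique : ∀ {s s′ w w′} → s ⟶ w → s′ ⟶ w′ → (∀ N → s N ≈ s′ N) → w ≈ w′
  ⟶-unique {s} {s′} {w} {w′} lim lim′ e =
      approximates-unique {λ N → seq (re (s N))} {λ N → seq (re (s′ N))}
        (λ ε 0<ε → eventually-map (λ N → eventually-map (λ n → proj₁)) (⟶-close {s} {w} lim ε 0<ε))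
        (λ ε 0<ε → eventually-map (λ N → eventually-map (λ n → proj₁)) (⟶-close {s′} {w′} lim′ ε 0<ε))
        (λ ε 0<ε → 0 , λ N _ → eventually-map (λ n → <⇒≤) (proj₁ (e N) ε 0<ε))
    , approximates-unique {λ N → seq (im (s N))} {λ N → seq (im (s′ N))}
        (λ ε 0<ε → eventually-map (λ N → eventually-map (λ n → proj₂)) (⟶-close {s} {w} lim ε 0<ε))
        (λ ε 0<ε → eventually-map (λ N → eventually-map (λ n → proj₂)) (⟶-close {s′} {w′} lim′ ε 0<ε))
        (λ ε 0<ε → 0 , λ N _ → eventually-map (λ n → <⇒≤) (proj₂ (e N) ε 0<ε))

  -- The numbers `s N` are real only up to `≈`. Equal numbers `z N` that are real at every stage
  -- supply explicit rational rows for the iterated limit.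
  ⟶-real : ∀ {s w} (z : ℕ → ℂ) {r : ℕ → ℕ → ℚ} → s ⟶ w → (∀ N → s N ≈ z N) → (∀ N n → RealAt n (z N) (r N n)) →
    seq (im w) ≃ₛ (λ _ → 0ℚ) × Approximates r (seq (re w))
  ⟶-real {s} {w} z {r} lim e real = im≃ , re≃
    where
    Close : ℚ → ℕ → ℕ → Set
    Close ε N n = ∣ r N n - seq (re w) n ∣ < ε × ∣ 0ℚ - seq (im w) n ∣ < ε
    far : ∀ {ε} a b c → ∣ a - c ∣ < ½ * ε → ∣ a - b ∣ < ½ * ε → ∣ b - c ∣ < ε
    far {ε} a b c p q = ≤-<-trans (∣-∣-triangle b a c)
      (subst (∣ b - a ∣ + ∣ a - c ∣ <_) (½*p+½*p≡p ε) (+-mono-< (subst (_< ½ * ε) (∣p-q∣≡∣q-p∣ a b) q) p))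
    near : ∀ {ε} N n → ∣ seq (re (s N)) n - seq (re w) n ∣ < ½ * ε × ∣ seq (im (s N)) n - seq (im w) n ∣ < ½ * ε →
      ∣ seq (re (s N)) n - seq (re (z N)) n ∣ < ½ * ε × ∣ seq (im (s N)) n - seq (im (z N)) n ∣ < ½ * ε → Close ε N n
    near {ε} N n (a , b) (c , d) =
        subst (λ t → ∣ t - seq (re w) n ∣ < ε) (re≡ (real N n)) (far (seq (re (s N)) n) (seq (re (z N)) n) (seq (re w) n) a c)
      , subst (λ t → ∣ t - seq (im w) n ∣ < ε) (im≡ (real N n)) (far (seq (im (s N)) n) (seq (im (z N)) n) (seq (im w) n) b d)
    close : ∀ ε → 0ℚ < ε → Eventually λ N → Eventually (Close ε N)
    close ε 0<ε =
      let N₀ , h = ⟶-close {s} {w} lim (½ * ε) (0<½* 0<ε)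
      in N₀ , λ N N₀≤N → eventually-zip {Q = λ n → _ × _} (near N) (h N N₀≤N)
           (eventually-zip {λ n → ∣ seq (re (s N)) n - seq (re (z N)) n ∣ < ½ * ε} {λ n → ∣ seq (im (s N)) n - seq (im (z N)) n ∣ < ½ * ε}
             (λ _ → _,_) (proj₁ (e N) (½ * ε) (0<½* 0<ε)) (proj₂ (e N) (½ * ε) (0<½* 0<ε)))
    im≃ : seq (im w) ≃ₛ (λ _ → 0ℚ)
    im≃ ε 0<ε =
      let N , h = eventually-witness {λ N → Eventually (Close ε N)} (close ε 0<ε)
      in eventually-map {Close ε N} (λ n (_ , b) → subst (_< ε) (∣p-q∣≡∣q-p∣ 0ℚ (seq (im w) n)) b) h
    re≃ : Approximates r (seq (re w))
    re≃ ε 0<ε =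
      let N₀ , h = close ε 0<ε
      in N₀ , λ N N₀≤N → eventually-map {Close ε N} (λ n → proj₁) (h N N₀≤N)

  -- The exponential function on the reals

  real-exp : ∀ {z w} {θ : ℕ → ℚ} → (∀ n → RealAt n z (θ n)) → IsExp z w →
    seq (im w) ≃ₛ (λ _ → 0ℚ) × Approximates (λ N n → expSum N (θ n)) (seq (re w))
  real-exp {z} {w} {θ} real isExp = ⟶-real {s} {w} s {λ N n → expSum N (θ n)} isExp (λ N → ≈-refl (s N))
    (λ N n → real-sum N _ (expTerm (θ n) ∘ toℕ) (λ j →
      real-* (ℚ→ℂ 1/ toℕ j !) (z ℂ.^ toℕ j) (real-coefficient n (toℕ j)) (real-^ z (toℕ j) (real n))))
    where
    s : ℕ → ℂ
    s N = ℂ.sum {N} λ n → ℚ→ℂ 1/ toℕ n ! ℂ.* z ℂ.^ toℕ n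
    real-coefficient : ∀ n k → RealAt n (ℚ→ℂ 1/ k !) (recip (k !) {{k ℕ.!≢0}})
    real-coefficient n k = realAt (sym (recip≡1/ (k !) {{k ℕ.!≢0}})) refl

  -- A Lipschitz constant on [-B , B], from aᵐ⁺¹ - bᵐ⁺¹ = a(aᵐ - bᵐ) + bᵐ(a - b).
  power-continuous : ∀ B m → 0ℚ ≤ B → ∃[ C ] (0ℚ ≤ C × (∀ {a b} → ∣ a ∣ ≤ B → ∣ b ∣ ≤ B →
    ∣ a ^ m - b ^ m ∣ ≤ C * ∣ a - b ∣))
  power-continuous B zero    _   = 0ℚ , ≤-refl , λ {a} {b} _ _ → ≤-reflexive (sym (*-zeroˡ ∣ a - b ∣))
  power-continuous B (suc m) 0≤B with power-continuous B m 0≤B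
  ... | C , 0≤C , ih = B * C + B ^ m , 0≤+ (0≤* 0≤B 0≤C) (0≤^ m 0≤B) , λ {a} {b} a≤ b≤ → begin
      ∣ a * a ^ m - b * b ^ m ∣                   ≡⟨ cong ∣_∣ (lemma a b (a ^ m) (b ^ m)) ⟩
      ∣ a * (a ^ m - b ^ m) + b ^ m * (a - b) ∣   ≤⟨ ∣p+q∣≤∣p∣+∣q∣ (a * (a ^ m - b ^ m)) (b ^ m * (a - b)) ⟩
      ∣ a * (a ^ m - b ^ m) ∣ + ∣ b ^ m * (a - b) ∣
        ≡⟨ cong₂ _+_ (∣p*q∣≡∣p∣*∣q∣ a (a ^ m - b ^ m)) (∣p*q∣≡∣p∣*∣q∣ (b ^ m) (a - b)) ⟩
      ∣ a ∣ * ∣ a ^ m - b ^ m ∣ + ∣ b ^ m ∣ * ∣ a - b ∣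
        ≤⟨ +-mono-≤ (*-mono-≤ (0≤∣p∣ a) a≤ (0≤∣p∣ (a ^ m - b ^ m)) (ih a≤ b≤))
             (*-monoʳ-≤ (0≤∣p∣ (a - b)) (≤-respˡ (sym (∣x^n∣ b m)) (^-mono-≤ m (0≤∣p∣ b) b≤))) ⟩
      B * (C * ∣ a - b ∣) + B ^ m * ∣ a - b ∣     ≡⟨ lemma₂ B C (B ^ m) ∣ a - b ∣ ⟩
      (B * C + B ^ m) * ∣ a - b ∣ ∎
    where
    open ≤-Reasoning
    lemma : ∀ a b x y → a * x - b * y ≡ a * (x - y) + y * (a - b)
    lemma = solve-∀ solver-ring
    lemma₂ : ∀ b c x t → b * (c * t) + x * t ≡ (b * c + x) * t
    lemma₂ = solve-∀ solver-ring

  -- By `expSum-^` the two families of partial sums differ by O(1/2ᴺ), and taking powers commutes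
  -- with the limit by the Lipschitz bound. The smallness of θ keeps all arguments within the range
  -- of the Cauchy product estimate.
  exp-^ : ∀ m .{{_ : ℕ.NonZero m}} {θ x v : ℕ → ℚ} → Eventually (λ n → ι m * ∣ θ n ∣ ≤ ¼) →
    Approximates (λ N n → expSum N (θ n)) x → Approximates (λ N n → expSum N (ι m * θ n)) v →
    v ≃ₛ (λ n → x n ^ m)
  exp-^ (suc m) {θ} {x} {v} small lim-x lim-v = approximates-unique
    {λ N n → expSum N (ι (suc m) * θ n)} {λ N n → expSum N (θ n) ^ suc m} lim-v lim-x^ near
    where
    -- Partial sums are bounded by 2, and the limit is taken within 1 of them.
    B : ℚ
    B = 1ℚ + (1ℚ + 1ℚ)
    ∣θ∣≤ : ∀ n → ι (suc m) * ∣ θ n ∣ ≤ ¼ → ∣ θ n ∣ ≤ ¼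
    ∣θ∣≤ n h = ≤-trans (≤-respˡ (*-identityˡ ∣ θ n ∣) (*-monoʳ-≤ (0≤∣p∣ (θ n)) (1≤ι (suc m)))) h
    sum-bounded : ∀ N n → ι (suc m) * ∣ θ n ∣ ≤ ¼ → ∣ expSum N (θ n) ∣ ≤ 1ℚ + 1ℚ
    sum-bounded N n h = ∣expSum∣≤2 N (∣θ∣≤ n h)
    continuity = power-continuous B (suc m) (nonNegative⁻¹ B)
    C = proj₁ continuity
    lim-x^ : Approximates (λ N n → expSum N (θ n) ^ suc m) (λ n → x n ^ suc m)
    lim-x^ ε 0<ε =
      let μ , 0<μ , Cμ≤ = small-multiple {C} (proj₁ (proj₂ continuity)) (0<½* 0<ε)
          ν , 0<ν , ν≤μ , ν≤1 = min-pos 0<μ (positive⁻¹ 1ℚ)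
      in eventually-map (λ N → eventually-zip (λ n h close → ≤-<-trans
          (≤-trans (proj₂ (proj₂ continuity)
              (≤-trans (sum-bounded N n h) (≤-by 1ℚ 0≤1 refl))
              (≤-trans (≤-respˡ (cong ∣_∣ (lemma (x n) (expSum N (θ n)))) (∣p+q∣≤∣p∣+∣q∣ (x n - expSum N (θ n)) (expSum N (θ n))))
                (+-mono-≤ (≤-respˡ (∣p-q∣≡∣q-p∣ (expSum N (θ n)) (x n)) (≤-trans (<⇒≤ close) ν≤1)) (sum-bounded N n h))))
            (≤-trans (*-monoˡ-≤ (proj₁ (proj₂ continuity)) (≤-trans (<⇒≤ close) ν≤μ)) Cμ≤)) (½*p<p 0<ε)) small)
        (lim-x ν 0<ν)
      where
      lemma : ∀ a b → a - b + b ≡ a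
      lemma = solve-∀ solver-ring
    near : ∀ ε → 0ℚ < ε → Eventually λ N → Eventually λ n →
      ∣ expSum N (ι (suc m) * θ n) - expSum N (θ n) ^ suc m ∣ ≤ ε
    near ε 0<ε =
      let C′ , 0≤C′ , bound = expSum-^ m
          μ , 0<μ , C′μ≤ = small-multiple 0≤C′ 0<ε
          M , ½^M≤ = ^-small 0<½ ½≤1 0<μ
      in M , λ N M≤N → eventually-map (λ n h → ≤-trans (bound N {θ n} h)
           (≤-trans (*-monoˡ-≤ 0≤C′ (≤-trans (^-antimono-≤ 0≤½ ½≤1 M≤N) ½^M≤)) C′μ≤)) small

  -- exp (-s) = 1 - s + O(s²)
  exp-bounds : ∀ {θ s s₀ E x} → θ ≡ - s → s₀ ≤ s → 0ℚ ≤ s → ∣ E - (1ℚ + θ) ∣ ≤ ½ * ∣ θ ∣ → ∣ E - x ∣ ≤ ½ * (½ * s₀) →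
    (1ℚ - x ≤ two * s) × (½ * (½ * s₀) ≤ 1ℚ - x)
  exp-bounds {θ} {s} {s₀} {E} {x} θ≡ s₀≤s 0≤s linear close =
      ≤-by ((½ * s - (- (E - (1ℚ + - s)))) + (¼′ - (E - x)) + ½ * (½ * (s - s₀)) + ½ * (½ * s))
        (0≤+ (0≤+ (0≤+ (p≤q⇒0≤q-p (∣p∣≤⇒-≤ linear′)) (p≤q⇒0≤q-p (∣p∣≤⇒≤ close)))
          (0≤* 0≤½ (0≤* 0≤½ (p≤q⇒0≤q-p s₀≤s)))) (0≤* 0≤½ (0≤* 0≤½ 0≤s))) (lemma₁ s s₀ E x)
    , ≤-by ((½ * s - (E - (1ℚ + - s))) + (¼′ - - (E - x)) + ½ * (s - s₀))
        (0≤+ (0≤+ (p≤q⇒0≤q-p (∣p∣≤⇒≤ linear′)) (p≤q⇒0≤q-p (∣p∣≤⇒-≤ close))) (0≤* 0≤½ (p≤q⇒0≤q-p s₀≤s)))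
        (lemma₂ s s₀ E x)
    where
    ¼′ = ½ * (½ * s₀)
    ∣θ∣≡ : ∣ θ ∣ ≡ s
    ∣θ∣≡ = trans (cong ∣_∣ θ≡) (trans (∣-p∣≡∣p∣ s) (0≤p⇒∣p∣≡p 0≤s))
    linear′ : ∣ E - (1ℚ + - s) ∣ ≤ ½ * s
    linear′ = subst₂ (λ a b → ∣ E - (1ℚ + a) ∣ ≤ ½ * b) θ≡ ∣θ∣≡ linear
    lemma₁ : ∀ s r e x → (1ℚ + 1ℚ) * s ≡ 1ℚ - x +
      ((½ * s - (- (e - (1ℚ + - s)))) + (½ * (½ * r) - (e - x)) + ½ * (½ * (s - r)) + ½ * (½ * s))
    lemma₁ = solve-∀ solver-ring
    lemma₂ : ∀ s r e x → 1ℚ - x ≡ ½ * (½ * r) +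
      ((½ * s - (e - (1ℚ + - s))) + (½ * (½ * r) - - (e - x)) + ½ * (s - r))
    lemma₂ = solve-∀ solver-ring

  module _ {p A : ℕ} .{{_ : ℕ.NonZero p}} {δ : ℚ} (1<p : 1 ℕ.< p) (0<δ : 0ℚ < δ) (δ≤1 : δ ≤ 1ℚ)
    (m : ℕ) .{{_ : ℕ.NonZero m}} (π : ℕ → ℚ)
    {b B : ℚ} (0<b : 0ℚ < b) (b≤π : Eventually λ n → b ≤ π n) (π≤B : Eventually λ n → π n ≤ B) where

    -- The n-th approximation of 2πiz/m at z = it. For m = 24 its exponential is q^(1/24).
    exponent : ℚ → ℕ → ℚ
    exponent t n = recip m * - (ι 2 * π n * t)

    private
      bounds = eta-magnitudes {p} {A} 1<p 0<δ δ≤1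
      η = proj₁ bounds
      K₀ = proj₁ (proj₂ bounds)
      0<η : 0ℚ < η
      0<η = proj₁ (proj₂ (proj₂ bounds))
      magnitude = proj₂ (proj₂ (proj₂ bounds))

      0<B : 0ℚ < B
      0<B = let n , b≤ , ≤B = eventually-witness (eventually-zip {λ n → b ≤ π n} {λ n → π n ≤ B} (λ _ → _,_) b≤π π≤B)
            in <-≤-trans 0<b (≤-trans b≤ ≤B)
      2B : ℚ
      2B = ι 2 * B
      0≤2B : 0ℚ ≤ 2B
      0≤2B = 0≤* (0≤ι 2) (<⇒≤ 0<B)

      abstract
        -- The first bound brings all exponents up to mp times θ into the range of `exp-^`. The
        -- second one keeps 1 - xᵐ ≤ m(1 - x) ≤ 2m · 2Bt below the threshold.
        choice : ∃[ t ] (0ℚ < t × ι (m ℕ.* p) * (2B * t) ≤ ¼ × ι m * (two * (2B * t)) ≤ η)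
        choice =
          let t₁ , 0<t₁ , h₁ = small-multiple {ι (m ℕ.* p) * 2B} {¼} (0≤* (0≤ι (m ℕ.* p)) 0≤2B) (0<* 0<½ 0<½)
              t₂ , 0<t₂ , h₂ = small-multiple {ι m * (two * 2B)} {η} (0≤* (0≤ι m) (0≤* 0≤two 0≤2B)) 0<η
              t , 0<t , t≤t₁ , t≤t₂ = min-pos 0<t₁ 0<t₂
          in t , 0<t
            , ≤-trans (≤-respˡ (*-assoc (ι (m ℕ.* p)) 2B t) (*-monoˡ-≤ (0≤* (0≤ι (m ℕ.* p)) 0≤2B) t≤t₁)) h₁
            , ≤-trans (≤-respˡ (lemma (ι m) 2B t) (*-monoˡ-≤ (0≤* (0≤ι m) (0≤* 0≤two 0≤2B)) t≤t₂)) h₂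
          where
          lemma : ∀ i c t → i * ((1ℚ + 1ℚ) * c) * t ≡ i * ((1ℚ + 1ℚ) * (c * t))
          lemma = solve-∀ solver-ring

    height : ℚ
    height = proj₁ choice

    0<height : 0ℚ < height
    0<height = proj₁ (proj₂ choice)

    private
      t = height
      s : ℕ → ℚ
      s n = recip m * (ι 2 * π n * t)
      s₀ : ℚ
      s₀ = recip m * (ι 2 * b * t)
      0<s₀ : 0ℚ < s₀
      0<s₀ = 0<* (0<recip m) (0<* (0<* (0<ι 2) 0<b) 0<height)

      θ≡-s : ∀ n → exponent t n ≡ - s n
      θ≡-s n = lemma (recip m) (ι 2 * π n * t)
        where
        lemma : ∀ a b → a * - b ≡ - (a * b)
        lemma = solve-∀ solver-ring

      record Small (n : ℕ) : Set where
        field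
          s₀≤s  : s₀ ≤ s n
          s≤2Bt : s n ≤ 2B * t
        0≤s : 0ℚ ≤ s n
        0≤s = ≤-trans (<⇒≤ 0<s₀) s₀≤s
        ∣θ∣≡s : ∣ exponent t n ∣ ≡ s n
        ∣θ∣≡s = trans (cong ∣_∣ (θ≡-s n)) (trans (∣-p∣≡∣p∣ (s n)) (0≤p⇒∣p∣≡p 0≤s))
        ιmps≤¼ : ι (m ℕ.* p) * s n ≤ ¼
        ιmps≤¼ = ≤-trans (*-monoˡ-≤ (0≤ι (m ℕ.* p)) s≤2Bt) (proj₁ (proj₂ (proj₂ choice)))
        ιm2s≤η : ι m * (two * s n) ≤ η
        ιm2s≤η = ≤-trans (*-monoˡ-≤ (0≤ι m) (*-monoˡ-≤ 0≤two s≤2Bt)) (proj₂ (proj₂ (proj₂ choice)))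
        s≤¼ : s n ≤ ¼
        s≤¼ = ≤-trans (≤-respˡ (*-identityˡ (s n)) (*-monoʳ-≤ 0≤s (1≤ι (m ℕ.* p) {{ℕ.m*n≢0 m p}}))) ιmps≤¼

      small : Eventually Small
      small = eventually-zip {λ n → b ≤ π n} {λ n → π n ≤ B} {Small} (λ n b≤ ≤B → record
        { s₀≤s  = *-monoˡ-≤ (<⇒≤ (0<recip m)) (*-monoʳ-≤ (<⇒≤ 0<height) (*-monoˡ-≤ (0≤ι 2) b≤))
        ; s≤2Bt = ≤-trans (p*q≤q (0≤* (0≤* (0≤ι 2) (≤-trans (<⇒≤ 0<b) b≤)) (<⇒≤ 0<height)) (recip≤1 m))
                    (*-monoʳ-≤ (<⇒≤ 0<height) (*-monoˡ-≤ (0≤ι 2) ≤B))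
        }) b≤π π≤B

    exponent-small : Eventually λ n → ι (m ℕ.* p) * ∣ exponent height n ∣ ≤ ¼
    exponent-small = eventually-map {Small} (λ n h → ≤-respˡ (cong (ι (m ℕ.* p) *_) (sym (Small.∣θ∣≡s h))) (Small.ιmps≤¼ h)) small

    module _ {x : ℕ → ℚ} (lim-x : Approximates (λ N n → expSum N (exponent height n)) x) where

      private
        -- 1 - xᵐ ≥ 1 - x ≥ ¼s₀, where `s₀` comes from the lower bound `b` of π: a floor that does
        -- not depend on n.
        choice₃ = min-pos {½ * (½ * s₀)} {1ℚ} (0<½* (0<½* 0<s₀)) (positive⁻¹ 1ℚ)
        g = proj₁ choice₃
        g≤ = proj₁ (proj₂ (proj₂ choice₃))
        σ-data = magnitude {g} (proj₁ (proj₂ choice₃)) (proj₂ (proj₂ (proj₂ choice₃)))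

        record Base (n : ℕ) : Set where
          field
            ½≤x : ½ ≤ x n
            x≤1 : x n ≤ 1ℚ
            g≤h : g ≤ 1ℚ - x n ^ m
            h≤η : 1ℚ - x n ^ m ≤ η

        Near : ℕ → ℕ → Set
        Near N n = ∣ expSum N (exponent t n) - x n ∣ < ½ * (½ * s₀)

        1-[1-x] : ∀ x → 1ℚ - (1ℚ - x) ≡ x
        1-[1-x] = solve-∀ solver-ring

        base-at : ∀ N n → Small n → Near (2 ℕ.+ N) n → Base n
        base-at N n sm near = record { ½≤x = ½≤x ; x≤1 = x≤1 ; g≤h = ≤-trans g≤ (≤-trans lower h≥) ; h≤η = h≤η }
          where
          open Small sm
          both = exp-bounds {exponent t n} {s n} {s₀} {expSum (2 ℕ.+ N) (exponent t n)} {x n} (θ≡-s n) s₀≤s 0≤s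
            (expSum-linear N (≤-respˡ (sym ∣θ∣≡s) s≤¼)) (<⇒≤ near)
          upper : 1ℚ - x n ≤ two * s n
          upper = proj₁ both
          lower : ½ * (½ * s₀) ≤ 1ℚ - x n
          lower = proj₂ both
          ½≤x : ½ ≤ x n
          ½≤x = ≤-respʳ (1-[1-x] (x n)) (≤-trans (+-monoʳ-≤ 1ℚ (neg-antimono-≤ (*-monoˡ-≤ 0≤two s≤¼)))
            (+-monoʳ-≤ 1ℚ (neg-antimono-≤ upper)))
          x≤1 : x n ≤ 1ℚ
          x≤1 = ≤-by (1ℚ - x n) (≤-trans (<⇒≤ (0<½* (0<½* 0<s₀))) lower) (lemma (x n))
            where
            lemma : ∀ x → 1ℚ ≡ x + (1ℚ - x)
            lemma = solve-∀ solver-ring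
          0≤x : 0ℚ ≤ x n
          0≤x = ≤-trans 0≤½ ½≤x
          h≥ : 1ℚ - x n ≤ 1ℚ - x n ^ m
          h≥ = ≤-respˡ (cong (λ t → 1ℚ - t) (*-identityʳ (x n))) (1-^-mono 0≤x x≤1 {1} {m} (ℕ.>-nonZero⁻¹ m))
          h≤η : 1ℚ - x n ^ m ≤ η
          h≤η = ≤-trans (bernoulli m 0≤x x≤1) (≤-trans (*-monoˡ-≤ (0≤ι m) upper) ιm2s≤η)

        base : Eventually Base
        -- A single partial sum near x is enough, but it must contain the constant and the linear
        -- term.
        base = eventually-zip {Small} {Near (2 ℕ.+ N)} {Base} (base-at N) small (near (2 ℕ.+ N) (ℕ.m≤n+m N 2))
          where
          lim = lim-x (½ * (½ * s₀)) (0<½* (0<½* 0<s₀))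
          N = proj₁ lim
          near : ∀ M → N ℕ.≤ M → Eventually (Near M)
          near = proj₂ lim

      scale : ℚ
      scale = proj₁ σ-data

      0<scale : 0ℚ < scale
      0<scale = proj₁ (proj₂ σ-data)

      magnitudes-near-cusp : ∀ {X Y : ℕ → ℚ} →
        Approximates (λ N n → x n * euler N (x n ^ m)) X →
        Approximates (λ N n → x n ^ p * euler N ((x n ^ m) ^ p)) Y →
        Eventually λ n → Magnitudes p A δ scale (X n) (Y n)
      magnitudes-near-cusp {X} {Y} lim-X lim-Y = eventually-zip
        {Base} {λ n → NearX n × NearY n} {λ n → Magnitudes p A δ scale (X n) (Y n)}
        (λ n bs (a , c) → proj₂ (proj₂ σ-data) m {K} (ℕ.m≤m+n K₀ _)
          (Base.½≤x bs) (Base.x≤1 bs) (Base.g≤h bs) (Base.h≤η bs)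
          (≤-respˡ (∣p-q∣≡∣q-p∣ (x n * euler (K ℕ.* p) (x n ^ m)) (X n)) (<⇒≤ a))
          (≤-respˡ (∣p-q∣≡∣q-p∣ (x n ^ p * euler K ((x n ^ m) ^ p)) (Y n)) (<⇒≤ c)))
        base (eventually-zip {NearX} {NearY} (λ _ → _,_) (proj₂ limX (K ℕ.* p) NX≤) (proj₂ limY K NY≤))
        where
        limX = lim-X scale 0<scale
        limY = lim-Y scale 0<scale
        NX = proj₁ limX
        NY = proj₁ limY
        -- X is compared with K * p factors and Y with K factors, so that the blocks of p match.
        K = K₀ ℕ.+ (NX ℕ.+ NY)
        NearX NearY : ℕ → Set
        NearX n = ∣ x n * euler (K ℕ.* p) (x n ^ m) - X n ∣ < scale
        NearY n = ∣ x n ^ p * euler K ((x n ^ m) ^ p) - Y n ∣ < scale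
        NX≤ : NX ℕ.≤ K ℕ.* p
        NX≤ = ℕ.≤-trans (ℕ.m≤m+n NX NY) (ℕ.≤-trans (ℕ.m≤n+m (NX ℕ.+ NY) K₀) (ℕ.m≤m*n K p))
        NY≤ : NY ℕ.≤ K
        NY≤ = ℕ.≤-trans (ℕ.m≤n+m NY NX) (ℕ.m≤n+m (NX ℕ.+ NY) K₀)

  real-resp : ∀ {n a b} z → a ≡ b → RealAt n z a → RealAt n z b
  real-resp z refl h = h

  approximates-resp : ∀ {r r′ : ℕ → ℕ → ℚ} {f} → (∀ N n → r N n ≡ r′ N n) → Approximates r f → Approximates r′ f
  approximates-resp {f = f} e h ε 0<ε =
    let N₀ , k = h ε 0<ε
    in N₀ , λ N N₀≤N → let n₀ , l = k N N₀≤N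
                       in n₀ , λ n n₀≤n → subst (λ t → ∣ t - f n ∣ < ε) (e N n) (l n n₀≤n)

  -- η on the imaginary axis

  etaPartial : ℂ → ℂ → ℕ → ℂ
  etaPartial r q N = r ℂ.* ℂ.product {N} λ n → 1ℂ ℂ.- q ℂ.^ suc (toℕ n)

  etaPartial-cong : ∀ {r r′ q q′} → r ≈ r′ → q ≈ q′ → ∀ N → etaPartial r q N ≈ etaPartial r′ q′ N
  etaPartial-cong {r} {r′} {q} {q′} r≈ q≈ N = ℂ-*-cong {r} {r′} {ℂ.product (factor q)} {ℂ.product (factor q′)} r≈
    (ℂ-product-cong N (factor q) (factor q′) (λ j →
      ℂ-minus-cong {1ℂ} {1ℂ} {q ℂ.^ suc (toℕ j)} {q′ ℂ.^ suc (toℕ j)} (≈-refl 1ℂ) (ℂ-^-cong (suc (toℕ j)) {q} {q′} q≈)))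
    where
    factor : ℂ → Fin N → ℂ
    factor q n = 1ℂ ℂ.- q ℂ.^ suc (toℕ n)

  real-etaPartial : ∀ {n a y} r q → RealAt n r a → RealAt n q y →
    ∀ N → RealAt n (etaPartial r q N) (a * euler N y)
  real-etaPartial {n} {a} {y} r q real-r real-q N =
    real-* {n} {a} {euler N y} r (ℂ.product {N} λ j → 1ℂ ℂ.- q ℂ.^ suc (toℕ j)) real-r
      (real-product {n} N (λ j → 1ℂ ℂ.- q ℂ.^ suc (toℕ j)) (λ j → 1ℚ - y ^ suc (toℕ j)) (λ j →
        real-minus {n} {1ℚ} {y ^ suc (toℕ j)} 1ℂ (q ℂ.^ suc (toℕ j)) (real-1 n)
          (real-^ {n} {y} q (suc (toℕ j)) real-q)))

  eta-real : ∀ {r q w} R Q (a y : ℕ → ℚ) → (∀ n → RealAt n R (a n)) → (∀ n → RealAt n Q (y n)) →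
    r ≈ R → q ≈ Q → etaPartial r q ⟶ w →
    seq (im w) ≃ₛ (λ _ → 0ℚ) × Approximates (λ N n → a n * euler N (y n)) (seq (re w))
  eta-real {r} {q} {w} R Q a y real-R real-Q r≈ q≈ lim = ⟶-real {etaPartial r q} {w} (etaPartial R Q) lim
    (etaPartial-cong {r} {R} {q} {Q} r≈ q≈) (λ N n → real-etaPartial {n} {a n} {y n} R Q (real-R n) (real-Q n) N)

  2πi* : ℝ → ℂ → ℂ
  2πi* π z = ℤ→ℂ (ℤ.+ 2) ℂ.* ℝ→ℂ π ℂ.* i ℂ.* z

  -- Complex products are formed termwise on the sequences, so on the imaginary axis the imaginary
  -- part of 2πiz is literally 0 at each stage.
  2πi*-real : ∀ {n t} π z → seq (re z) n ≡ 0ℚ → seq (im z) n ≡ t → RealAt n (2πi* π z) (- (ι 2 * seq π n * t))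
  2πi*-real {n} {t} π z re0 im≡t = realAt
    (trans (re-lemma (ℤ.+ 2 / 1) (seq π n) (seq (re z) n) (seq (im z) n))
      (cong₂ (λ c t → - (c * seq π n * t)) (sym (ι≡/1 2)) im≡t))
    (trans (cong (λ a → U * seq (im z) n + V * a) re0) (im-lemma (ℤ.+ 2 / 1) (seq π n) (seq (im z) n)))
    where
    c = ℤ.+ 2 / 1
    U = (c * seq π n - 0ℚ * 0ℚ) * 0ℚ - (c * 0ℚ + 0ℚ * seq π n) * 1ℚ
    V = (c * seq π n - 0ℚ * 0ℚ) * 1ℚ + (c * 0ℚ + 0ℚ * seq π n) * 0ℚ
    re-lemma : ∀ c p a b → ((c * p - 0ℚ * 0ℚ) * 0ℚ - (c * 0ℚ + 0ℚ * p) * 1ℚ) * a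
      - ((c * p - 0ℚ * 0ℚ) * 1ℚ + (c * 0ℚ + 0ℚ * p) * 0ℚ) * b ≡ - (c * p * b)
    re-lemma = solve-∀ solver-ring
    im-lemma : ∀ c p b → ((c * p - 0ℚ * 0ℚ) * 0ℚ - (c * 0ℚ + 0ℚ * p) * 1ℚ) * b
      + ((c * p - 0ℚ * 0ℚ) * 1ℚ + (c * 0ℚ + 0ℚ * p) * 0ℚ) * 0ℚ ≡ 0ℚ
    im-lemma = solve-∀ solver-ring

  real-ℚ* : ∀ {n a} c z → RealAt n z a → RealAt n (ℚ→ℂ c ℂ.* z) (c * a)
  real-ℚ* {n} {a} c z = real-* {n} {c} {a} (ℚ→ℂ c) z (realAt refl refl)

  -- All four exponentials in η(z) and η(pz) are powers of x = r = exp (2πiz / m).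
  module _ (m p : ℕ) .{{_ : ℕ.NonZero m}} .{{_ : ℕ.NonZero p}} {θ : ℕ → ℚ}
    (small : Eventually λ n → ι (m ℕ.* p) * ∣ θ n ∣ ≤ ¼) {u v u′ v′ : ℂ}
    (real-u : ∀ n → RealAt n u (ι m * θ n)) (real-v : ∀ n → RealAt n v (θ n))
    (real-u′ : ∀ n → RealAt n u′ (ι (m ℕ.* p) * θ n)) (real-v′ : ∀ n → RealAt n v′ (ι p * θ n))
    {q r q′ r′ : ℂ} (exp-q : IsExp u q) (exp-r : IsExp v r) (exp-q′ : IsExp u′ q′) (exp-r′ : IsExp v′ r′) where

    private
      x : ℝ
      x = re r

      lim-x : Approximates (λ N n → expSum N (θ n)) (seq x)
      lim-x = proj₂ (real-exp {v} {r} {θ} real-v exp-r)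

      real-power : ∀ k n → RealAt n (ℝ→ℂ x ℂ.^ k) (seq x n ^ k)
      real-power k n = real-^ {n} {seq x n} (ℝ→ℂ x) k (real-ℝ n x)

      power : ∀ k .{{_ : ℕ.NonZero k}} → k ℕ.≤ m ℕ.* p → ∀ {z w} → (∀ n → RealAt n z (ι k * θ n)) → IsExp z w →
        w ≈ ℝ→ℂ x ℂ.^ k
      power k k≤ {z} {w} real isExp = ≈-real {w} {ℝ→ℂ x ℂ.^ k} {λ n → seq x n ^ k} (proj₁ both)
        (exp-^ k {θ} {seq x} {seq (re w)}
          (eventually-map {λ n → ι (m ℕ.* p) * ∣ θ n ∣ ≤ ¼} (λ n → ≤-trans (*-monoʳ-≤ (0≤∣p∣ (θ n)) (ι-mono k≤))) small)
          lim-x (proj₂ both)) (real-power k)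
        where
        both : seq (im w) ≃ₛ (λ _ → 0ℚ) × Approximates (λ N n → expSum N (ι k * θ n)) (seq (re w))
        both = real-exp {z} {w} {λ n → ι k * θ n} real isExp

      -- The case k = 1 expresses that `r` equals its own real part.
      r≈ : r ≈ ℝ→ℂ x ℂ.^ 1
      r≈ = power 1 (ℕ.>-nonZero⁻¹ (m ℕ.* p) {{ℕ.m*n≢0 m p}}) {v} {r}
        (λ n → real-resp v (sym (trans (cong (_* θ n) ι1≡1) (*-identityˡ (θ n)))) (real-v n)) exp-r

    eta-values-on-axis : ∀ {X Y} →
      etaPartial r q ⟶ X →
      etaPartial r′ q′ ⟶ Y →
      seq (im X) ≃ₛ (λ _ → 0ℚ) × seq (im Y) ≃ₛ (λ _ → 0ℚ) × ∃[ x ]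
        ( Approximates (λ N n → expSum N (θ n)) x
        × Approximates (λ N n → x n * euler N (x n ^ m)) (seq (re X))
        × Approximates (λ N n → x n ^ p * euler N ((x n ^ m) ^ p)) (seq (re Y)))
    eta-values-on-axis {X} {Y} lim-X lim-Y =
        proj₁ real-X , proj₁ real-Y , seq x , lim-x
      , approximates-resp {f = seq (re X)} (λ N n → cong (_* euler N (seq x n ^ m)) (*-identityʳ (seq x n))) (proj₂ real-X)
      , approximates-resp {f = seq (re Y)} (λ N n → cong (λ y → seq x n ^ p * euler N y) (sym (^-assocʳ (seq x n) m p))) (proj₂ real-Y)
      where
      real-X : seq (im X) ≃ₛ (λ _ → 0ℚ) × Approximates (λ N n → seq x n ^ 1 * euler N (seq x n ^ m)) (seq (re X))
      real-X = eta-real {r} {q} {X} (ℝ→ℂ x ℂ.^ 1) (ℝ→ℂ x ℂ.^ m) (λ n → seq x n ^ 1) (λ n → seq x n ^ m)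
        (real-power 1) (real-power m) r≈ (power m (ℕ.m≤m*n m p) {u} {q} real-u exp-q) lim-X

      real-Y : seq (im Y) ≃ₛ (λ _ → 0ℚ) × Approximates (λ N n → seq x n ^ p * euler N (seq x n ^ (m ℕ.* p))) (seq (re Y))
      real-Y = eta-real {r′} {q′} {Y} (ℝ→ℂ x ℂ.^ p) (ℝ→ℂ x ℂ.^ (m ℕ.* p)) (λ n → seq x n ^ p) (λ n → seq x n ^ (m ℕ.* p))
        (real-power p) (real-power (m ℕ.* p)) (power p (ℕ.m≤n*m p m) {v′} {r′} real-v′ exp-r′)
        (power (m ℕ.* p) {{ℕ.m*n≢0 m p}} ℕ.≤-refl {u′} {q′} real-u′ exp-q′) lim-Y

  -- The exponents 2πiz and 2πiz/m at it and pit

  module _ (m p : ℕ) .{{_ : ℕ.NonZero m}} {c : ℚ} (c≡ : c ≡ recip m) (π : ℝ) (t : ℚ) where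

    private
      θ : ℕ → ℚ
      θ n = recip m * - (ι 2 * seq π n * t)

      ι*recip* : ∀ x → ι m * (recip m * x) ≡ x
      ι*recip* x = trans (sym (*-assoc (ι m) (recip m) x)) (trans (cong (_* x) (ι*recip m)) (*-identityˡ x))

    module _ (z : ℂ) (re-z : ∀ n → seq (re z) n ≡ 0ℚ) (im-z : ∀ n → seq (im z) n ≡ t) where

      real-2πiz : ∀ n → RealAt n (2πi* π z) (ι m * θ n)
      real-2πiz n = real-resp (2πi* π z) (sym (ι*recip* (- (ι 2 * seq π n * t)))) (2πi*-real π z (re-z n) (im-z n))

      real-c2πiz : ∀ n → RealAt n (ℚ→ℂ c ℂ.* 2πi* π z) (θ n)
      real-c2πiz n = real-resp (ℚ→ℂ c ℂ.* 2πi* π z) (cong (_* - (ι 2 * seq π n * t)) c≡)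
        (real-ℚ* c (2πi* π z) (2πi*-real π z (re-z n) (im-z n)))

    module _ (z : ℂ) (re-z : ∀ n → seq (re z) n ≡ 0ℚ) (im-z : ∀ n → seq (im z) n ≡ ι p * t) where

      private
        lemma : ∀ x p t → - (x * (p * t)) ≡ p * - (x * t)
        lemma = solve-∀ solver-ring
        lemma′ : ∀ r p x → r * (p * x) ≡ p * (r * x)
        lemma′ = solve-∀ solver-ring

      real-2πipz : ∀ n → RealAt n (2πi* π z) (ι (m ℕ.* p) * θ n)
      real-2πipz n = real-resp (2πi* π z)
        (trans (lemma (ι 2 * seq π n) (ι p) t) (trans (cong (ι p *_) (sym (ι*recip* (- (ι 2 * seq π n * t)))))
          (trans (lemma″ (ι p) (ι m) (θ n)) (cong (_* θ n) (sym (ι-* m p))))))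
        (2πi*-real π z (re-z n) (im-z n))
        where
        lemma″ : ∀ p m x → p * (m * x) ≡ m * p * x
        lemma″ = solve-∀ solver-ring

      real-c2πipz : ∀ n → RealAt n (ℚ→ℂ c ℂ.* 2πi* π z) (ι p * θ n)
      real-c2πipz n = real-resp (ℚ→ℂ c ℂ.* 2πi* π z)
        (trans (cong₂ _*_ c≡ (lemma (ι 2 * seq π n) (ι p) t)) (lemma′ (recip m) (ι p) (- (ι 2 * seq π n * t))))
        (real-ℚ* c (2πi* π z) (2πi*-real π z (re-z n) (im-z n)))

  -- Written out as in IsEta, so that the two match without unfolding.
  PartialLimit : ℂ → ℂ → ℂ → Set
  PartialLimit r q w = (λ N → r ℂ.* ℂ.product {N} λ n → 1ℂ ℂ.- q ℂ.^ suc (toℕ n)) ⟶ w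

  etaPartial-limit : ∀ {r q w} → PartialLimit r q w → etaPartial r q ⟶ w
  etaPartial-limit h = h

  -- For u = 2πiz and v = 2πiz/24 this says that w = η(z).
  EtaLimit : ℂ → ℂ → ℂ → Set
  EtaLimit u v w = ∃[ q ] ∃[ r ] (IsExp u q × IsExp v r × PartialLimit r q w)

  module _ {p A : ℕ} .{{_ : ℕ.NonZero p}} {δ : ℚ} (1<p : 1 ℕ.< p) (0<δ : 0ℚ < δ) (δ≤1 : δ ≤ 1ℚ)
    (m : ℕ) .{{_ : ℕ.NonZero m}} (π : ℝ) where

    private
      θ : ℚ → ℕ → ℚ
      θ t n = recip m * - (ι 2 * seq π n * t)

    -- The height t is fixed before any exponential is given, so the exponentials can afterwards be
    -- those that the description of η supplies at the point it.
    eta-near-cusp : 0ℝ <ℝ π → ∃[ t ] (0ℚ < t × (∀ {u v u′ v′ X Y} →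
      (∀ n → RealAt n u (ι m * θ t n)) → (∀ n → RealAt n v (θ t n)) →
      (∀ n → RealAt n u′ (ι (m ℕ.* p) * θ t n)) → (∀ n → RealAt n v′ (ι p * θ t n)) →
      EtaLimit u v X → EtaLimit u′ v′ Y →
      seq (im X) ≃ₛ (λ _ → 0ℚ) × seq (im Y) ≃ₛ (λ _ → 0ℚ) ×
        ∃[ σ ] (0ℚ < σ × Eventually λ n → Magnitudes p A δ σ (seq (re X) n) (seq (re Y) n))))
    eta-near-cusp (b , 0<b , N , h) =
        height {p} {A} 1<p 0<δ δ≤1 m (seq π) 0<b b≤π π≤B
      , 0<height {p} {A} 1<p 0<δ δ≤1 m (seq π) 0<b b≤π π≤B
      , λ {u} {v} {u′} {v′} {X} {Y} real-u real-v real-u′ real-v′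
          (q , r , exp-q , exp-r , limit) (q′ , r′ , exp-q′ , exp-r′ , limit′) →
          let im-X , im-Y , x , lim-x , lim-X , lim-Y = eta-values-on-axis m p
                {θ (height {p} {A} 1<p 0<δ δ≤1 m (seq π) 0<b b≤π π≤B)}
                (exponent-small {p} {A} 1<p 0<δ δ≤1 m (seq π) 0<b b≤π π≤B)
                {u} {v} {u′} {v′} real-u real-v real-u′ real-v′
                {q} {r} {q′} {r′} exp-q exp-r exp-q′ exp-r′ {X} {Y}
                (etaPartial-limit {r} {q} {X} limit) (etaPartial-limit {r′} {q′} {Y} limit′)
          in im-X , im-Y
            , scale {p} {A} 1<p 0<δ δ≤1 m (seq π) 0<b b≤π π≤B {x} lim-x
            , 0<scale {p} {A} 1<p 0<δ δ≤1 m (seq π) 0<b b≤π π≤B {x} lim-x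
            , magnitudes-near-cusp {p} {A} 1<p 0<δ δ≤1 m (seq π) 0<b b≤π π≤B {x} lim-x {seq (re X)} {seq (re Y)} lim-X lim-Y
      where
      b≤π : Eventually λ n → b ≤ seq π n
      b≤π = N , λ n N≤n → ≤-respˡ (+-identityˡ b) (h n N≤n)
      bounded : ∃[ B ] (0ℚ < B × Eventually λ n → ∣ seq π n ∣ ≤ B)
      bounded = cauchy⇒bounded {seq π} (cauchy π)
      π≤B : Eventually λ n → seq π n ≤ proj₁ bounded
      π≤B = eventually-map {λ n → ∣ seq π n ∣ ≤ proj₁ bounded} (λ n → ∣p∣≤⇒≤) (proj₂ (proj₂ bounded))

  -- Linear relations among monomials of different magnitude

  ∣sum∣≤ : ∀ k (v : Fin k → ℚ) {e} → (∀ i → ∣ v i ∣ ≤ e) → ∣ sum v ∣ ≤ ι k * e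
  ∣sum∣≤ zero    v {e} _ = ≤-reflexive (sym (trans (cong (_* e) ι0≡0) (*-zeroˡ e)))
  ∣sum∣≤ (suc k) v {e} h = ≤-trans (∣p+q∣≤∣p∣+∣q∣ (v zero) (sum (v ∘ suc)))
    (≤-trans (+-mono-≤ (h zero) (∣sum∣≤ k (v ∘ suc) (λ i → h (suc i))))
      (≤-reflexive (trans (lemma e (ι k)) (cong (_* e) (sym (ι-suc k))))))
    where
    lemma : ∀ e i → e + i * e ≡ (1ℚ + i) * e
    lemma = solve-∀ solver-ring

  -- v j is the whole sum minus the k - 1 other terms; adding `e` on the left avoids the subtraction
  -- k - 1.
  summand-bound : ∀ {k} (v : Fin k → ℚ) j {s e} → ∣ sum v ∣ ≤ s → (∀ i → i ≢ j → ∣ v i ∣ ≤ e) →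
    ∣ v j ∣ + e ≤ s + ι k * e
  summand-bound {suc k} v zero {s} {e} ∣Σ∣≤ others = begin
    ∣ v zero ∣ + e
      ≡⟨ cong (λ t → ∣ t ∣ + e) (lemma (v zero) (sum (v ∘ suc))) ⟩
    ∣ sum v - sum (v ∘ suc) ∣ + e
      ≤⟨ +-monoˡ-≤ e (≤-trans (∣p-q∣≤∣p∣+∣q∣ (sum v) (sum (v ∘ suc)))
           (+-mono-≤ ∣Σ∣≤ (∣sum∣≤ k (v ∘ suc) (λ i → others (suc i) (λ ()))))) ⟩
    s + ι k * e + e                    ≡⟨ lemma₂ s (ι k) e ⟩
    s + (1ℚ + ι k) * e                 ≡⟨ cong (λ t → s + t * e) (sym (ι-suc k)) ⟩
    s + ι (suc k) * e ∎
    where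
    open ≤-Reasoning
    lemma : ∀ a b → a ≡ a + b - b
    lemma = solve-∀ solver-ring
    lemma₂ : ∀ s i e → s + i * e + e ≡ s + (1ℚ + i) * e
    lemma₂ = solve-∀ solver-ring
  summand-bound {suc k} v (suc j) {s} {e} ∣Σ∣≤ others = begin
    ∣ v (suc j) ∣ + e
      ≤⟨ summand-bound (v ∘ suc) j {s + e}
           (≤-respˡ (cong ∣_∣ (sym (lemma (v zero) (sum (v ∘ suc)))))
             (≤-trans (∣p-q∣≤∣p∣+∣q∣ (sum v) (v zero)) (+-mono-≤ ∣Σ∣≤ (others zero (λ ())))))
           (λ i i≢j → others (suc i) (λ eq → i≢j (Fin.suc-injective eq))) ⟩
    s + e + ι k * e                    ≡⟨ lemma₂ s (ι k) e ⟩
    s + (1ℚ + ι k) * e                 ≡⟨ cong (λ t → s + t * e) (sym (ι-suc k)) ⟩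
    s + ι (suc k) * e ∎
    where
    open ≤-Reasoning
    lemma : ∀ a b → b ≡ a + b - a
    lemma = solve-∀ solver-ring
    lemma₂ : ∀ s i e → s + e + i * e ≡ s + (1ℚ + i) * e
    lemma₂ = solve-∀ solver-ring

  common-bound : ∀ {k} (γ : Fin k → ℕ → ℚ) → (∀ j → IsCauchy (γ j)) →
    ∃[ C ] (0ℚ ≤ C × Eventually λ n → ∀ j → ∣ γ j n ∣ ≤ C)
  common-bound {zero}  γ _   = 0ℚ , ≤-refl , 0 , λ _ _ ()
  common-bound {suc k} γ cau =
    let B , 0<B , h = cauchy⇒bounded {γ zero} (cau zero)
        C , 0≤C , h′ = common-bound (γ ∘ suc) (cau ∘ suc)
    in B + C , 0≤+ (<⇒≤ 0<B) 0≤C , eventually-zip {λ n → ∣ γ zero n ∣ ≤ B} {λ n → ∀ j → ∣ γ (suc j) n ∣ ≤ C}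
      (λ n a b → λ { zero    → ≤-trans a (≤-respˡ (+-identityʳ B) (+-monoʳ-≤ B 0≤C))
                   ; (suc j) → ≤-trans (b j) (≤-respˡ (+-identityˡ C) (+-monoˡ-≤ C (<⇒≤ 0<B))) }) h h′

  module Independence {k : ℕ} (p A : ℕ) (a b : Fin k → ℕ) (a≤A : ∀ j → a j ℕ.≤ A)
    (distinct : ∀ i j → a i ≡ a j → b i ≡ b j → i ≡ j) (γ : Fin k → ℕ → ℚ) (γ-cauchy : ∀ j → IsCauchy (γ j))
    (relation : ∀ δ → 0ℚ < δ → δ ≤ 1ℚ → ∃[ σ ] ∃ λ (x : ℕ → ℚ) → ∃ λ (y : ℕ → ℚ) → (0ℚ < σ
      × Eventually (λ n → Magnitudes p A δ σ (x n) (y n))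
      × (λ n → sum (λ j → γ j n * (x n ^ a j * y n ^ b j))) ≃ₛ (λ _ → 0ℚ))) where

    -- The level is the exponent of Y after X is replaced by Yᵖ. The key encodes the lexicographic
    -- order of (level , a) in one number, using a ≤ A; smaller keys belong to larger monomials.
    level key : Fin k → ℕ
    level j = p ℕ.* a j ℕ.+ b j
    key j = level j ℕ.* suc A ℕ.+ a j

    level<⇒key< : ∀ i j → level i ℕ.< level j → key i ℕ.< key j
    level<⇒key< i j lt = ℕ.≤-trans (s≤s (ℕ.+-monoʳ-≤ (level i ℕ.* suc A) (a≤A i)))
      (ℕ.≤-trans (ℕ.≤-reflexive (trans (sym (ℕ.+-suc (level i ℕ.* suc A) A)) (ℕ.+-comm (level i ℕ.* suc A) (suc A))))
        (ℕ.≤-trans (ℕ.*-monoˡ-≤ (suc A) lt) (ℕ.m≤m+n _ (a j))))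

    power<⇒key< : ∀ i j → level i ≡ level j → a i ℕ.< a j → key i ℕ.< key j
    power<⇒key< i j eq lt = ℕ.≤-trans (ℕ.≤-reflexive (sym (ℕ.+-suc (level i ℕ.* suc A) (a i))))
      (ℕ.≤-trans (ℕ.+-monoʳ-≤ (level i ℕ.* suc A) lt) (ℕ.≤-reflexive (cong (λ l → l ℕ.* suc A ℕ.+ a j) eq)))

    module Step (j : Fin k) (lower : ∀ i → key i ℕ.< key j → γ i ≃ₛ (λ _ → 0ℚ))
      (κ : ℚ) (0<κ : 0ℚ < κ) (away : Eventually λ n → κ ≤ ∣ γ j n ∣) where

      abstract
        μ-data : ∃[ μ ] (0ℚ < μ × ι (suc k) * μ ≤ ½ * κ)
        μ-data = small-multiple (0≤ι (suc k)) (0<½* 0<κ)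

        C-data : ∃[ C ] (0ℚ ≤ C × Eventually λ n → ∀ i → ∣ γ i n ∣ ≤ C)
        C-data = common-bound γ γ-cauchy

      μ C : ℚ
      μ = proj₁ μ-data
      C = proj₁ C-data
      0<μ : 0ℚ < μ
      0<μ = proj₁ (proj₂ μ-data)
      0≤C : 0ℚ ≤ C
      0≤C = proj₁ (proj₂ C-data)

      abstract
        δ-data : ∃[ δ ] (0ℚ < δ × δ ≤ 1ℚ × C * δ ≤ μ)
        δ-data =
          let δ₁ , 0<δ₁ , Cδ₁≤μ = small-multiple 0≤C 0<μ
              δ , 0<δ , δ≤δ₁ , δ≤1 = min-pos 0<δ₁ (positive⁻¹ 1ℚ)
          in δ , 0<δ , δ≤1 , ≤-trans (*-monoˡ-≤ 0≤C δ≤δ₁) Cδ₁≤μ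

      δ : ℚ
      δ = proj₁ δ-data
      0<δ : 0ℚ < δ
      0<δ = proj₁ (proj₂ δ-data)
      δ≤1 : δ ≤ 1ℚ
      δ≤1 = proj₁ (proj₂ (proj₂ δ-data))
      Cδ≤μ : C * δ ≤ μ
      Cδ≤μ = proj₂ (proj₂ (proj₂ δ-data))

      contradictory : ∀ {σ} (x y : ℕ → ℚ) → 0ℚ < σ → Eventually (λ n → Magnitudes p A δ σ (x n) (y n)) →
        (λ n → sum (λ j → γ j n * (x n ^ a j * y n ^ b j))) ≃ₛ (λ _ → 0ℚ) → ⊥
      contradictory {σ} x y 0<σ mags sum≃0 = absurd (eventually-witness
        (eventually-zip {λ n → Magnitudes p A δ σ (x n) (y n)} {Rest} (λ _ → _,_) mags rest))
        where
        T : Fin k → ℕ → ℚ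
        T i n = x n ^ a i * y n ^ b i
        -- Monomials of lower key may be far larger than Tⱼ, so their coefficients must be small
        -- compared with Tⱼ itself. This works because `ρ` lies below Tⱼ at every stage where the
        -- magnitudes hold, and does not change with n.
        ρ ε : ℚ
        ρ = σ ^ a j * σ ^ b j
        ε = μ * ρ
        0<ε : 0ℚ < ε
        0<ε = 0<* 0<μ (0<* (0<^ (a j) 0<σ) (0<^ (b j) 0<σ))
        Rest₂ Rest₁ Rest : ℕ → Set
        Rest₂ n = ∀ i → key i ℕ.< key j → ∣ γ i n - 0ℚ ∣ < ε
        Rest₁ n = (∣ sum (λ i → γ i n * T i n) - 0ℚ ∣ < ε) × Rest₂ n
        Rest n = (κ ≤ ∣ γ j n ∣ × (∀ i → ∣ γ i n ∣ ≤ C)) × Rest₁ n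
        lower-small : ∀ i → Eventually λ n → key i ℕ.< key j → ∣ γ i n - 0ℚ ∣ < ε
        lower-small i with key i ℕ.<? key j
        ... | yes lt = let N , h = lower i lt ε 0<ε in N , λ n N≤n _ → h n N≤n
        ... | no ¬lt = 0 , λ n _ lt → contradiction lt ¬lt
        rest : Eventually Rest
        rest = eventually-zip {λ n → κ ≤ ∣ γ j n ∣ × (∀ i → ∣ γ i n ∣ ≤ C)} {Rest₁} (λ _ → _,_)
          (eventually-zip {λ n → κ ≤ ∣ γ j n ∣} {λ n → ∀ i → ∣ γ i n ∣ ≤ C} (λ _ → _,_) away (proj₂ (proj₂ C-data)))
          (eventually-zip {λ n → ∣ sum (λ i → γ i n * T i n) - 0ℚ ∣ < ε} {Rest₂} (λ _ → _,_) (sum≃0 ε 0<ε) (eventually-Fin lower-small))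
        p-0≡p : ∀ t → t - 0ℚ ≡ t
        p-0≡p = solve-∀ solver-ring
        absurd : ∃[ n ] (Magnitudes p A δ σ (x n) (y n) × Rest n) → ⊥
        -- Since all other terms and the sum are at most μTⱼ, it follows that κTⱼ ≤ ∣γⱼ∣Tⱼ ≤ (k +
        -- 1)μTⱼ ≤ ½κTⱼ, although Tⱼ > 0.
        absurd (n , M , (κ≤ , γ≤C) , Σ< , low) = <-irrefl refl (<-≤-trans (½*p<p (0<* 0<κ 0<Tⱼ))
            (≤-trans (≤-trans (*-monoʳ-≤ 0≤Tⱼ κ≤) (≤-respˡ (∣γT∣ j) (≤-trans
                (≤-respˡ (+-identityʳ ∣ γ j n * T j n ∣) (+-monoʳ-≤ ∣ γ j n * T j n ∣ 0≤e)) bound)))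
              (≤-trans (≤-reflexive (trans (lemma (ι k) e) (trans (cong (_* e) (sym (ι-suc k))) (sym (*-assoc (ι (suc k)) μ (T j n))))))
                (≤-trans (*-monoʳ-≤ 0≤Tⱼ (proj₂ (proj₂ μ-data))) (≤-reflexive (*-assoc ½ κ (T j n)))))))
          where
          open Domination {p} {A} {δ} {σ} {x n} {y n} (<⇒≤ 0<δ) δ≤1 (<⇒≤ 0<σ) M
          e : ℚ
          e = μ * T j n
          0<Tⱼ : 0ℚ < T j n
          0<Tⱼ = <-≤-trans (0<* (0<^ (a j) 0<σ) (0<^ (b j) 0<σ)) (ρ^≤monomial (a j) (b j))
          0≤Tⱼ : 0ℚ ≤ T j n
          0≤Tⱼ = <⇒≤ 0<Tⱼ
          0≤e : 0ℚ ≤ e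
          0≤e = 0≤* (<⇒≤ 0<μ) 0≤Tⱼ
          ε≤e : ε ≤ e
          ε≤e = *-monoˡ-≤ (<⇒≤ 0<μ) (ρ^≤monomial (a j) (b j))
          lemma : ∀ i e → e + i * e ≡ (1ℚ + i) * e
          lemma = solve-∀ solver-ring
          ∣γT∣ : ∀ i → ∣ γ i n * T i n ∣ ≡ ∣ γ i n ∣ * T i n
          ∣γT∣ i = trans (∣p*q∣≡∣p∣*∣q∣ (γ i n) (T i n)) (cong (∣ γ i n ∣ *_) (0≤p⇒∣p∣≡p (0≤monomial (a i) (b i))))
          by-lower : ∀ i → key i ℕ.< key j → ∣ γ i n * T i n ∣ ≤ e
          by-lower i lt = ≤-respˡ (sym (∣γT∣ i)) (≤-trans (p*q≤p (0≤∣p∣ (γ i n)) (monomial≤1 (a i) (b i)))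
            (≤-trans (≤-respˡ (cong ∣_∣ (p-0≡p (γ i n))) (<⇒≤ (low i lt))) ε≤e))
          by-domination : ∀ i → T i n ≤ δ * T j n → ∣ γ i n * T i n ∣ ≤ e
          by-domination i le = ≤-respˡ (sym (∣γT∣ i)) (≤-trans (*-mono-≤ (0≤∣p∣ (γ i n)) (γ≤C i) (0≤monomial (a i) (b i)) le)
            (≤-respˡ (*-assoc C δ (T j n)) (*-monoʳ-≤ 0≤Tⱼ Cδ≤μ)))
          others : ∀ i → i ≢ j → ∣ γ i n * T i n ∣ ≤ e
          others i i≢j with ℕ.<-cmp (level i) (level j)
          ... | tri< lt _ _ = by-lower i (level<⇒key< i j lt)
          ... | tri> _ _ gt = by-domination i (dominated-level {a j} {b j} {a i} {b i} (a≤A j) gt)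
          ... | tri≈ _ eq _ with ℕ.<-cmp (a i) (a j)
          ...   | tri< lt _ _ = by-lower i (power<⇒key< i j eq lt)
          ...   | tri> _ _ gt = by-domination i (dominated-power {a j} {b j} {a i} {b i} (sym eq) gt)
          ...   | tri≈ _ a≡ _ = contradiction (distinct i j a≡
                    (ℕ.+-cancelˡ-≡ (p ℕ.* a j) (b i) (b j) (trans (cong (λ t → p ℕ.* t ℕ.+ b i) (sym a≡)) eq))) i≢j
          bound : ∣ γ j n * T j n ∣ + e ≤ e + ι k * e
          bound = summand-bound (λ i → γ i n * T i n) j
            (≤-trans (≤-respˡ (cong ∣_∣ (p-0≡p (sum (λ i → γ i n * T i n)))) (<⇒≤ Σ<)) ε≤e) others

      step : ⊥
      step = let σ , x , y , 0<σ , mags , sum≃0 = relation δ 0<δ δ≤1 in contradictory x y 0<σ mags sum≃0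

    -- Induction on the key removes the larger monomials first; `Step` refutes that the coefficient
    -- is bounded away from 0, and for a Cauchy sequence this is convergence to 0.
    coefficients-vanish : ∀ j → γ j ≃ₛ (λ _ → 0ℚ)
    coefficients-vanish j = go j (<-wellFounded (key j))
      where
      go : ∀ j → Acc ℕ._<_ (key j) → γ j ≃ₛ (λ _ → 0ℚ)
      go j (acc rs) = cauchy-≃ₛ0 {γ j} (γ-cauchy j) (λ κ 0<κ away → Step.step j (λ i lt → go i (rs lt)) κ 0<κ away)

  -- Uniqueness of η and of the powers

  IsExp-unique : ∀ {z z′ w w′} → z ≈ z′ → IsExp z w → IsExp z′ w′ → w ≈ w′
  IsExp-unique {z} {z′} {w} {w′} z≈ lim lim′ = ⟶-unique
    {λ N → ℂ.sum {N} λ n → ℚ→ℂ 1/ toℕ n ! ℂ.* z ℂ.^ toℕ n} {λ N → ℂ.sum {N} λ n → ℚ→ℂ 1/ toℕ n ! ℂ.* z′ ℂ.^ toℕ n}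
    {w} {w′} lim lim′ (λ N →
      ℂ-sum-cong N (λ n → ℚ→ℂ 1/ toℕ n ! ℂ.* z ℂ.^ toℕ n) (λ n → ℚ→ℂ 1/ toℕ n ! ℂ.* z′ ℂ.^ toℕ n) (λ j →
        ℂ-*-cong {ℚ→ℂ 1/ toℕ j !} {ℚ→ℂ 1/ toℕ j !} {z ℂ.^ toℕ j} {z′ ℂ.^ toℕ j} (≈-refl (ℚ→ℂ 1/ toℕ j !))
          (ℂ-^-cong (toℕ j) {z} {z′} z≈)))

  -- By minimality neither number is below the other.
  IsPi-unique : ∀ {π π′} → IsPi π → IsPi π′ → π ≈ℝ π′
  IsPi-unique {π} {π′} (0<π , e , least) (0<π′ , e′ , least′) =
    ≮∧≯⇒≈ℝ {π} {π′} (λ π<π′ → least′ π 0<π π<π′ e) (λ π′<π → least π′ 0<π′ π′<π e′)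

  2πi*-cong : ∀ {π π′} z → π ≈ℝ π′ → 2πi* π z ≈ 2πi* π′ z
  2πi*-cong {π} {π′} z π≈ = ℂ-*-cong {ℤ→ℂ (ℤ.+ 2) ℂ.* ℝ→ℂ π ℂ.* i} {ℤ→ℂ (ℤ.+ 2) ℂ.* ℝ→ℂ π′ ℂ.* i} {z} {z}
    (ℂ-*-cong {ℤ→ℂ (ℤ.+ 2) ℂ.* ℝ→ℂ π} {ℤ→ℂ (ℤ.+ 2) ℂ.* ℝ→ℂ π′} {i} {i}
      (ℂ-*-cong {ℤ→ℂ (ℤ.+ 2)} {ℤ→ℂ (ℤ.+ 2)} {ℝ→ℂ π} {ℝ→ℂ π′} (≈-refl (ℤ→ℂ (ℤ.+ 2))) (π≈ , ≈ℝ-refl {0ℝ}))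
      (≈-refl i))
    (≈-refl z)

  EtaLimit-unique : ∀ {u u′ v v′ w w′} → u ≈ u′ → v ≈ v′ → EtaLimit u v w → EtaLimit u′ v′ w′ → w ≈ w′
  EtaLimit-unique {u} {u′} {v} {v′} {w} {w′} u≈ v≈
    (q , r , exp-q , exp-r , limit) (q′ , r′ , exp-q′ , exp-r′ , limit′) =
    ⟶-unique {etaPartial r q} {etaPartial r′ q′} {w} {w′}
      (etaPartial-limit {r} {q} {w} limit) (etaPartial-limit {r′} {q′} {w′} limit′) (etaPartial-cong {r} {r′} {q} {q′}
      (IsExp-unique {v} {v′} {r} {r′} v≈ exp-r exp-r′) (IsExp-unique {u} {u′} {q} {q′} u≈ exp-q exp-q′))

  Same : ℂ → ℂ → Set
  Same z w = ∀ n → seq (re z) n ≡ seq (re w) n × seq (im z) n ≡ seq (im w) n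

  Same⇒≈ : ∀ {z w} → Same z w → z ≈ w
  Same⇒≈ {z} {w} h = ≗⇒≈ z w (λ n → proj₁ (h n)) (λ n → proj₂ (h n))

  Same-real : ∀ {z w n a} → Same z w → RealAt n w a → RealAt n z a
  Same-real {z} {w} {n} h (realAt p q) = realAt (trans (proj₁ (h n)) p) (trans (proj₂ (h n)) q)

  EtaLimitAt : ℝ → ℂ → ℂ → Set
  EtaLimitAt π z w = ∃[ q ] ∃[ r ]
    ( IsExp (ℤ→ℂ (ℤ.+ 2) ℂ.* ℝ→ℂ π ℂ.* i ℂ.* z) q
    × IsExp (ℚ→ℂ (ℤ.+ 1 / 24) ℂ.* (ℤ→ℂ (ℤ.+ 2) ℂ.* ℝ→ℂ π ℂ.* i ℂ.* z)) r
    × PartialLimit r q w)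

  2πi/24* : ℝ → ℂ → ℂ
  2πi/24* π z = ℚ→ℂ (ℤ.+ 1 / 24) ℂ.* 2πi* π z

  -- u and v agree with 2πiz and 2πiz/24 term by term, which is cheaper to use than equality in ℂ.
  EtaLimitOf : ℝ → ℂ → ℂ → Set
  EtaLimitOf π z w = ∃[ u ] ∃[ v ] (Same u (2πi* π z) × Same v (2πi/24* π z) × EtaLimit u v w)

  etaLimit : ∀ {π z w} → EtaLimitAt π z w → EtaLimitOf π z w
  etaLimit {π} {z} h =
    ℤ→ℂ (ℤ.+ 2) ℂ.* ℝ→ℂ π ℂ.* i ℂ.* z , ℚ→ℂ (ℤ.+ 1 / 24) ℂ.* (ℤ→ℂ (ℤ.+ 2) ℂ.* ℝ→ℂ π ℂ.* i ℂ.* z)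
    , (λ n → refl , refl) , (λ n → refl , refl) , h

  IsEta⇒EtaLimitAt : ∀ {η} (isη : IsEta η) z → EtaLimitAt (proj₁ isη) (point z) (η ⟨ z ⟩)
  IsEta⇒EtaLimitAt isη z = proj₂ (proj₂ isη) z

  IsEta⇒EtaLimitOf : ∀ {η} (isη : IsEta η) z → EtaLimitOf (proj₁ isη) (point z) (η ⟨ z ⟩)
  IsEta⇒EtaLimitOf {η} isη z = etaLimit {proj₁ isη} {point z} {η ⟨ z ⟩} (IsEta⇒EtaLimitAt {η} isη z)

  EtaLimitOf-unique : ∀ {π π′ z w w′} → π ≈ℝ π′ → EtaLimitOf π z w → EtaLimitOf π′ z w′ → w ≈ w′
  EtaLimitOf-unique {π} {π′} {z} {w} {w′} π≈ (u , v , u= , v= , lim) (u′ , v′ , u′= , v′= , lim′) =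
    EtaLimit-unique {u} {u′} {v} {v′} {w} {w′} (via {u} {u′} {2πi* π z} {2πi* π′ z} u= u′= u≈)
      (via {v} {v′} {2πi/24* π z} {2πi/24* π′ z} v= v′= v≈) lim lim′
    where
    via : ∀ {a b c d} → Same a c → Same b d → c ≈ d → a ≈ b
    via {a} {b} {c} {d} p q e = ≈-trans a c b (Same⇒≈ {a} {c} p) (≈-trans c d b e (≈-sym b d (Same⇒≈ {b} {d} q)))
    u≈ : 2πi* π z ≈ 2πi* π′ z
    u≈ = 2πi*-cong {π} {π′} z π≈
    v≈ : 2πi/24* π z ≈ 2πi/24* π′ z
    v≈ = ℂ-*-cong {ℚ→ℂ (ℤ.+ 1 / 24)} {ℚ→ℂ (ℤ.+ 1 / 24)} {2πi* π z} {2πi* π′ z} (≈-refl (ℚ→ℂ (ℤ.+ 1 / 24))) u≈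

  -- Each quotient brings its own η, with its own π and its own exponentials; they must be
  -- identified before the quotients can enter one relation between monomials.
  IsEta-unique : ∀ {η η′} → IsEta η → IsEta η′ → η ≐ η′
  IsEta-unique {η} {η′} isη isη′ z = EtaLimitOf-unique {proj₁ isη} {proj₁ isη′} {point z} {η ⟨ z ⟩} {η′ ⟨ z ⟩}
    (IsPi-unique {proj₁ isη} {proj₁ isη′} (proj₁ (proj₂ isη)) (proj₁ (proj₂ isη′)))
    (IsEta⇒EtaLimitOf {η} isη z) (IsEta⇒EtaLimitOf {η′} isη′ z)

  private
    module ℂP = Powers ℂ-commutativeRing

  IsPower-cong : ∀ {w w′ u} k → w ≈ w′ → IsPower w k u → IsPower w′ k u
  IsPower-cong {w} {w′} {u} (ℤ.+ n)    w≈ h = ≈-trans u (w ℂ.^ n) (w′ ℂ.^ n) h (ℂ-^-cong n {w} {w′} w≈)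
  IsPower-cong {w} {w′} {u} -[1+ n ] w≈ h = ≈-trans (u ℂ.* w′ ℂ.^ suc n) (u ℂ.* w ℂ.^ suc n) 1ℂ
    (ℂ-*-cong {u} {u} {w′ ℂ.^ suc n} {w ℂ.^ suc n} (≈-refl u)
      (ℂ-^-cong (suc n) {w′} {w} (≈-sym w w′ w≈))) h

  IsPower-unique : ∀ {w u u′} k → IsPower w k u → IsPower w k u′ → u ≈ u′
  IsPower-unique {w} {u} {u′} (ℤ.+ n)    h h′ = ≈-trans u (w ℂ.^ n) u′ h (≈-sym u′ (w ℂ.^ n) h′)
  IsPower-unique {w} {u} {u′} -[1+ n ] h h′ = ℂP.inverse-unique {u} {u′} {w ℂ.^ suc n} h h′

  -- r + R, provided that r ≥ -R
  shift : ℕ → ℤ → ℕ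
  shift R (ℤ.+ n)  = n ℕ.+ R
  shift R -[1+ n ] = R ℕ.∸ suc n

  shift≤ : ∀ {R} r → ℤ.∣ r ∣ ℕ.≤ R → shift R r ℕ.≤ R ℕ.+ R
  shift≤ {R} (ℤ.+ n)  h = ℕ.+-monoˡ-≤ R h
  shift≤ {R} -[1+ n ] h = ℕ.≤-trans (ℕ.m∸n≤m R (suc n)) (ℕ.m≤m+n R R)

  -- After shifting, negative exponents lie below R and the others do not, so `shift` cannot confuse
  -- the signs.
  shift-sign : ∀ {R} m n → suc n ℕ.≤ R → R ℕ.∸ suc n ℕ.< m ℕ.+ R
  shift-sign {R} m n h = ℕ.<-≤-trans (ℕ.∸-monoʳ-< {R} {suc n} {0} (s≤s z≤n) h) (ℕ.m≤n+m R m)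

  shift-injective : ∀ {R} r s → ℤ.∣ r ∣ ℕ.≤ R → ℤ.∣ s ∣ ℕ.≤ R → shift R r ≡ shift R s → r ≡ s
  shift-injective {R} (ℤ.+ m)  (ℤ.+ n)  _ _ e = cong ℤ.+_ (ℕ.+-cancelʳ-≡ R m n e)
  shift-injective {R} (ℤ.+ m)  -[1+ n ] _ h e = contradiction e (ℕ.>⇒≢ (shift-sign m n h))
  shift-injective {R} -[1+ m ] (ℤ.+ n)  h _ e = contradiction e (ℕ.<⇒≢ (shift-sign n m h))
  shift-injective {R} -[1+ m ] -[1+ n ] h h′ e = cong -[1+_] (ℕ.suc-injective (ℕ.∸-cancelˡ-≡ h h′ e))

  IsPower-shift : ∀ {w u R} k → ℤ.∣ k ∣ ℕ.≤ R → IsPower w k u → u ℂ.* w ℂ.^ R ≈ w ℂ.^ shift R k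
  IsPower-shift {w} {u} {R} (ℤ.+ n)    _ h = ℂP.nonneg-shift {u} {w} n R h
  IsPower-shift {w} {u} {R} -[1+ n ] n<R h = ℂP.neg-shift {u} {w} (suc n) R n<R h

  Fin-bounded : ∀ {k} (f : Fin k → ℕ) → ∃[ B ] (∀ j → f j ℕ.≤ B)
  Fin-bounded {zero}  f = 0 , λ ()
  Fin-bounded {suc k} f =
    let B , h = Fin-bounded (f ∘ suc)
    in f zero ℕ.+ B , λ { zero → ℕ.m≤m+n (f zero) B ; (suc j) → ℕ.≤-trans (h j) (ℕ.m≤n+m B (f zero)) }

  -- Relations between real monomials, and removal of negative exponents

  re-sum : ∀ {k} (f : Fin k → ℂ) n → seq (re (ℂ.sum f)) n ≡ sum (λ j → seq (re (f j)) n)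
  re-sum {zero}  f n = refl
  re-sum {suc k} f n = cong (seq (re (f zero)) n +_) (re-sum (f ∘ suc) n)

  im-sum : ∀ {k} (f : Fin k → ℂ) n → seq (im (ℂ.sum f)) n ≡ sum (λ j → seq (im (f j)) n)
  im-sum {zero}  f n = refl
  im-sum {suc k} f n = cong (seq (im (f zero)) n +_) (im-sum (f ∘ suc) n)

  re-*-real : ∀ {n a} c w → RealAt n w a → seq (re (c ℂ.* w)) n ≡ seq (re c) n * a
  re-*-real {n} {a} c w h = trans (cong₂ (λ s t → seq (re c) n * s - seq (im c) n * t) (IsReal.re≡ h) (IsReal.im≡ h))
    (lemma (seq (re c) n) (seq (im c) n) a)
    where
    lemma : ∀ x y a → x * a - y * 0ℚ ≡ x * a
    lemma = solve-∀ solver-ring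

  im-*-real : ∀ {n a} c w → RealAt n w a → seq (im (c ℂ.* w)) n ≡ seq (im c) n * a
  im-*-real {n} {a} c w h = trans (cong₂ (λ s t → seq (re c) n * s + seq (im c) n * t) (IsReal.im≡ h) (IsReal.re≡ h))
    (lemma (seq (re c) n) (seq (im c) n) a)
    where
    lemma : ∀ x y a → x * 0ℚ + y * a ≡ y * a
    lemma = solve-∀ solver-ring

  sum-cong : ∀ {k} (f g : Fin k → ℚ) → (∀ j → f j ≡ g j) → sum f ≡ sum g
  sum-cong {zero}  f g e = refl
  sum-cong {suc k} f g e = cong₂ _+_ (e zero) (sum-cong (f ∘ suc) (g ∘ suc) (λ j → e (suc j)))

  ≃ₛ-respˡ : ∀ {f g h : ℕ → ℚ} → (∀ n → f n ≡ g n) → f ≃ₛ h → g ≃ₛ h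
  ≃ₛ-respˡ {h = h} e p ε 0<ε = let N , k = p ε 0<ε in N , λ n N≤n → subst (λ t → ∣ t - h n ∣ < ε) (e n) (k n N≤n)

  weighted : ∀ {k} → (Fin k → ℂ) → (Fin k → ℂ) → Fin k → ℂ
  weighted c w j = c j ℂ.* w j

  monomial : ∀ {k} → (Fin k → ℕ) → (Fin k → ℕ) → ℂ → ℂ → Fin k → ℂ
  monomial a b x y j = x ℂ.^ a j ℂ.* y ℂ.^ b j

  real-monomial : ∀ {k} (a b : Fin k → ℕ) x y j n →
    RealAt n (monomial a b (ℝ→ℂ x) (ℝ→ℂ y) j) (seq x n ^ a j * seq y n ^ b j)
  real-monomial a b x y j n = real-* {n} {seq x n ^ a j} {seq y n ^ b j} ((ℝ→ℂ x) ℂ.^ a j) ((ℝ→ℂ y) ℂ.^ b j)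
    (real-^ {n} {seq x n} (ℝ→ℂ x) (a j) (real-ℝ n x)) (real-^ {n} {seq y n} (ℝ→ℂ y) (b j) (real-ℝ n y))

  -- As the monomials are real, the relation splits into one for the real and one for the imaginary
  -- parts of the coefficients, and arguments by order of magnitude apply to each.
  relation-parts : ∀ {k} (c w : Fin k → ℂ) (M : Fin k → ℕ → ℚ) → (∀ j n → RealAt n (w j) (M j n)) →
    ℂ.sum (weighted c w) ≈ 0ℂ →
      (λ n → sum (λ j → seq (re (c j)) n * M j n)) ≃ₛ (λ _ → 0ℚ)
    × (λ n → sum (λ j → seq (im (c j)) n * M j n)) ≃ₛ (λ _ → 0ℚ)
  relation-parts c w M real (p , q) =
      ≃ₛ-respˡ {seq (re (ℂ.sum (weighted c w)))} {λ n → sum (λ j → seq (re (c j)) n * M j n)} {λ _ → 0ℚ}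
        (λ n → trans (re-sum (weighted c w) n) (sum-cong _ (λ j → seq (re (c j)) n * M j n)
          (λ j → re-*-real {n} (c j) (w j) (real j n)))) p
    , ≃ₛ-respˡ {seq (im (ℂ.sum (weighted c w)))} {λ n → sum (λ j → seq (im (c j)) n * M j n)} {λ _ → 0ℚ}
        (λ n → trans (im-sum (weighted c w) n) (sum-cong _ (λ j → seq (im (c j)) n * M j n)
          (λ j → im-*-real {n} (c j) (w j) (real j n)))) q

  scale-sum : ∀ {k} (f g : Fin k → ℂ) w → (∀ j → f j ℂ.* w ≈ g j) → ℂ.sum f ≈ 0ℂ → ℂ.sum g ≈ 0ℂ
  scale-sum f g w = ℂP.scale-sum f g w

  scale-term : ∀ {c f u v s t x y} → f ≈ u ℂ.* v → u ℂ.* s ≈ x → v ℂ.* t ≈ y → (c ℂ.* f) ℂ.* (s ℂ.* t) ≈ c ℂ.* (x ℂ.* y)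
  scale-term {c} {f} {u} {v} {s} {t} {x} {y} = ℂP.scale-term {c} {f} {u} {v} {s} {t} {x} {y}

  -- Multiplication by XᴿYᴿ shifts all exponents by `R`, which makes them natural numbers and
  -- preserves their differences.
  scaled-relation : ∀ {k} (c w u v : Fin k → ℂ) (X Y : ℂ) R (a b : Fin k → ℕ) → (∀ j → w j ≈ u j ℂ.* v j) →
    (∀ j → u j ℂ.* X ℂ.^ R ≈ X ℂ.^ a j) → (∀ j → v j ℂ.* Y ℂ.^ R ≈ Y ℂ.^ b j) →
    ℂ.sum (weighted c w) ≈ 0ℂ → ℂ.sum (weighted c (monomial a b X Y)) ≈ 0ℂ
  scaled-relation c w u v X Y R a b w≈ u≈ v≈ = scale-sum (weighted c w) (weighted c (monomial a b X Y)) (X ℂ.^ R ℂ.* Y ℂ.^ R)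
    (λ j → scale-term {c j} {w j} {u j} {v j} {X ℂ.^ R} {Y ℂ.^ R} {X ℂ.^ a j} {Y ℂ.^ b j} (w≈ j) (u≈ j) (v≈ j))

  cusp-magnitudes : ∀ {p A} .{{_ : ℕ.NonZero p}} {δ} → 1 ℕ.< p → 0ℚ < δ → δ ≤ 1ℚ →
    ∀ m .{{_ : ℕ.NonZero m}} {c} → c ≡ recip m → ∀ π → 0ℝ <ℝ π →
    ∃[ t ] (0ℚ < t × (∀ {u v u′ v′ X Y} z z′ →
      (∀ n → seq (re z) n ≡ 0ℚ) → (∀ n → seq (im z) n ≡ t) →
      (∀ n → seq (re z′) n ≡ 0ℚ) → (∀ n → seq (im z′) n ≡ ι p * t) →
      Same u (2πi* π z) → Same v (ℚ→ℂ c ℂ.* 2πi* π z) → Same u′ (2πi* π z′) → Same v′ (ℚ→ℂ c ℂ.* 2πi* π z′) →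
      EtaLimit u v X → EtaLimit u′ v′ Y →
      seq (im X) ≃ₛ (λ _ → 0ℚ) × seq (im Y) ≃ₛ (λ _ → 0ℚ) ×
        ∃[ σ ] (0ℚ < σ × Eventually λ n → Magnitudes p A δ σ (seq (re X) n) (seq (re Y) n))))
  cusp-magnitudes {p} {A} {δ} 1<p 0<δ δ≤1 m {c} c≡ π 0<π =
    let t , 0<t , near = eta-near-cusp {p} {A} {δ} 1<p 0<δ δ≤1 m π 0<π
    in t , 0<t , λ {u} {v} {u′} {v′} {X} {Y} z z′ re-z im-z re-z′ im-z′ u= v= u′= v′= →
      near {u} {v} {u′} {v′} {X} {Y}
        (λ n → Same-real {u} {2πi* π z} {n} u= (real-2πiz m p c≡ π t z re-z im-z n))
        (λ n → Same-real {v} {ℚ→ℂ c ℂ.* 2πi* π z} {n} v= (real-c2πiz m p c≡ π t z re-z im-z n))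
        (λ n → Same-real {u′} {2πi* π z′} {n} u′= (real-2πipz m p c≡ π t z′ re-z′ im-z′ n))
        (λ n → Same-real {v′} {ℚ→ℂ c ℂ.* 2πi* π z′} {n} v′= (real-c2πipz m p c≡ π t z′ re-z′ im-z′ n))

  QuotientAt : ℤ → ℤ → ℂ → ℂ → ℂ → Set
  QuotientAt r s x y w = ∃[ u ] ∃[ v ] (IsPower x r u × IsPower y s v × w ≈ u ℂ.* v)

  QuotientAt-cong : ∀ {r s x x′ y y′ w} → x ≈ x′ → y ≈ y′ → QuotientAt r s x y w → QuotientAt r s x′ y′ w
  QuotientAt-cong {r} {s} {x} {x′} {y} {y′} x≈ y≈ (u , v , pu , pv , w≈) =
    u , v , IsPower-cong {x} {x′} {u} r x≈ pu , IsPower-cong {y} {y′} {v} s y≈ pv , w≈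

  QuotientAt-unique : ∀ {r s x y w w′} → QuotientAt r s x y w → QuotientAt r s x y w′ → w ≈ w′
  QuotientAt-unique {r} {s} {x} {y} {w} {w′} (u , v , pu , pv , w≈) (u′ , v′ , pu′ , pv′ , w′≈) =
    ≈-trans w (u ℂ.* v) w′ w≈ (≈-trans (u ℂ.* v) (u′ ℂ.* v′) w′
      (ℂ-*-cong {u} {u′} {v} {v′} (IsPower-unique {x} {u} {u′} r pu pu′) (IsPower-unique {y} {v} {v′} s pv pv′))
      (≈-sym w′ (u′ ℂ.* v′) w′≈))

  IsPower-shift-≡ : ∀ {w u R e} k → e ≡ shift R k → ℤ.∣ k ∣ ℕ.≤ R → IsPower w k u → u ℂ.* w ℂ.^ R ≈ w ℂ.^ e
  IsPower-shift-≡ {w} {u} {R} k refl = IsPower-shift {w} {u} {R} k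

  monomial-relation : ∀ {k} (c w u v : Fin k → ℂ) (r s : Fin k → ℤ) (X Y : ℂ) R (a b : Fin k → ℕ) →
    (∀ j → a j ≡ shift R (r j)) → (∀ j → b j ≡ shift R (s j)) →
    (∀ j → ℤ.∣ r j ∣ ℕ.≤ R) → (∀ j → ℤ.∣ s j ∣ ℕ.≤ R) →
    (∀ j → IsPower X (r j) (u j) × IsPower Y (s j) (v j) × w j ≈ u j ℂ.* v j) →
    ℂ.sum (weighted c w) ≈ 0ℂ → ℂ.sum (weighted c (monomial a b X Y)) ≈ 0ℂ
  monomial-relation c w u v r s X Y R a b a≡ b≡ r≤R s≤R powers = scaled-relation c w u v X Y R a b
    (λ j → proj₂ (proj₂ (powers j)))
    (λ j → IsPower-shift-≡ {X} {u j} {R} {a j} (r j) (a≡ j) (r≤R j) (proj₁ (powers j)))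
    (λ j → IsPower-shift-≡ {Y} {v j} {R} {b j} (s j) (b≡ j) (s≤R j) (proj₁ (proj₂ (powers j))))

  quotient-relation : ∀ {k} (c w : Fin k → ℂ) (r s : Fin k → ℤ) (X Y : ℂ) R (a b : Fin k → ℕ) →
    (∀ j → a j ≡ shift R (r j)) → (∀ j → b j ≡ shift R (s j)) →
    (∀ j → ℤ.∣ r j ∣ ℕ.≤ R) → (∀ j → ℤ.∣ s j ∣ ℕ.≤ R) →
    (∀ j → QuotientAt (r j) (s j) X Y (w j)) →
    ℂ.sum (weighted c w) ≈ 0ℂ → ℂ.sum (weighted c (monomial a b X Y)) ≈ 0ℂ
  quotient-relation c w r s X Y R a b a≡ b≡ r≤R s≤R q =
    monomial-relation c w (λ j → proj₁ (q j)) (λ j → proj₁ (proj₂ (q j))) r s X Y R a b a≡ b≡ r≤R s≤R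
      (λ j → proj₂ (proj₂ (q j)))

  -- The linear relation evaluated near the cusp 0

  module Quotients {k : ℕ} (p : ℕ) .{{_ : ℕ.NonZero p}} (1<p : 1 ℕ.< p) (c : Fin k → ℂ) (w : ℍ → Fin k → ℂ)
    (r s : Fin k → ℤ) (π : ℝ) (0<π : 0ℝ <ℝ π) (E E′ : ℍ → ℂ) (pz : ℍ → ℂ)
    (re-pz : ∀ z n → seq (re (pz z)) n ≡ ι p * seq (re (point z)) n)
    (im-pz : ∀ z n → seq (im (pz z)) n ≡ ι p * seq (im (point z)) n)
    (E-limit : ∀ z → EtaLimitOf π (point z) (E z)) (E′-limit : ∀ z → EtaLimitOf π (pz z) (E′ z))
    (quotient : ∀ j z → QuotientAt (r j) (s j) (E z) (E′ z) (w z j))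
    (distinct : ∀ i j → r i ≡ r j → s i ≡ s j → i ≡ j)
    (relation : ∀ z → ℂ.sum (weighted c (w z)) ≈ 0ℂ) where

    private
      abstract
        R-data : ∃[ R ] (∀ j → ℤ.∣ r j ∣ ℕ.+ ℤ.∣ s j ∣ ℕ.≤ R)
        R-data = Fin-bounded (λ j → ℤ.∣ r j ∣ ℕ.+ ℤ.∣ s j ∣)
      R : ℕ
      R = proj₁ R-data
      r≤R : ∀ j → ℤ.∣ r j ∣ ℕ.≤ R
      r≤R j = ℕ.≤-trans (ℕ.m≤m+n _ _) (proj₂ R-data j)
      s≤R : ∀ j → ℤ.∣ s j ∣ ℕ.≤ R
      s≤R j = ℕ.≤-trans (ℕ.m≤n+m _ _) (proj₂ R-data j)
      a b : Fin k → ℕ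
      a j = shift R (r j)
      b j = shift R (s j)
      A : ℕ
      A = R ℕ.+ R

    relation-at : ∀ z (x y : ℝ) → E z ≈ ℝ→ℂ x → E′ z ≈ ℝ→ℂ y →
      ℂ.sum (weighted c (monomial a b (ℝ→ℂ x) (ℝ→ℂ y))) ≈ 0ℂ
    relation-at z x y x≈ y≈ = quotient-relation c (w z) r s (ℝ→ℂ x) (ℝ→ℂ y) R a b (λ _ → refl) (λ _ → refl) r≤R s≤R
      (λ j → QuotientAt-cong {r j} {s j} {E z} {ℝ→ℂ x} {E′ z} {ℝ→ℂ y} {w z j} x≈ y≈ (quotient j z)) (relation z)

    CuspRelation : ℚ → Set
    CuspRelation δ = ∃[ σ ] ∃[ x ] ∃[ y ] (0ℚ < σ
      × Eventually (λ n → Magnitudes p A δ σ (seq x n) (seq y n))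
      × (λ n → sum (λ j → seq (re (c j)) n * (seq x n ^ a j * seq y n ^ b j))) ≃ₛ (λ _ → 0ℚ)
      × (λ n → sum (λ j → seq (im (c j)) n * (seq x n ^ a j * seq y n ^ b j))) ≃ₛ (λ _ → 0ℚ))

    cusp-relation : ∀ δ → 0ℚ < δ → δ ≤ 1ℚ → CuspRelation δ
    cusp-relation δ 0<δ δ≤1 = conclude (cusp-magnitudes {p} {A} {δ} 1<p 0<δ δ≤1 24 {ℤ.+ 1 / 24} (sym (recip≡1/ 24))
        π 0<π)
      where
      conclude : ∃[ t ] (0ℚ < t × (∀ {u v u′ v′ X Y} z z′ →
        (∀ n → seq (re z) n ≡ 0ℚ) → (∀ n → seq (im z) n ≡ t) →
        (∀ n → seq (re z′) n ≡ 0ℚ) → (∀ n → seq (im z′) n ≡ ι p * t) →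
        Same u (2πi* π z) → Same v (2πi/24* π z) → Same u′ (2πi* π z′) → Same v′ (2πi/24* π z′) →
        EtaLimit u v X → EtaLimit u′ v′ Y →
        seq (im X) ≃ₛ (λ _ → 0ℚ) × seq (im Y) ≃ₛ (λ _ → 0ℚ) ×
          ∃[ σ ] (0ℚ < σ × Eventually λ n → Magnitudes p A δ σ (seq (re X) n) (seq (re Y) n)))) → CuspRelation δ
      conclude (t , 0<t , near) = at-z (E-limit z) (E′-limit z)
        where
        -- Both coordinates are constant rational sequences, so the stagewise conditions on the
        -- point hold by `refl`.
        z : ℍ
        z = mkℍ (0ℝ +i ℚ→ℝ t) (ε<ℝ 0<t)
        finish : seq (im (E z)) ≃ₛ (λ _ → 0ℚ) × seq (im (E′ z)) ≃ₛ (λ _ → 0ℚ) ×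
          ∃[ σ ] (0ℚ < σ × Eventually λ n → Magnitudes p A δ σ (seq (re (E z)) n) (seq (re (E′ z)) n)) →
          CuspRelation δ
        finish (im-x , im-y , σ , 0<σ , mags) = σ , x , y , 0<σ , mags , relation-parts {k} c (monomial a b (ℝ→ℂ x) (ℝ→ℂ y))
            (λ j n → seq x n ^ a j * seq y n ^ b j) (real-monomial a b x y)
            (relation-at z x y (≈-re {E z} im-x) (≈-re {E′ z} im-y))
          where
          x y : ℝ
          x = re (E z)
          y = re (E′ z)
        at-z : EtaLimitOf π (point z) (E z) → EtaLimitOf π (pz z) (E′ z) → CuspRelation δ
        at-z (u , v , u= , v= , lim) (u′ , v′ , u′= , v′= , lim′) =
          finish (near {u} {v} {u′} {v′} {E z} {E′ z} (point z) (pz z) (λ _ → refl) (λ _ → refl)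
            (λ n → trans (re-pz z n) (*-zeroʳ (ι p))) (im-pz z) u= v= u′= v′= lim lim′)

    private
      exponents-distinct : ∀ i j → a i ≡ a j → b i ≡ b j → i ≡ j
      exponents-distinct i j p q = distinct i j (shift-injective (r i) (r j) (r≤R i) (r≤R j) p)
        (shift-injective (s i) (s j) (s≤R i) (s≤R j) q)
      a≤A : ∀ j → a j ℕ.≤ A
      a≤A j = shift≤ (r j) (r≤R j)

    coefficients-zero : ∀ j → c j ≈ 0ℂ
    coefficients-zero j =
        Independence.coefficients-vanish p A a b a≤A exponents-distinct (λ j → seq (re (c j))) (λ j → cauchy (re (c j)))
          (λ δ 0<δ δ≤1 → let σ , x , y , 0<σ , mags , re≃ , im≃ = cusp-relation δ 0<δ δ≤1
                         in σ , seq x , seq y , 0<σ , mags , re≃) j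
      , Independence.coefficients-vanish p A a b a≤A exponents-distinct (λ j → seq (im (c j))) (λ j → cauchy (im (c j)))
          (λ δ 0<δ δ≤1 → let σ , x , y , 0<σ , mags , re≃ , im≃ = cusp-relation δ 0<δ δ≤1
                         in σ , seq x , seq y , 0<σ , mags , im≃) j

  -- Families of η-quotients, each with its own η

  module IndependenceOfQuotients (p : ℕ) .{{_ : ℕ.NonZero p}} (1<p : 1 ℕ.< p) where

    scaled : ℍ → ℍ
    scaled z = p · z

    re-scaled : ∀ z n → seq (re (point (scaled z))) n ≡ ι p * seq (re (point z)) n
    re-scaled z n = cong (_* seq (re (point z)) n) (sym (ι≡/1 p))

    im-scaled : ∀ z n → seq (im (point (scaled z))) n ≡ ι p * seq (im (point z)) n
    im-scaled z n = cong (_* seq (im (point z)) n) (sym (ι≡/1 p))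

    module _ {k : ℕ} (f : Fin k → Function) (f-quotient : ∀ j → IsEtaQuotient p (f j)) (f-injective : Injective _≡_ _≐_ f) where

      eta : Fin k → Function
      eta j = proj₁ (f-quotient j)
      r s : Fin k → ℤ
      r j = proj₁ (proj₂ (f-quotient j))
      s j = proj₁ (proj₂ (proj₂ (f-quotient j)))
      isEta : ∀ j → IsEta (eta j)
      isEta j = proj₁ (proj₂ (proj₂ (proj₂ (f-quotient j))))
      quotient : ∀ j z → QuotientAt (r j) (s j) (eta j ⟨ z ⟩) (eta j ⟨ scaled z ⟩) (f j ⟨ z ⟩)
      quotient j = proj₂ (proj₂ (proj₂ (proj₂ (f-quotient j))))
      quotient-at : ∀ i j z → QuotientAt (r j) (s j) (eta i ⟨ z ⟩) (eta i ⟨ scaled z ⟩) (f j ⟨ z ⟩)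
      quotient-at i j z = QuotientAt-cong {r j} {s j} {eta j ⟨ z ⟩} {eta i ⟨ z ⟩} {eta j ⟨ scaled z ⟩} {eta i ⟨ scaled z ⟩} {f j ⟨ z ⟩}
        (IsEta-unique {eta j} {eta i} (isEta j) (isEta i) z) (IsEta-unique {eta j} {eta i} (isEta j) (isEta i) (scaled z)) (quotient j z)
      -- Uniqueness of η and of integer powers makes quotients with the same exponents equal as
      -- functions, and the family is injective.
      distinct : ∀ i j → r i ≡ r j → s i ≡ s j → i ≡ j
      distinct i j r≡ s≡ = f-injective λ z → QuotientAt-unique {r j} {s j} {eta j ⟨ z ⟩} {eta j ⟨ scaled z ⟩} {f i ⟨ z ⟩} {f j ⟨ z ⟩}
        (subst₂ (λ r s → QuotientAt r s (eta j ⟨ z ⟩) (eta j ⟨ scaled z ⟩) (f i ⟨ z ⟩)) {r i} {r j} {s i} {s j} r≡ s≡ (quotient-at j i z))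
        (quotient j z)

      independent : (c : Fin k → ℂ) → (∀ z → ℂ.sum (λ j → c j ℂ.* f j ⟨ z ⟩) ≈ 0ℂ) → ∀ j → c j ≈ 0ℂ
      -- The η of `f j` serves for the whole family; the given index `j` also ensures that there is
      -- one.
      independent c relation j = Quotients.coefficients-zero {k} p 1<p c (λ z j → f j ⟨ z ⟩) r s
        (proj₁ (isEta j)) (proj₁ (proj₁ (proj₂ (isEta j))))
        (λ z → eta j ⟨ z ⟩) (λ z → eta j ⟨ scaled z ⟩) (λ z → point (scaled z)) re-scaled im-scaled
        (λ z → IsEta⇒EtaLimitOf {eta j} (isEta j) z) (λ z → IsEta⇒EtaLimitOf {eta j} (isEta j) (scaled z))
        (quotient-at j) distinct relation j

open EtaQuotients.IndependenceOfQuotients using (independent)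
open import Defs
open import Data.Integer using (ℤ)
open import Data.Nat using (ℕ; _<_; s≤s; z≤n)
open import Data.Nat.Primality using (Prime; prime⇒nonZero)
open import Data.Nat.Properties using (≤-trans)
open import Data.Product using (_×_; proj₁)

theorem5p5 : (p : ℕ) (p-prime : Prime p) → 3 < p → (k : ℤ) →
    LinearlyIndependent (λ f →
    IsEtaQuotient p {{prime⇒nonZero p-prime}} f × IsModularForm k (Γ₁ p) f)
theorem5p5 p p-prime 3<p k n f f∈S f-injective =
  independent p {{prime⇒nonZero p-prime}} (≤-trans (s≤s (s≤s z≤n)) 3<p) f (λ j → proj₁ (f∈S j)) f-injective
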